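{- For every $n\ge 1$, each fiber of the map $\gamma:S_n\to\mathrm{gRec}_n$ is a congruence class of the congruence $\Gamma$ on the weak order on $S_n$. In particular, each fiber of $\gamma$ contains a unique $2$-clumped permutation.
   Context: **Permutations.** Permutations $x\in S_n$ are written in one-line notation $x=x_1x_2\cdots x_n$. The weak order on $S_n$ is the lattice whose cover relations are $x\lessdot y$ where, for some $i$, $x_i=y_{i+1}<y_i=x_{i+1}$ and $x_j=y_j$ for $j\notin\{i,i+1\}$. A descent of $x$ is a pair of adjacent entries $x_i>x_{i+1}$. A *clump* associated to the descent $x_i>x_{i+1}$ is a nonempty maximal sequence of consecutive integers (values) strictly between $x_{i+1}$ and $x_i$, all of which occur in $x$ on the same side of the adjacent entries $x_ix_{i+1}$ (all to the left of $x_i$ or all to the right of $x_{i+1}$; no requirement on their positions relative to each other). A permutation is *$2$-clumped* if each of its descents has at most $2$ clumps. (Equivalently, it avoids the generalized patterns $3$-$51$-$2$-$4$, $3$-$51$-$4$-$2$, $2$-$4$-$51$-$3$, $4$-$2$-$51$-$3$, where entries not separated by a dash must be adjacent in the permutation.) **The congruence $\Gamma$.** $\Gamma$ is the unique lattice congruence on the weak order on $S_n$ (known to exist) such that, for every cover $x\lessdot y$, with $e$ and $a$ ($a<e$) the adjacent entries swapped to convert $y$ to $x$: $x\equiv y$ modulo $\Gamma$ if and only if there are entries $b,c,d$ in $y$ with $a<b<c<d<e$ such that $b$ and $d$ are on the same side of the adjacent pair $ea$ in $y$, while $c$ is on the other side of $ea$. (Since congruence classes of a finite lattice are intervals, $\Gamma$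 is the equivalence relation generated by these cover relations.) **Generic rectangulations.** Consider tilings of a rectangle $S$ (with horizontal and vertical edges) by finitely many rectangles. A tiling is *generic* if no point is a corner of four distinct tiles. A tile $U$ is *below* a tile $V$ if the top edge of $U$ intersects the bottom edge of $V$; $U$ is *left of* $V$ if the right edge of $U$ intersects the left edge of $V$. Two tilings (of possibly different rectangles) are combinatorially equivalent if there is a bijection between their tiles that exactly preserves the relations "below" and "left of". A *generic rectangulation* is an equivalence class of generic tilings; $\mathrm{gRec}_n$ is the set of generic rectangulations with $n$ rectangles. Rectangulations are described by representative tilings. **Diagonal rectangulations.** The diagonal of $S$ is the segment from its top-left corner to its bottom-right corner. A *diagonal rectangulation* is a rectangulation having a representative in which the interior of every rectangle meets the diagonal; it is automatically generic. Its rectangles are numbered $1,\dots,n$ in the order in which they meet the diagonal, from top-left to bottom-right. **The map $\rho$ from $S_n$ to diagonal rectangulations with $n$ rectangles.** Place $n+1$ distinct points on the diagonal of $S$, including the top-left and bottom-right corners of $S$, and label the spaces between consecutive points $1,\dots,n$ from top-left to bottom-right. Given $x\in S_n$, draw rectangles in steps $i=1,\dots,n$. In step $i$, let $T$ be the union of the left and bottom edges of $S$ with the rectangles drawn in the first $i-1$ steps ($T$ is left- and bottom-justified). Let $p$ and $p'$ be the diagonal points immediately above/left of, respectively immediately below/right of, the label $x_i$. The new rectangle has the following corners. Top-left corner: if $p\notin T$, the rightmost point of $T$ directly left of $p$; if $p\in T$, the highest point of $T$ directly above $p$ (possibly $p$ itself). Bottom-right corner: if $p'\notin T$, the highest point of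 $T$ directly below $p'$; if $p'\in T$, the rightmost point of $T$ directly to the right of $p'$ (possibly $p'$ itself). The result after $n$ steps is $\rho(x)$; the rectangle drawn in step $i$ is the one numbered $x_i$. **Walls, wall slides, numbering.** A *wall* of a rectangulation is a line segment in $S$, not contained in an edge of $S$, that is maximal with respect to not intersecting the interior of any rectangle. A *wall slide* along a wall $W$ takes two walls that end in $W$ from opposite sides and slides them past each other, changing no other incidences. Two generic rectangulations are *equivalent as mosaic floorplans* if they are related by a sequence of wall slides. It is known that each generic rectangulation $R$ is equivalent as a mosaic floorplan to a unique diagonal rectangulation $R'$. The walls and rectangles of $R$ correspond to those of $R'$ along wall slides (preserving, for each wall, which rectangles are adjacent to it on each side and their order), and the rectangles of $R$ inherit the numbering $1,\dots,n$ from $R'$. **Wall shuffles.** For a vertical wall $W$ of $R$, the *wall shuffle* $\sigma_W$ is the following sequence: moving along $W$ from bottom to top, at each wall $W'$ that ends at $W$ on the left, record the number of the rectangle with right edge in $W$ and bottom edge in $W'$; at each wall $W'$ that ends at $W$ on the right, record the number of the rectangle with left edge in $W$ and top edge in $W'$. Thus $\sigma_W$ is a shuffle of the (decreasing) sequence of numbers, from bottom to top, of rectangles whose right edge is in $W$, excluding the bottom one, with the (decreasing) sequence of numbers, from bottom to top, of rectangles whose left edge is in $W$, excluding the top one. For a horizontal wall $W$: moving from left to right, at each wall $W'$ that ends at $W$ from above, record the number of the rectangle with bottom edge in $W$ and right edge in $W'$; at each $W'$ that ends at $W$ from below, record the number of the rectangle with top edge in $W$ and left edge in $W'$. Thus $\sigma_W$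 is a shuffle of the (increasing) sequence of numbers, from left to right, of rectangles whose bottom edge is in $W$, excluding the rightmost, with the (increasing) sequence of numbers, from left to right, of rectangles whose top edge is in $W$, excluding the leftmost. Specifying a generic rectangulation is equivalent to specifying its diagonal rectangulation $R'$ together with an arbitrary, independently chosen wall shuffle (a shuffle of the two sequences just described) for each wall of $R'$. **The map $\gamma:S_n\to\mathrm{gRec}_n$.** Given $x\in S_n$, let $R'=\rho(x)$. For each wall $W$ of $R'$, each of the two sequences of rectangle numbers to be shuffled for $W$ is a subsequence of $x_1\cdots x_n$, so a wall shuffle $\sigma_W$ is obtained as the subsequence of $x_1\cdots x_n$ consisting of all numbers occurring in these two sequences. Then $\gamma(x)$ is the generic rectangulation determined by $R'=\rho(x)$ and these wall shuffles. -}

module Defs where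

open import Data.Fin using (Fin; toℕ) renaming (_<_ to _<ᶠ_; _≤_ to _≤ᶠ_)
open import Data.Fin.Permutation using (Permutation′; _⟨$⟩ʳ_; _⟨$⟩ˡ_; _≈_)
open import Data.Integer using (+_)
open import Data.List using (List; []; _∷_; _++_; foldl; take)
import Data.List as List
open import Data.List.Membership.Propositional using () renaming (_∈_ to _∈ₗ_)
open import Data.List.Relation.Binary.Sublist.Propositional using () renaming (_⊆_ to _⊑_)
open import Data.List.Relation.Unary.AllPairs using (AllPairs)
open import Data.List.Relation.Unary.Any using (Any; any?)
open import Data.Nat using (ℕ; zero; suc; _∸_)
import Data.Nat as ℕ
import Data.Nat.Coprimality as Coprimality
open import Data.Product using (Σ; ∃; ∃₂; _×_; _,_; proj₁; proj₂)
open import Data.Rational using (ℚ; mkℚ; _≤_; _<_)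
open import Data.Sum using (_⊎_)
open import Data.Vec using (Vec; lookup; tabulate)
open import Function.Bundles using (_⇔_)
open import Function.Definitions using (Injective)
open import Relation.Binary.Construct.Closure.Equivalence using (EqClosure)
open import Relation.Binary.Construct.Closure.ReflexiveTransitive using (Star)
open import Relation.Binary.PropositionalEquality using (_≡_; _≢_)
open import Relation.Nullary using (¬_; Dec; yes; no; does)
open import Relation.Nullary.Decidable using (_×-dec_; _⊎-dec_)
open import Relation.Unary using (Pred; _⊆_; _≬_)
open import Data.Bool using (if_then_else_)
open import Level using (0ℓ)

private
  variable
    n : ℕ

------------------------------------------------------------------------
-- Permutations and the weak order

-- The entry xᵢ of the one-line notation is x ⟨$⟩ʳ i, and the position of
-- the value v is x ⟨$⟩ˡ v.  Positions, values and rectangle numbers are all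
-- in Fin n, i.e. they run from 0 to n-1 instead of from 1 to n.

Perm : ℕ → Set
Perm n = Permutation′ n

word : Perm n → List (Fin n)
word x = List.tabulate (x ⟨$⟩ʳ_)

Adjacent : Fin n → Fin n → Set
Adjacent i j = toℕ j ≡ suc (toℕ i)

-- Cover of the weak order whose swapped positions are i and j = i + 1.
_⋖[_,_]_ : Perm n → Fin n → Fin n → Perm n → Set
x ⋖[ i , j ] y =
    Adjacent i j
  × x ⟨$⟩ʳ i ≡ y ⟨$⟩ʳ j
  × (y ⟨$⟩ʳ j) <ᶠ (y ⟨$⟩ʳ i)
  × y ⟨$⟩ʳ i ≡ x ⟨$⟩ʳ j
  × (∀ h → h ≢ i → h ≢ j → x ⟨$⟩ʳ h ≡ y ⟨$⟩ʳ h)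

-- Sides of the pair of entries in adjacent positions i, j.
LeftOfPair RightOfPair : Perm n → Fin n → Fin n → Pred (Fin n) 0ℓ
LeftOfPair  x i j v = (x ⟨$⟩ˡ v) <ᶠ i
RightOfPair x i j v = j <ᶠ (x ⟨$⟩ˡ v)

-- Covers x ⋖ y contracted by Γ; the swapped entries are e = yᵢ and a = yⱼ.
ΓCover : Perm n → Perm n → Set
ΓCover {n} x y = ∃₂ λ i j → x ⋖[ i , j ] y ×
  Σ (Fin n) λ b → Σ (Fin n) λ c → Σ (Fin n) λ d →
      (y ⟨$⟩ʳ j) <ᶠ b × b <ᶠ c × c <ᶠ d × d <ᶠ (y ⟨$⟩ʳ i)
    × (  (LeftOfPair  y i j b × LeftOfPair  y i j d × RightOfPair y i j c)
       ⊎ (RightOfPair y i j b × RightOfPair y i j d × LeftOfPair  y i j c))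

-- Congruence modulo Γ.  _≈_ is pointwise equality of permutations, which
-- is what equality in Sₙ means for Permutation′ without function
-- extensionality, so it has to be included among the generators.
_≡Γ_ : Perm n → Perm n → Set
_≡Γ_ = EqClosure (λ x y → x ≈ y ⊎ ΓCover x y)

IsΓClass : Pred (Perm n) 0ℓ → Set
IsΓClass P = ∃ λ x → ∀ y → P y ⇔ (x ≡Γ y)

------------------------------------------------------------------------
-- 2-clumped permutations

-- The values lo,…,hi lie strictly between xⱼ and xᵢ, and all of them occur
-- on one side of the adjacent pair xᵢ xⱼ.
OneSidedRun : Perm n → Fin n → Fin n → Fin n × Fin n → Set
OneSidedRun x i j (lo , hi) =
    (x ⟨$⟩ʳ j) <ᶠ lo × lo ≤ᶠ hi × hi <ᶠ (x ⟨$⟩ʳ i)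
  × (  (∀ v → lo ≤ᶠ v → v ≤ᶠ hi → LeftOfPair  x i j v)
     ⊎ (∀ v → lo ≤ᶠ v → v ≤ᶠ hi → RightOfPair x i j v))

-- A clump, given by its least and greatest values.
Clump : Perm n → Fin n → Fin n → Fin n × Fin n → Set
Clump x i j (lo , hi) = OneSidedRun x i j (lo , hi) ×
  (∀ lo′ hi′ → OneSidedRun x i j (lo′ , hi′) →
    lo′ ≤ᶠ lo → hi ≤ᶠ hi′ → lo′ ≡ lo × hi′ ≡ hi)

TwoClumped : Perm n → Set
TwoClumped x = ∀ i j → Adjacent i j → (x ⟨$⟩ʳ j) <ᶠ (x ⟨$⟩ʳ i) →
  ∀ C₁ C₂ C₃ → Clump x i j C₁ → Clump x i j C₂ → Clump x i j C₃ →
  C₁ ≡ C₂ ⊎ C₁ ≡ C₃ ⊎ C₂ ≡ C₃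

------------------------------------------------------------------------
-- Plane geometry

record Rect (A : Set) : Set where
  constructor rect
  field
    left right bottom top : A

open Rect public

mapRect : {A B : Set} → (A → B) → Rect A → Rect B
mapRect f (rect l r b t) = rect (f l) (f r) (f b) (f t)

Point : Set
Point = ℚ × ℚ

-- vert x y₀ y₁ joins (x , y₀) to (x , y₁), and horiz y x₀ x₁ joins
-- (x₀ , y) to (x₁ , y).
data Segment : Set where
  vert horiz : ℚ → ℚ → ℚ → Segment

NonDegenerate : Segment → Set
NonDegenerate (vert  _ a b) = a < b
NonDegenerate (horiz _ a b) = a < b

⟦_⟧ : Segment → Pred Point 0ℓ
⟦ vert  c a b ⟧ (x , y) = x ≡ c × a ≤ y × y ≤ b
⟦ horiz c a b ⟧ (x , y) = y ≡ c × a ≤ x × x ≤ b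

NonEmptyRect : Rect ℚ → Set
NonEmptyRect r = left r < right r × bottom r < top r

Closed Interior Corner : Rect ℚ → Pred Point 0ℓ
Closed   r (x , y) = left r ≤ x × x ≤ right r × bottom r ≤ y × y ≤ top r
Interior r (x , y) = left r < x × x < right r × bottom r < y × y < top r
Corner   r (x , y) = (x ≡ left r ⊎ x ≡ right r) × (y ≡ bottom r ⊎ y ≡ top r)

data Edge : Set where
  leftE rightE bottomE topE : Edge

edge : Edge → Rect ℚ → Segment
edge leftE   r = vert  (left r)   (bottom r) (top r)
edge rightE  r = vert  (right r)  (bottom r) (top r)
edge bottomE r = horiz (bottom r) (left r) (right r)
edge topE    r = horiz (top r)    (left r) (right r)

------------------------------------------------------------------------
-- Generic rectangulations

-- A rectangle S together with n numbered rectangles.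
record Layout (n : ℕ) : Set where
  constructor layout
  field
    frame : Rect ℚ
    tiles : Vec (Rect ℚ) n

  tile : Fin n → Rect ℚ
  tile = lookup tiles

open Layout public

record IsGenericTiling (T : Layout n) : Set where
  field
    frame-nonEmpty : NonEmptyRect (frame T)
    tile-nonEmpty  : ∀ k → NonEmptyRect (tile T k)
    disjoint       : ∀ k l → k ≢ l → ¬ (Interior (tile T k) ≬ Interior (tile T l))
    inside         : ∀ k → Closed (tile T k) ⊆ Closed (frame T)
    covers         : ∀ p → Closed (frame T) p → ∃ λ k → Closed (tile T k) p
    generic        : ∀ p → ¬ (∃ λ (f : Fin 4 → Fin n) →
                       Injective _≡_ _≡_ f × (∀ i → Corner (tile T (f i)) p))

Below LeftOf : (T : Layout n) → Fin n → Fin n → Set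
Below  T k l = ⟦ edge topE   (tile T k) ⟧ ≬ ⟦ edge bottomE (tile T l) ⟧
LeftOf T k l = ⟦ edge rightE (tile T k) ⟧ ≬ ⟦ edge leftE   (tile T l) ⟧

-- Combinatorial equivalence; the numbering of the tiles is disregarded.
_≅_ : Layout n → Layout n → Set
_≅_ {n} T U = ∃ λ (φ : Permutation′ n) → ∀ k l →
    (Below  T k l ⇔ Below  U (φ ⟨$⟩ʳ k) (φ ⟨$⟩ʳ l))
  × (LeftOf T k l ⇔ LeftOf U (φ ⟨$⟩ʳ k) (φ ⟨$⟩ʳ l))

-- Representatives of the elements of gRecₙ, which is the set of classes
-- of generic tilings modulo _≅_.
GenericTiling : ℕ → Set
GenericTiling n = ∃ λ (T : Layout n) → IsGenericTiling T

------------------------------------------------------------------------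
-- Walls and wall shuffles

-- Every segment of positive length in S that meets no tile's interior is
-- vertical or horizontal, so Segment loses nothing.
AvoidsInteriors : Layout n → Segment → Set
AvoidsInteriors T W =
    NonDegenerate W
  × ⟦ W ⟧ ⊆ Closed (frame T)
  × (∀ k → ¬ (⟦ W ⟧ ≬ Interior (tile T k)))

Wall : Layout n → Segment → Set
Wall T W =
    AvoidsInteriors T W
  × (∀ e → ¬ (⟦ W ⟧ ⊆ ⟦ edge e (frame T) ⟧))
  × (∀ V → AvoidsInteriors T V → ⟦ W ⟧ ⊆ ⟦ V ⟧ → ⟦ V ⟧ ⊆ ⟦ W ⟧)

EdgeIn : Layout n → Edge → Fin n → Segment → Set
EdgeIn T e k W = ⟦ edge e (tile T k) ⟧ ⊆ ⟦ W ⟧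

-- The two sides of a wall: left and right of a vertical wall, above and
-- below a horizontal one.
data Side : Set where
  left/above right/below : Side

-- RecordsFrom T W s k c: a wall W′ ends at W on side s, its endpoint on W
-- has coordinate c along W, and k is the number recorded there.
RecordsFrom : Layout n → Segment → Side → Fin n → ℚ → Set
RecordsFrom T W@(vert _ _ _) left/above k c = ∃₂ λ a b →
  Wall T (horiz c a b) × ⟦ W ⟧ (b , c) × EdgeIn T rightE k W × EdgeIn T bottomE k (horiz c a b)
RecordsFrom T W@(vert _ _ _) right/below k c = ∃₂ λ a b →
  Wall T (horiz c a b) × ⟦ W ⟧ (a , c) × EdgeIn T leftE k W × EdgeIn T topE k (horiz c a b)
RecordsFrom T W@(horiz _ _ _) left/above k c = ∃₂ λ a b →
  Wall T (vert c a b) × ⟦ W ⟧ (c , a) × EdgeIn T bottomE k W × EdgeIn T rightE k (vert c a b)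
RecordsFrom T W@(horiz _ _ _) right/below k c = ∃₂ λ a b →
  Wall T (vert c a b) × ⟦ W ⟧ (c , b) × EdgeIn T topE k W × EdgeIn T leftE k (vert c a b)

Recorded : Layout n → Segment → Pred (Fin n) 0ℓ
Recorded T W k = ∃₂ λ s c → RecordsFrom T W s k c

RecordedBefore : Layout n → Segment → Fin n → Fin n → Set
RecordedBefore T W j k = ∃₂ λ s c → ∃₂ λ t d →
  RecordsFrom T W s j c × RecordsFrom T W t k d × c < d

IsWallShuffle : Layout n → Segment → List (Fin n) → Set
IsWallShuffle T W σ =
    (∀ k → (k ∈ₗ σ) ⇔ Recorded T W k)
  × AllPairs (RecordedBefore T W) σ

------------------------------------------------------------------------
-- Wall slides

-- The wall W of T corresponds to the wall W′ of U when the same numbered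
-- rectangles are adjacent to it on each side.
SameWall : Layout n → Segment → Layout n → Segment → Set
SameWall T W U W′ = ∀ e k → EdgeIn T e k W ⇔ EdgeIn U e k W′

-- A wall slide along W, as a relation between numbered generic tilings that
-- only looks at their combinatorial structure: rectangles correspond by
-- number, walls correspond by SameWall, and the only change is that two
-- consecutive entries of the shuffle of W, coming from opposite sides of W,
-- trade places.
record WallSlide (T U : Layout n) : Set where
  field
    generic-T   : IsGenericTiling T
    generic-U   : IsGenericTiling U
    walls-to    : ∀ V → Wall T V → ∃ λ V′ → Wall U V′ × SameWall T V U V′
    walls-from  : ∀ V′ → Wall U V′ → ∃ λ V → Wall T V × SameWall T V U V′
    frame-edges : ∀ e k → EdgeIn T e k (edge e (frame T)) ⇔ EdgeIn U e k (edge e (frame U))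
    {W W′}      : Segment
    wall-W      : Wall T W
    wall-W′     : Wall U W′
    same-W      : SameWall T W U W′
    {α β}       : List (Fin n)
    {j k}       : Fin n
    {c d}       : ℚ
    opposite    : (RecordsFrom T W left/above j c × RecordsFrom T W right/below k d)
                ⊎ (RecordsFrom T W right/below j c × RecordsFrom T W left/above k d)
    shuffle-T   : IsWallShuffle T W  (α ++ j ∷ k ∷ β)
    shuffle-U   : IsWallShuffle U W′ (α ++ k ∷ j ∷ β)
    others      : ∀ V V′ → Wall T V → Wall U V′ → SameWall T V U V′ → V ≢ W →
                  ∀ σ → IsWallShuffle T V σ ⇔ IsWallShuffle U V′ σ

------------------------------------------------------------------------
-- The map ρ

-- S is the square [0,n] × [0,n], and the points on its diagonal are
-- (i , n - i) for i = 0,…,n.  All corners that arise have natural number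
-- coordinates, and so T meets any grid line in finitely many intervals with
-- natural number endpoints; extremal points of T on a grid line can therefore
-- be found among the grid points.

InRect : ℕ × ℕ → Rect ℕ → Set
InRect (u , v) r = left r ℕ.≤ u × u ℕ.≤ right r × bottom r ℕ.≤ v × v ℕ.≤ top r

-- The region T, for points (u , v) of S.
InT : List (Rect ℕ) → ℕ × ℕ → Set
InT T p = proj₁ p ≡ 0 ⊎ proj₂ p ≡ 0 ⊎ Any (InRect p) T

inT? : ∀ T p → Dec (InT T p)
inT? T (u , v) = (u ℕ.≟ 0) ⊎-dec (v ℕ.≟ 0) ⊎-dec any? (λ r →
  (left r ℕ.≤? u) ×-dec (u ℕ.≤? right r) ×-dec (bottom r ℕ.≤? v) ×-dec (v ℕ.≤? top r)) T

-- The greatest m ≤ b satisfying P, or 0 if there is none.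
greatest≤ : ℕ → {P : ℕ → Set} → (∀ m → Dec (P m)) → ℕ
greatest≤ zero    P? = zero
greatest≤ (suc b) P? = if does (P? (suc b)) then suc b else greatest≤ b P?

-- The rectangle drawn for the label k when T is the union of the left and
-- bottom edges of S with the rectangles in the list.  Here p = (k , n - k)
-- and p′ = (k + 1 , n - k - 1).  When p ∈ T, the highest point of T on the
-- vertical line through p is weakly above p, and similarly for p′.
newRect : (n : ℕ) → List (Rect ℕ) → Fin n → Rect ℕ
newRect n T k = rect (proj₁ topLeft) (proj₁ bottomRight) (proj₂ bottomRight) (proj₂ topLeft)
  where
  a  = toℕ k
  b  = n ∸ a
  a′ = suc a
  b′ = n ∸ a′

  topLeft : ℕ × ℕ
  topLeft with inT? T (a , b)
  ... | no  _ = greatest≤ a (λ u → inT? T (u , b)) , b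
  ... | yes _ = a , greatest≤ n (λ v → inT? T (a , v))

  bottomRight : ℕ × ℕ
  bottomRight with inT? T (a′ , b′)
  ... | no  _ = a′ , greatest≤ b′ (λ v → inT? T (a′ , v))
  ... | yes _ = greatest≤ n (λ u → inT? T (u , b′)) , b′

drawn : List (Fin n) → List (Rect ℕ)
drawn {n} = foldl (λ T k → newRect n T k ∷ T) []

-- The rectangle numbered k is drawn after those for the entries preceding k.
ρ : Perm n → Layout n
ρ {n} x = layout (mapRect toℚ (rect 0 n 0 n)) (tabulate λ k →
  mapRect toℚ (newRect n (drawn (take (toℕ (x ⟨$⟩ˡ k)) (word x))) k))
  where
  toℚ : ℕ → ℚ
  toℚ m = mkℚ (+ m) 0 (Coprimality.sym (Coprimality.1-coprimeTo m))

------------------------------------------------------------------------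
-- The map γ

-- The graph of γ: the class of R in gRecₙ is γ(x).  Numbered is a
-- representative with the numbering inherited from the diagonal
-- rectangulation ρ(x) along wall slides; for each wall V of ρ(x), the
-- shuffle of the corresponding wall is the subsequence of x consisting of the
-- numbers to be shuffled for V.
record _γ↦_ (x : Perm n) (R : Layout n) : Set where
  field
    Numbered : Layout n
    slides   : Star WallSlide (ρ x) Numbered
    shuffles : ∀ V W → Wall (ρ x) V → Wall Numbered W → SameWall (ρ x) V Numbered W →
               ∃ λ σ → σ ⊑ word x × (∀ k → (k ∈ₗ σ) ⇔ Recorded (ρ x) V k)
                     × IsWallShuffle Numbered W σ
    class    : Numbered ≅ R

-- The fiber of γ over the class of a generic tiling R.
Fiber : GenericTiling n → Pred (Perm n) 0ℓ
Fiber R x = x γ↦ proj₁ R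

{-# OPTIONS --safe #-}

-- Order the labels by their positions in x.  The rectangle of ρ(x) numbered k
-- consists of the grid cells (c , r) for which k is the first of the labels
-- c,…,r, if c ≤ r, or the last of r,…,c, if r ≤ c.  So its sides are the ends
-- of the runs of labels next to k that come after k, or before k, and a
-- transposition of the square amounts to a reversal of x.  In particular ρ(x)
-- and the wall shuffles do not change along the covers that Γ contracts.
--
-- Conversely let γ(x) = γ(y).  Two rectangles lie on opposite sides of a
-- common wall if and only if a zigzag of contacts joins them, and consecutive
-- labels always do, in increasing order.  So the contacts determine the
-- numbering, then ρ(x), and then the wall shuffles.  The labels of a descent of
-- a two-clumped z lie on opposite sides of a common wall, hence each descent of
-- z is an inversion of every y in its fiber, and by induction so is each
-- inversion of z.  Thus a fiber contains at most one two-clumped permutation;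
-- and every permutation descends to one along covers contracted by Γ.

module Submission where

open import Defs
open import Data.Empty using (⊥; ⊥-elim)
open import Data.Fin as Fin using (Fin; zero; suc; toℕ; fromℕ<)
open import Data.Fin.Induction using (>-wellFounded) renaming (<-wellFounded to <ᶠ-wellFounded)
open import Data.Fin.Permutation
  using (Permutation′; _⟨$⟩ʳ_; _⟨$⟩ˡ_; _≈_; inverseˡ; inverseʳ; transpose; _∘ₚ_; flip)
import Data.Fin.Permutation.Components as PC
open import Data.Fin.Properties as Finₚ using (toℕ<n; toℕ-injective; toℕ-fromℕ<; fromℕ<-toℕ; fromℕ<-injective)
import Data.Integer as ℤ
import Data.Integer.Properties as ℤₚ
open import Data.List as List using (List; []; _∷_; take)
open import Data.List.Membership.Propositional using (_∈_)
import Data.List.Properties as Listₚ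
open import Data.List.Relation.Binary.Sublist.Propositional using (_∷ʳ_; _∷_; []; minimum) renaming (_⊆_ to _⊑_)
open import Data.List.Relation.Binary.Sublist.Propositional.Properties using (All-resp-⊆)
open import Data.List.Relation.Unary.All as All using (All; []; _∷_)
import Data.List.Relation.Unary.All.Properties as Allₚ
open import Data.List.Relation.Unary.AllPairs using (AllPairs; []; _∷_)
import Data.List.Relation.Unary.AllPairs.Properties as AllPairsₚ
open import Data.List.Relation.Unary.Any using (here; there)
open import Data.Nat
  using (ℕ; zero; suc; _+_; _*_; _∸_; _⊔_; _≤_; _<_; _≥_; _≤?_; _<?_; _≟_; z≤n; s≤s; s≤s⁻¹; s<s⁻¹)
import Data.Nat.Coprimality as Coprimality
open import Data.Nat.Induction using (<-wellFounded)
open import Data.Nat.Properties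
open import Data.Product using (Σ; ∃; ∃!; ∃₂; _×_; _,_; proj₁; proj₂)
open import Data.Rational as ℚ using (ℚ; mkℚ; *≤*)
import Data.Rational.Properties as ℚₚ
open import Data.Sum using (_⊎_; inj₁; inj₂; swap; [_,_]′)
open import Data.Vec.Properties using (lookup∘tabulate; tabulate-cong)
open import Function.Base using (_∘_; id)
open import Function.Bundles using (_⇔_; mk⇔; module Equivalence)
open import Function.Construct.Identity using (⇔-id)
open import Induction.WellFounded using (WellFounded; Acc; acc; wf⇒asym)
open import Relation.Binary.Construct.Closure.Equivalence using (symmetric)
open import Relation.Binary.Construct.Closure.ReflexiveTransitive using (Star; ε; _◅_; _◅◅_)
open import Relation.Binary.Construct.Closure.Symmetric using (fwd; bwd)
open import Relation.Binary.Definitions using (tri<; tri≈; tri>)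
open import Relation.Binary.PropositionalEquality
open import Relation.Nullary using (¬_; Dec; yes; no; contradiction)
open import Relation.Nullary.Decidable using (_×-dec_; _⊎-dec_)
open import Relation.Unary using (_⊆_)
open Equivalence using (to; from)

-- Two difficulties shape the proof. The graph of γ gives a numbered tiling only up to wall slides,
-- and its class forgets the numbers, so nothing can be read off from its coordinates directly.
-- `Oriented` therefore keeps only which edges lie in which wall, where the wall through the
-- diagonal point between J and J + 1 has the number J + 1; such statements survive slides.
-- Positions along a wall are compared only through its shuffle, and contacts are the only data
-- common to two representatives. Secondly, every fact is wanted for both directions of walls. Hence
-- the extents belong to an arbitrary strict total order on natural numbers: a fact about vertical
-- walls, applied to the reversed order, is the fact about horizontal ones. The three labels in the
-- definition of Γ do two jobs. One early label between a and e already keeps `L` and `B` of all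
-- rectangles from changing when a and e trade places, and one late label keeps `R` and `T`; this
-- fixes ρ(x). The alternation of three of them keeps a and e from being recorded on a common wall,
-- so that no shuffle notices the exchange.

private variable
  n : ℕ

-- Extents of a label in a total order

record StrictTotal (_≺_ : ℕ → ℕ → Set) : Set where
  field
    ≺-trans : ∀ {i j k} → i ≺ j → j ≺ k → i ≺ k
    ≺-asym  : ∀ {i j} → i ≺ j → ¬ (j ≺ i)
    ≺-conn  : ∀ {i j} → i ≢ j → i ≺ j ⊎ j ≺ i
    _≺?_    : ∀ i j → Dec (i ≺ j)

infix 10 _ᵒ
_ᵒ : (ℕ → ℕ → Set) → ℕ → ℕ → Set
(R ᵒ) i j = R j i

reverse : ∀ {R} → StrictTotal R → StrictTotal (R ᵒ)
reverse o = record
  { ≺-trans = λ p q → ≺-trans q p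
  ; ≺-asym  = ≺-asym
  ; ≺-conn  = λ i≢j → swap (≺-conn i≢j)
  ; _≺?_    = λ i j → j ≺? i
  } where open StrictTotal o

-- The lower end of the run of labels next to `k` that come after `k`; the label `c` itself is in
-- the run or equals `k`. With `suc i ≡ c` in place of a subtraction, `outer` is void when the run
-- reaches the label 0.
record IsLo (_≺_ : ℕ → ℕ → Set) (k c : ℕ) : Set where
  constructor isLo
  field
    lo≤   : c ≤ k
    inner : ∀ {i} → c ≤ i → i < k → k ≺ i
    outer : ∀ {i} → suc i ≡ c → i ≺ k

-- The upper end is exclusive: `d` is the first label past the run, or `n` if there is none.
record IsHi (n : ℕ) (_≺_ : ℕ → ℕ → Set) (k d : ℕ) : Set where
  constructor isHi
  field
    <hi   : k < d
    hi≤   : d ≤ n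
    inner : ∀ {i} → k < i → i < d → k ≺ i
    outer : d < n → d ≺ k

module _ {_≺_ : ℕ → ℕ → Set} (o : StrictTotal _≺_) where
  open StrictTotal o

  -- The label just below `c` comes before `k`, so no run of later labels extends past it. Most
  -- equations between extents are later obtained from this bound and its counterpart `hi-greatest`.
  lo-least : ∀ {k c e} → IsLo _≺_ k c → e ≤ k → (∀ {i} → e ≤ i → i < k → k ≺ i) → c ≤ e
  lo-least {k} {c} {e} s e≤k after with c ≤? e
  ... | yes c≤e = c≤e
  ... | no c≰e with c | s | ≰⇒> c≰e
  ...   | suc i | isLo i<k _ out | s≤s e≤i = contradiction (out refl) (≺-asym (after e≤i i<k))

  hi-greatest : ∀ {n k d e} → IsHi n _≺_ k d → e ≤ n → (∀ {i} → k < i → i < e → k ≺ i) → e ≤ d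
  hi-greatest {d = d} {e} (isHi k<d _ _ out) e≤n after with e ≤? d
  ... | yes e≤d = e≤d
  ... | no e≰d = let d<e = ≰⇒> e≰d in
    contradiction (out (<-≤-trans d<e e≤n)) (≺-asym (after k<d d<e))

  lo-unique : ∀ {k c e} → IsLo _≺_ k c → IsLo _≺_ k e → c ≡ e
  lo-unique s t = ≤-antisym (lo-least s (IsLo.lo≤ t) (IsLo.inner t)) (lo-least t (IsLo.lo≤ s) (IsLo.inner s))

  hi-unique : ∀ {n k d e} → IsHi n _≺_ k d → IsHi n _≺_ k e → d ≡ e
  hi-unique s t = ≤-antisym (hi-greatest t (IsHi.hi≤ s) (IsHi.inner s)) (hi-greatest s (IsHi.hi≤ t) (IsHi.inner t))

module _ {P : ℕ → Set} (P? : ∀ i → Dec (P i)) where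

  runDown : ∀ c → ∃ λ c′ → c′ ≤ c × (∀ {i} → c′ ≤ i → i < c → P i) × (∀ {i} → suc i ≡ c′ → ¬ P i)
  runDown zero = 0 , z≤n , (λ _ ()) , λ ()
  runDown (suc c) with P? c
  ... | no ¬p = suc c , ≤-refl , (λ p q → contradiction (≤-trans q p) (<-irrefl refl)) , λ { refl → ¬p }
  ... | yes p with runDown c
  ...   | c′ , c′≤c , all , max = c′ , m≤n⇒m≤1+n c′≤c , all′ , max
    where
    all′ : ∀ {i} → c′ ≤ i → i < suc c → P i
    all′ {i} l (s≤s i≤c) with m≤n⇒m<n∨m≡n i≤c
    ... | inj₁ i<c  = all l i<c
    ... | inj₂ refl = p

  runUp : ∀ d fuel → ∃ λ d′ → d ≤ d′ × d′ ≤ d + fuel × (∀ {i} → d ≤ i → i < d′ → P i) × (d′ < d + fuel → ¬ P d′)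
  runUp d zero = d , ≤-refl , m≤m+n d 0 , (λ p q → contradiction (≤-trans q p) (<-irrefl refl)) ,
    λ q → contradiction (subst (d <_) (+-identityʳ d) q) (<-irrefl refl)
  runUp d (suc f) with P? d
  ... | no ¬p = d , ≤-refl , m≤m+n d _ , (λ p q → contradiction (≤-trans q p) (<-irrefl refl)) , λ _ → ¬p
  ... | yes p with runUp (suc d) f
  ...   | d′ , d<d′ , le , all , max = d′ , <⇒≤ d<d′ , subst (d′ ≤_) (sym (+-suc d f)) le , all′ ,
    λ q → max (subst (d′ <_) (+-suc d f) q)
    where
    all′ : ∀ {i} → d ≤ i → i < d′ → P i
    all′ l q with m≤n⇒m<n∨m≡n l
    ... | inj₁ d<i  = all d<i q
    ... | inj₂ refl = p

-- L, R are the left and right ends of the columns met by the rectangle of a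
-- label, and T, B the ends of its rows, rows being counted from the top.
record Extents (n : ℕ) (_≺_ : ℕ → ℕ → Set) : Set where
  field
    L R T B : ℕ → ℕ
    isL : ∀ {k} → k < n → IsLo _≺_ k (L k)
    isR : ∀ {k} → k < n → IsHi n (_≺_ ᵒ) k (R k)
    isT : ∀ {k} → k < n → IsLo (_≺_ ᵒ) k (T k)
    isB : ∀ {k} → k < n → IsHi n _≺_ k (B k)

  L≤ : ∀ {k} → k < n → L k ≤ k
  L≤ p = IsLo.lo≤ (isL p)
  T≤ : ∀ {k} → k < n → T k ≤ k
  T≤ p = IsLo.lo≤ (isT p)
  <R : ∀ {k} → k < n → k < R k
  <R p = IsHi.<hi (isR p)
  <B : ∀ {k} → k < n → k < B k
  <B p = IsHi.<hi (isB p)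
  R≤ : ∀ {k} → k < n → R k ≤ n
  R≤ p = IsHi.hi≤ (isR p)
  B≤ : ∀ {k} → k < n → B k ≤ n
  B≤ p = IsHi.hi≤ (isB p)

module _ {n : ℕ} {_≺_ : ℕ → ℕ → Set} (o : StrictTotal _≺_) where
  open StrictTotal o

  private
    loOf : ∀ {R : ℕ → ℕ → Set} → StrictTotal R → ∀ k → ∃ λ c → IsLo R k c
    loOf o′ k with runDown (λ i → StrictTotal._≺?_ o′ k i) k
    ... | c , c≤k , all , max = c , isLo c≤k all λ { refl →
        [ id , (λ p → contradiction p (max refl)) ]′ (StrictTotal.≺-conn o′ (<⇒≢ c≤k)) }

    hiOf : ∀ {R : ℕ → ℕ → Set} → StrictTotal R → ∀ k → ∃ λ d → k < n → IsHi n R k d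
    hiOf o′ k with runUp (λ i → StrictTotal._≺?_ o′ k i) (suc k) (n ∸ suc k)
    ... | d , k<d , le , all , max = d , λ k<n → isHi k<d (subst (d ≤_) (m+[n∸m]≡n k<n) le) all λ d<n →
        [ (λ p → contradiction p (max (subst (d <_) (sym (m+[n∸m]≡n k<n)) d<n))) , id ]′ (StrictTotal.≺-conn o′ (<⇒≢ k<d))

  -- Only the specifications of the four ends are used from here on; the searches that find them
  -- need never unfold.
  abstract
    extents : Extents n _≺_
    extents = record
      { L = λ k → proj₁ (loOf o k)
      ; R = λ k → proj₁ (hiOf (reverse o) k)
      ; T = λ k → proj₁ (loOf (reverse o) k)
      ; B = λ k → proj₁ (hiOf o k)
      ; isL = λ {k} _ → proj₂ (loOf o k)
      ; isR = λ {k} → proj₂ (hiOf (reverse o) k)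
      ; isT = λ {k} _ → proj₂ (loOf (reverse o) k)
      ; isB = λ {k} → proj₂ (hiOf o k)
      }

transposeᴱ : ∀ {n R} → Extents n R → Extents n (R ᵒ)
transposeᴱ E = record { L = T ; R = B ; T = L ; B = R ; isL = isT ; isR = isB ; isT = isL ; isB = isR }
  where open Extents E

-- The tiling of the grid by the rectangles of the labels

module Tiles {n : ℕ} {_≺_ : ℕ → ℕ → Set} (o : StrictTotal _≺_) (E : Extents n _≺_) where
  open StrictTotal o
  open Extents E

  Ab : ∀ {ℓ} {A : Set ℓ} {i j} → i ≺ j → j ≺ i → A
  Ab p q = contradiction q (≺-asym p)

  InTile : ℕ → ℕ → ℕ → Set
  InTile k c r = L k ≤ c × c < R k × T k ≤ r × r < B k

  -- On and below the diagonal a cell belongs to the first of the labels from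
  -- its column to its row.
  private
    first : ∀ c r → c ≤ r → ∃ λ k → c ≤ k × k ≤ r × (∀ {i} → c ≤ i → i ≤ r → i ≢ k → k ≺ i)
    first c zero z≤n = 0 , z≤n , z≤n , λ { _ z≤n ne → contradiction refl ne }
    first c (suc r) c≤r with m≤n⇒m<n∨m≡n c≤r
    ... | inj₂ refl = suc r , ≤-refl , ≤-refl , λ p q ne → contradiction (≤-antisym q p) ne
    ... | inj₁ (s≤s c≤r′) with first c r c≤r′
    ...   | k , c≤k , k≤r , min with k ≺? suc r
    ...     | yes k≺ = k , c≤k , m≤n⇒m≤1+n k≤r , min′
      where
      min′ : ∀ {i} → c ≤ i → i ≤ suc r → i ≢ k → k ≺ i
      min′ p q ne with m≤n⇒m<n∨m≡n q
      ... | inj₁ (s≤s i≤r) = min p i≤r ne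
      ... | inj₂ refl = k≺
    ...     | no k⊀ = suc r , c≤r , ≤-refl , min′
      where
      r≺k : suc r ≺ k
      r≺k with ≺-conn {k} {suc r} (<⇒≢ (s≤s k≤r))
      ... | inj₁ p = contradiction p k⊀
      ... | inj₂ p = p
      min′ : ∀ {i} → c ≤ i → i ≤ suc r → i ≢ suc r → suc r ≺ i
      min′ {i} p q ne with i ≟ k
      ... | yes refl = r≺k
      ... | no i≢k = ≺-trans r≺k (min p (s≤s⁻¹ (≤∧≢⇒< q ne)) i≢k)

  tileBelow : ∀ {c r} → c ≤ r → r < n → ∃ λ k → k < n × InTile k c r
  tileBelow {c} {r} c≤r r<n with first c r c≤r
  ... | k , c≤k , k≤r , min = k , k<n ,
      lo-least o (isL k<n) c≤k (λ p q → min p (≤-trans (<⇒≤ q) k≤r) (<⇒≢ q)) ,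
      ≤-<-trans c≤k (<R k<n) , ≤-trans (T≤ k<n) k≤r ,
      hi-greatest o (isB k<n) r<n (λ p q → min (≤-trans c≤k (<⇒≤ p)) (s≤s⁻¹ q) (>⇒≢ p))
    where k<n = ≤-<-trans k≤r r<n

  private
    -- If `k` were outside the interval, its neighbour on the side of the interval would be in two
    -- runs of `k` at once, one of labels after `k` and one of labels before `k`.
    between : ∀ {k c r} → k < n → c ≤ r → InTile k c r → c ≤ k × k ≤ r
    between {k} {c} {r} k<n c≤r (l , r′ , t , b) with c ≤? k | k ≤? r
    ... | yes p | yes q = p , q
    ... | no p | _ = let k<c = ≰⇒> p in
      Ab (IsHi.inner (isR k<n) (n<1+n k) (≤-<-trans k<c r′))
         (IsHi.inner (isB k<n) (n<1+n k) (≤-<-trans (≤-trans k<c c≤r) b))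
    ... | _ | no q with k | ≰⇒> q
    ...   | suc j | s≤s r≤j =
      Ab (IsLo.inner (isL k<n) (≤-trans l (≤-trans c≤r r≤j)) ≤-refl)
         (IsLo.inner (isT k<n) (≤-trans t r≤j) ≤-refl)

  uniqueBelow : ∀ {k k′ c r} → k < n → k′ < n → c ≤ r → InTile k c r → InTile k′ c r → k ≡ k′
  uniqueBelow {k} {k′} k<n k′<n c≤r i@(l , _ , _ , b) i′@(l′ , _ , _ , b′)
    with between k<n c≤r i | between k′<n c≤r i′ | <-cmp k k′
  ... | p , q | p′ , q′ | tri≈ _ eq _ = eq
  ... | p , q | p′ , q′ | tri< k<k′ _ _ =
    Ab (IsLo.inner (isL k′<n) (≤-trans l′ p) k<k′) (IsHi.inner (isB k<n) k<k′ (≤-<-trans q′ b))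
  ... | p , q | p′ , q′ | tri> _ _ k′<k =
    Ab (IsLo.inner (isL k<n) (≤-trans l p′) k′<k) (IsHi.inner (isB k′<n) k′<k (≤-<-trans q b′))

  -- Walls, for consecutive labels J and K = J + 1

  -- The order of two consecutive labels decides the direction of the wall through the diagonal
  -- point between them. If `J` comes first, the wall is vertical, with the right edge of `J` and
  -- the left edge of `J + 1` on it.
  L-step : ∀ {J} → suc J < n → J ≺ suc J → L (suc J) ≡ suc J
  L-step {J} K<n J≺K with m≤n⇒m<n∨m≡n (L≤ K<n)
  ... | inj₂ eq = eq
  ... | inj₁ (s≤s l) = Ab (IsLo.inner (isL K<n) l ≤-refl) J≺K

  R-step : ∀ {J} → suc J < n → J ≺ suc J → R J ≡ suc J
  R-step {J} K<n J≺K with m≤n⇒m<n∨m≡n (<R J<n)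
    where J<n = <-trans (n<1+n J) K<n
  ... | inj₂ eq = sym eq
  ... | inj₁ l = Ab (IsHi.inner (isR (<-trans (n<1+n J) K<n)) ≤-refl l) J≺K

  -- A rectangle `k < J` that crosses the column line has columns beyond `k`, hence no row beyond
  -- `k`. Overlapping the wall then puts `k` among the labels that come before `J + 1`, while
  -- crossing the line makes `J + 1` come before `k`. For `k > J` the argument is the mirror image,
  -- with `J` in place of `J + 1`.
  wall-avoids : ∀ {J k} → suc J < n → k < n → J ≺ suc J →
    L k < suc J → suc J < R k → T (suc J) < B k → T k < B J → ∀ {A : Set} → A
  wall-avoids {J} {k} K<n k<n J≺K l r t b with k ≤? J
  ... | yes k≤J with m≤n⇒m<n∨m≡n k≤J
  ...   | inj₂ refl = Ab (IsHi.inner (isR k<n) ≤-refl r) J≺K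
  ...   | inj₁ k<J = Ab (IsLo.inner (isT K<n) T≤k (m≤n⇒m≤1+n k<J)) K≺k
    where
    K≺k : suc J ≺ k
    K≺k = IsHi.inner (isR k<n) (m≤n⇒m≤1+n k<J) r
    k⁺≺k : suc k ≺ k
    k⁺≺k = IsHi.inner (isR k<n) ≤-refl (≤-<-trans k<J (<-trans (n<1+n J) r))
    T≤k : T (suc J) ≤ k
    T≤k with m≤n⇒m<n∨m≡n (<B k<n)
    ... | inj₁ p = Ab (IsHi.inner (isB k<n) ≤-refl p) k⁺≺k
    ... | inj₂ eq = s≤s⁻¹ (subst (T (suc J) <_) (sym eq) t)
  wall-avoids {J} {k} K<n k<n J≺K (s≤s l) r t b | no k≰J with k | ≰⇒> k≰J
  ... | suc i | s≤s J≤i = Ab (IsLo.inner (isL k<n) l (s≤s J≤i)) (IsHi.inner (isB J<n) (s≤s J≤i) k<B)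
    where
    J<n = <-trans (n<1+n J) K<n
    k≺i : suc i ≺ i
    k≺i = IsLo.inner (isL k<n) (≤-trans l J≤i) ≤-refl
    k<B : suc i < B J
    k<B with m≤n⇒m<n∨m≡n (T≤ k<n)
    ... | inj₁ (s≤s p) = Ab (IsLo.inner (isT k<n) p ≤-refl) k≺i
    ... | inj₂ eq = subst (_< B J) eq b

  Blocks : ℕ → ℕ → Set
  Blocks K k = L k < K × K < R k

  -- The label `k` just outside the run of `J + 1` comes after everything up to `J + 1`. So its
  -- rectangle reaches across the column line and stops the wall. At the other end of the wall, the
  -- label `B J` comes before everything down to `J` and does the same.
  wall-top : ∀ {J} → suc J < n → J ≺ suc J →
    T (suc J) ≡ 0 ⊎ ∃ λ k → k < n × Blocks (suc J) k × T k < T (suc J) × T (suc J) ≤ B k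
  wall-top {J} K<n J≺K with T (suc J) in eq
  ... | zero = inj₁ refl
  ... | suc k = inj₂ (k , k<n ,
      (s≤s (≤-trans (L≤ k<n) (<⇒≤ k<J)) ,
       hi-greatest (reverse o) (isR k<n) K<n λ p q → before p (s≤s⁻¹ q)) ,
      s≤s (T≤ k<n) , <B k<n)
    where
    s : IsLo (_≺_ ᵒ) (suc J) (suc k)
    s = subst (IsLo _ _) eq (isT K<n)
    K≺k : suc J ≺ k
    K≺k = IsLo.outer s refl
    k<J : k < J
    k<J = ≤∧≢⇒< (s≤s⁻¹ (IsLo.lo≤ s)) λ { refl → ≺-asym J≺K K≺k }
    k<n : k < n
    k<n = <-trans (m≤n⇒m≤1+n k<J) K<n
    before : ∀ {i} → k < i → i ≤ suc J → i ≺ k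
    before p q with m≤n⇒m<n∨m≡n q
    ... | inj₁ q′ = ≺-trans (IsLo.inner s p q′) K≺k
    ... | inj₂ refl = K≺k

  wall-bottom : ∀ {J} → suc J < n → J ≺ suc J →
    B J ≡ n ⊎ ∃ λ k → k < n × Blocks (suc J) k × T k ≤ B J × B J < B k
  wall-bottom {J} K<n J≺K with m≤n⇒m<n∨m≡n (B≤ J<n)
    where J<n = <-trans (n<1+n J) K<n
  ... | inj₂ eq = inj₁ eq
  ... | inj₁ k<n = inj₂ (B J , k<n ,
      (s≤s (lo-least o (isL k<n) (<⇒≤ (<B J<n)) after) ,
       ≤-<-trans (<B J<n) (<R k<n)) ,
      T≤ k<n , <B k<n)
    where
    J<n = <-trans (n<1+n J) K<n
    k≺J : B J ≺ J
    k≺J = IsHi.outer (isB J<n) k<n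
    after : ∀ {i} → J ≤ i → i < B J → B J ≺ i
    after p q with m≤n⇒m<n∨m≡n p
    ... | inj₁ p′ = ≺-trans k≺J (IsHi.inner (isB J<n) p′ q)
    ... | inj₂ refl = k≺J

  wall-proper : ∀ {J} → suc J < n → J ≺ suc J → T (suc J) < B J
  wall-proper {J} K<n J≺K = ≤-<-trans T≤J (<B (<-trans (n<1+n J) K<n))
    where
    T≤J : T (suc J) ≤ J
    T≤J = lo-least (reverse o) (isT K<n) (n≤1+n J) λ p q → subst (_≺ suc J) (≤-antisym p (s≤s⁻¹ q)) J≺K

  -- No wall avoids the diagonal: an edge at column `J + 1` lies in the wall through the diagonal
  -- point there. The labels from `T k` on come before `J + 1` because they come before `k`, are
  -- `k`, or lie in the run that ends at `J + 1`; the bound for `B` is similar.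
  right-on-wall : ∀ {J k} → suc J < n → k < n → R k ≡ suc J →
    J ≺ suc J × T (suc J) ≤ T k × B k ≤ B J
  right-on-wall {J} {k} K<n k<n eq = J≺K ,
      lo-least (reverse o) (isT K<n) (≤-trans (T≤ k<n) (<⇒≤ k<K)) before ,
      hi-greatest o (isB J<n) (B≤ k<n) after
    where
    J<n = <-trans (n<1+n J) K<n
    s : IsHi n (_≺_ ᵒ) k (suc J)
    s = subst (IsHi _ _ _) eq (isR k<n)
    k<K = IsHi.<hi s
    k≺K : k ≺ suc J
    k≺K = IsHi.outer s K<n
    before′ : ∀ {i} → k ≤ i → i < suc J → i ≺ suc J
    before′ p q with m≤n⇒m<n∨m≡n p
    ... | inj₁ p′ = ≺-trans (IsHi.inner s p′ q) k≺K
    ... | inj₂ refl = k≺K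
    J≺K : J ≺ suc J
    J≺K = before′ (s≤s⁻¹ k<K) ≤-refl
    before : ∀ {i} → T k ≤ i → i < suc J → i ≺ suc J
    before {i} p q with i <? k
    ... | yes i<k = ≺-trans (IsLo.inner (isT k<n) p i<k) k≺K
    ... | no i≮k = before′ (≮⇒≥ i≮k) q
    after : ∀ {i} → J < i → i < B k → J ≺ i
    after {i} p q with m≤n⇒m<n∨m≡n (s≤s⁻¹ k<K)
    ... | inj₂ refl = IsHi.inner (isB k<n) p q
    ... | inj₁ k<J = ≺-trans (IsHi.inner s k<J ≤-refl) (IsHi.inner (isB k<n) (<-trans k<J p) q)

  left-on-wall : ∀ {J l} → l < n → L l ≡ suc J →
    J ≺ suc J × T (suc J) ≤ T l × B l ≤ B J
  left-on-wall {J} {l} l<n eq = J≺K ,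
      T≤T ,
      hi-greatest o (isB J<n) (B≤ l<n) after
    where
    s : IsLo _≺_ l (suc J)
    s = subst (IsLo _ _) eq (isL l<n)
    K≤l = IsLo.lo≤ s
    K<n : suc J < n
    K<n = ≤-<-trans K≤l l<n
    J<n = <-trans (n<1+n J) K<n
    J≺l : J ≺ l
    J≺l = IsLo.outer s refl
    after′ : ∀ {i} → J < i → i ≤ l → J ≺ i
    after′ p q with m≤n⇒m<n∨m≡n q
    ... | inj₁ q′ = ≺-trans J≺l (IsLo.inner s p q′)
    ... | inj₂ refl = J≺l
    J≺K : J ≺ suc J
    J≺K = after′ ≤-refl K≤l
    after : ∀ {i} → J < i → i < B l → J ≺ i
    after {i} p q with l <? i
    ... | yes l<i = ≺-trans J≺l (IsHi.inner (isB l<n) l<i q)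
    ... | no l≮i = after′ p (≮⇒≥ l≮i)
    -- If the left edge of `l` is further left than `l`, then `l - 1` comes after `l`, so the rows
    -- of `l` start at `l` itself.
    T≤T : T (suc J) ≤ T l
    T≤T with m≤n⇒m<n∨m≡n K≤l | m≤n⇒m<n∨m≡n (T≤ l<n)
    ... | inj₂ refl | _ = ≤-refl
    ... | inj₁ K<l | inj₂ T≡l = ≤-trans (T≤ K<n) (≤-trans K≤l (≤-reflexive (sym T≡l)))
    ... | inj₁ K<l | inj₁ T<l = last l refl T<l K<l
      where
      last : ∀ {A : Set} m → l ≡ m → T l < m → suc J < m → A
      last (suc i) refl T<l K<l = Ab (IsLo.inner (isT l<n) (s≤s⁻¹ T<l) ≤-refl) (IsLo.inner s (s≤s⁻¹ K<l) ≤-refl)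

-- The order in which a permutation lists its labels

-- Labels beyond n are put at the end, in their natural order.
rank : Perm n → ℕ → ℕ
rank {n} x i with i <? n
... | yes i<n = toℕ (x ⟨$⟩ˡ fromℕ< i<n)
... | no  _   = i

rank-toℕ : (x : Perm n) (k : Fin n) → rank x (toℕ k) ≡ toℕ (x ⟨$⟩ˡ k)
rank-toℕ {n} x k with toℕ k <? n
... | yes p = cong (λ v → toℕ (x ⟨$⟩ˡ v)) (fromℕ<-toℕ k p)
... | no ¬p = contradiction (toℕ<n k) ¬p

⟨$⟩ˡ-injective : (x : Perm n) {u v : Fin n} → x ⟨$⟩ˡ u ≡ x ⟨$⟩ˡ v → u ≡ v
⟨$⟩ˡ-injective x eq = trans (sym (inverseʳ x)) (trans (cong (x ⟨$⟩ʳ_) eq) (inverseʳ x))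

rank-beyond : (x : Perm n) {v : ℕ} → ¬ v < n → rank x v ≡ v
rank-beyond {n} x {v} v≮n with v <? n
... | yes v<n = contradiction v<n v≮n
... | no _    = refl

rank-injective : (x : Perm n) {i j : ℕ} → rank x i ≡ rank x j → i ≡ j
rank-injective {n} x {i} {j} eq with i <? n | j <? n
... | yes p | yes q = fromℕ<-injective _ _ p q (⟨$⟩ˡ-injective x (toℕ-injective eq))
... | yes p | no ¬q = contradiction (subst (_< n) eq (toℕ<n _)) ¬q
... | no ¬p | yes q = contradiction (subst (_< n) (sym eq) (toℕ<n _)) ¬p
... | no _  | no _  = eq

Before : Perm n → ℕ → ℕ → Set
Before x i j = rank x i < rank x j

before : (x : Perm n) → StrictTotal (Before x)
before x = record
  { ≺-trans = <-trans
  ; ≺-asym  = <-asym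
  ; ≺-conn  = λ {i} {j} i≢j → conn i≢j
  ; _≺?_    = λ i j → rank x i <? rank x j
  }
  where
  conn : ∀ {i j} → i ≢ j → Before x i j ⊎ Before x j i
  conn {i} {j} i≢j with <-cmp (rank x i) (rank x j)
  ... | tri< p _ _ = inj₁ p
  ... | tri≈ _ p _ = contradiction (rank-injective x p) i≢j
  ... | tri> _ _ p = inj₂ p

extentsOf : (x : Perm n) → Extents n (Before x)
extentsOf x = extents (before x)

rectOf : ∀ {_≺_} → Extents n _≺_ → ℕ → Rect ℕ
rectOf {n} E k = rect (L k) (R k) (n ∸ B k) (n ∸ T k)
  where open Extents E

rect≡ : ∀ {l l′ r r′ b b′ t t′ : ℕ} → l ≡ l′ → r ≡ r′ → b ≡ b′ → t ≡ t′ → rect l r b t ≡ rect l′ r′ b′ t′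
rect≡ refl refl refl refl = refl

-- The region filled by the map ρ

greatest-unique : ∀ b {P : ℕ → Set} (P? : ∀ m → Dec (P m)) m → m ≤ b → P m →
  (∀ {m′} → m < m′ → m′ ≤ b → ¬ P m′) → greatest≤ b P? ≡ m
greatest-unique zero    P? zero z≤n _ _ = refl
greatest-unique (suc b) P? m m≤b p max with P? (suc b)
... | yes q with m≤n⇒m<n∨m≡n m≤b
...   | inj₁ m<b = contradiction q (max m<b ≤-refl)
...   | inj₂ eq  = sym eq
greatest-unique (suc b) P? m m≤b p max | no ¬q with m≤n⇒m<n∨m≡n m≤b
...   | inj₁ m<b  = greatest-unique b P? m (s≤s⁻¹ m<b) p (λ l r → max l (m≤n⇒m≤1+n r))
...   | inj₂ refl = contradiction p ¬q

-- The cell in column c and row r is filled once the labels in D are drawn.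
Region : (ℕ → Set) → ℕ → ℕ → Set
Region D c r = (c ≤ r × ∃ λ m → c ≤ m × m ≤ r × D m) ⊎ (r < c × (∀ {m} → r ≤ m → m ≤ c → D m))

Region-map : ∀ {D D′ : ℕ → Set} → (∀ {m} → D m → D′ m) → ∀ {c r} → Region D c r → Region D′ c r
Region-map f (inj₁ (le , m , p , q , d)) = inj₁ (le , m , p , q , f d)
Region-map f (inj₂ (lt , all)) = inj₂ (lt , λ p q → f (all p q))

-- The point tested is the top right corner of the cell. It suffices because the drawn region is
-- left- and bottom-justified: a drawn rectangle containing this corner covers the cell or lies to
-- the right of it or above, and then the cell is filled already.
Fills : (n : ℕ) → List (Rect ℕ) → (ℕ → Set) → Set
Fills n T D = ∀ c r → c < n → r < n → InT T (suc c , n ∸ r) ⇔ Region D c r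

module Draw {_≺_ : ℕ → ℕ → Set} (o : StrictTotal _≺_) (E : Extents n _≺_) (kᶠ : Fin n) where
  open StrictTotal o
  open Extents E

  private
    k = toℕ kᶠ
    k<n = toℕ<n kᶠ
    isLk = isL k<n
    isRk = isR k<n
    isTk = isT k<n
    isBk = isB k<n

  Upto : ℕ → Set
  Upto i = i ≺ toℕ kᶠ ⊎ i ≡ toℕ kᶠ

  -- Justification of the region again: whatever lies left of and below the top right corner of the
  -- new rectangle is filled, by `k` or by a label drawn earlier.
  rect⇒region : ∀ {c r} → suc c ≤ R k → T k ≤ r → Region Upto c r
  rect⇒region {c} {r} c<R T≤r with c ≤? r
  ... | yes c≤r = inj₁ (c≤r , below)
    where
    below : ∃ λ m → c ≤ m × m ≤ r × Upto m
    below with c ≤? k | k ≤? r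
    ... | yes p | yes q = k , p , q , inj₂ refl
    ... | no p | _ = c , ≤-refl , c≤r , inj₁ (IsHi.inner isRk (≰⇒> p) c<R)
    ... | yes _ | no q = r , c≤r , ≤-refl , inj₁ (IsLo.inner isTk T≤r (≰⇒> q))
  ... | no c≰r = inj₂ (≰⇒> c≰r , above)
    where
    above : ∀ {m} → r ≤ m → m ≤ c → Upto m
    above {m} p q with <-cmp m k
    ... | tri< m<k _ _ = inj₁ (IsLo.inner isTk (≤-trans T≤r p) m<k)
    ... | tri≈ _ eq _ = inj₂ eq
    ... | tri> _ _ k<m = inj₁ (IsHi.inner isRk k<m (≤-<-trans q c<R))

  private
    strict : ∀ {i} → Upto i → i ≢ k → i ≺ k
    strict (inj₁ p) _ = p
    strict (inj₂ e) ne = contradiction e ne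

  -- On or below the diagonal, a cell for which `k` counts but which lies outside the rectangle of
  -- `k` is beyond an end of a run of `k`; the label just past that end comes before `k` and has
  -- filled the cell. Above the diagonal, all labels from row to column are drawn, so the runs of
  -- `k` cover the cell unless `k` is not among them.
  region⇒rect : ∀ {c r} → c < n → r < n → Region Upto c r →
    Region (_≺ k) c r ⊎ (L k ≤ suc c × suc c ≤ R k × T k ≤ r × r ≤ B k)
  region⇒rect c<n r<n (inj₁ (c≤r , m , p , q , inj₁ m≺k)) = inj₁ (inj₁ (c≤r , m , p , q , m≺k))
  region⇒rect {c} {r} c<n r<n (inj₁ (c≤r , m , p , q , inj₂ refl)) with L k ≤? c | r <? B k
  ... | yes l | yes b = inj₂ (m≤n⇒m≤1+n l , ≤-<-trans p (<R k<n) , ≤-trans (T≤ k<n) q , <⇒≤ b)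
  ... | no l | _ with L k | isLk | ≰⇒> l
  ...   | suc i | s | s≤s c≤i = inj₁ (inj₁ (c≤r , i , c≤i , ≤-trans (<⇒≤ (IsLo.lo≤ s)) q , IsLo.outer s refl))
  region⇒rect {c} {r} c<n r<n (inj₁ (c≤r , m , p , q , inj₂ refl)) | yes _ | no b =
    let B≤r = ≮⇒≥ b in
    inj₁ (inj₁ (c≤r , B k , ≤-trans p (<⇒≤ (<B k<n)) , B≤r , IsHi.outer isBk (≤-<-trans B≤r r<n)))
  region⇒rect {c} {r} c<n r<n (inj₂ (r<c , all)) with r ≤? k | k ≤? c
  ... | yes p | yes q = inj₂ (≤-trans (L≤ k<n) (m≤n⇒m≤1+n q) ,
      hi-greatest (reverse o) isRk c<n (λ k<i i≤c → strict (all (≤-trans p (<⇒≤ k<i)) (s≤s⁻¹ i≤c)) (>⇒≢ k<i)) ,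
      lo-least (reverse o) isTk p (λ r≤i i<k → strict (all r≤i (≤-trans (<⇒≤ i<k) q)) (<⇒≢ i<k)) ,
      ≤-trans p (<⇒≤ (<B k<n)))
  ... | no p | _ = inj₁ (inj₂ (r<c , λ l u → strict (all l u) λ { refl → p l }))
  ... | yes _ | no p = inj₁ (inj₂ (r<c , λ l u → strict (all l u) λ { refl → p u }))

  module _ (T : List (Rect ℕ)) (fills : Fills n T (_≺ k)) where
    private
      T′ = Extents.T E (toℕ kᶠ)

      module F {c r} (c<n : c < n) (r<n : r < n) = Equivalence (fills c r c<n r<n)

      n∸v<n : ∀ {v} → 0 < v → v ≤ n → n ∸ v < n
      n∸v<n 0<v v≤n = ∸-monoʳ-< 0<v v≤n

      -- The diagonal point next to `k` is in `T` exactly when the neighbouring label on that side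
      -- has been drawn, or when the point is a corner of the square, where these implications are
      -- void.
      LeftCorner RightCorner : Set
      LeftCorner  = ∀ {j} → suc j ≡ k → j ≺ k
      RightCorner = suc k < n → suc k ≺ k

      to-region : ∀ {c v} → c < n → 0 < v → v ≤ n → InT T (suc c , v) → Region (_≺ k) c (n ∸ v)
      to-region {c} c<n 0<v v≤n t =
        F.to c<n (n∸v<n 0<v v≤n) (subst (λ v → InT T (suc c , v)) (sym (m∸[m∸n]≡n v≤n)) t)

      leftCorner⇒ : InT T (k , n ∸ k) → LeftCorner
      leftCorner⇒ t {j} eq with F.to (<-trans (≤-reflexive eq) k<n) k<n (subst (λ u → InT T (u , n ∸ k)) (sym eq) t)
      ... | inj₂ (k<j , _) = contradiction k<j (<-asym (≤-reflexive eq))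
      ... | inj₁ (_ , m , p , q , m≺k) with m≤n⇒m<n∨m≡n q
      ...   | inj₁ m<k = subst (_≺ k) (≤-antisym (s≤s⁻¹ (subst (m <_) (sym eq) m<k)) p) m≺k
      ...   | inj₂ refl = contradiction m≺k (≺-asym m≺k)

      leftCorner⇐ : LeftCorner → InT T (k , n ∸ k)
      leftCorner⇐ c = go k refl
        where
        go : ∀ m → k ≡ m → InT T (m , n ∸ m)
        go zero eq = inj₁ refl
        go (suc j) eq = F.from j<n (subst (_< n) eq k<n) (inj₁ (n≤1+n j , j , ≤-refl , n≤1+n j , c (sym eq)))
          where j<n = <-trans (n<1+n j) (subst (_< n) eq k<n)

      rightCorner⇒ : InT T (suc k , n ∸ suc k) → RightCorner
      rightCorner⇒ t K<n with F.to k<n K<n t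
      ... | inj₂ (K<k , _) = contradiction K<k (<-asym (n<1+n k))
      ... | inj₁ (_ , m , p , q , m≺k) with m≤n⇒m<n∨m≡n p
      ...   | inj₁ k<m = subst (_≺ k) (≤-antisym q k<m) m≺k
      ...   | inj₂ refl = contradiction m≺k (≺-asym m≺k)

      rightCorner⇐ : RightCorner → InT T (suc k , n ∸ suc k)
      rightCorner⇐ c with suc k <? n
      ... | no K≮n = inj₂ (inj₁ (m≤n⇒m∸n≡0 (≮⇒≥ K≮n)))
      ... | yes K<n = F.from k<n K<n (inj₁ (n≤1+n k , suc k , n≤1+n k , ≤-refl , c K<n))

      ¬LeftCorner⇒ : ¬ LeftCorner → T′ ≡ k
      ¬LeftCorner⇒ ¬c with m≤n⇒m<n∨m≡n (T≤ k<n)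
      ... | inj₂ eq = eq
      ... | inj₁ T<k = contradiction (λ {j} eq → IsLo.inner isTk (s≤s⁻¹ (subst (T′ <_) (sym eq) T<k)) (≤-reflexive eq)) ¬c

      top-left : ¬ LeftCorner → greatest≤ k (λ u → inT? T (u , n ∸ k)) ≡ L k
      top-left ¬c = greatest-unique k _ (L k) (L≤ k<n) (at (L k) refl) after
        where
        at : ∀ m → L k ≡ m → InT T (m , n ∸ k)
        at zero eq = inj₁ refl
        at (suc i) eq = F.from (<-trans i<k k<n) k<n (inj₁ (<⇒≤ i<k , i , ≤-refl , <⇒≤ i<k , IsLo.outer isLk (sym eq)))
          where i<k = subst (_≤ k) eq (L≤ k<n)
        after : ∀ {u} → L k < u → u ≤ k → ¬ InT T (u , n ∸ k)
        after {suc c} l c<k t with F.to (<-trans c<k k<n) k<n t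
        ... | inj₂ (k<c , _) = <-asym k<c c<k
        ... | inj₁ (_ , m , p , q , m≺k) with m≤n⇒m<n∨m≡n q
        ...   | inj₁ m<k = ≺-asym m≺k (IsLo.inner isLk (≤-trans (s≤s⁻¹ l) p) m<k)
        ...   | inj₂ refl = ≺-asym m≺k m≺k

      LeftCorner⇒ : LeftCorner → L k ≡ k
      LeftCorner⇒ c with m≤n⇒m<n∨m≡n (L≤ k<n)
      ... | inj₂ eq = eq
      ... | inj₁ l = go k refl l
        where
        go : ∀ m → k ≡ m → L k < m → L k ≡ k
        go (suc j) eq (s≤s l) = contradiction (c (sym eq)) (≺-asym (IsLo.inner isLk l (≤-reflexive (sym eq))))

      top-end : LeftCorner → greatest≤ n (λ v → inT? T (k , v)) ≡ n ∸ T′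
      top-end c = greatest-unique n _ (n ∸ T′) (m∸n≤m n T′) (at k refl) after
        where
        T<n = ≤-<-trans (T≤ k<n) k<n
        at : ∀ m → k ≡ m → InT T (m , n ∸ T′)
        at zero eq = inj₁ refl
        at (suc j) eq with j ≤? T′
        ... | yes p = F.from (<-trans (≤-reflexive (sym eq)) k<n) T<n (inj₁ (p , j , ≤-refl , p , c (sym eq)))
        ... | no p = F.from (<-trans (≤-reflexive (sym eq)) k<n) T<n
          (inj₂ (≰⇒> p , λ l u → IsLo.inner isTk l (subst (_ <_) (sym eq) (s≤s u))))
        after : ∀ {v} → n ∸ T′ < v → v ≤ n → ¬ InT T (k , v)
        after {v} l v≤n t = go k refl
          where
          0<v = ≤-<-trans z≤n l
          r<T : n ∸ v < T′
          r<T = ∸-cancelʳ-< (subst (n ∸ T′ <_) (sym (m∸[m∸n]≡n v≤n)) l)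
          go : ∀ m → ¬ k ≡ m
          go zero eq = contradiction (<-≤-trans r<T (subst (T′ ≤_) eq (T≤ k<n))) λ ()
          go (suc j) eq = contradiction (lo-least (reverse o) isTk (<⇒≤ (<-≤-trans r<T (T≤ k<n))) all) (<⇒≱ r<T)
            where
            all : ∀ {i} → n ∸ v ≤ i → i < k → i ≺ k
            all {i} p q with to-region {j} (<-trans (≤-reflexive (sym eq)) k<n) 0<v v≤n (subst (λ u → InT T (u , v)) eq t)
            ... | inj₁ (j≤r , _) = subst (_≺ k) (≤-antisym (≤-trans j≤r p) (s≤s⁻¹ (subst (i <_) eq q))) (c (sym eq))
            ... | inj₂ (_ , f) = f p (s≤s⁻¹ (subst (i <_) eq q))

      ¬RightCorner⇒ : ¬ RightCorner → R k ≡ suc k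
      ¬RightCorner⇒ ¬c with m≤n⇒m<n∨m≡n (<R k<n)
      ... | inj₂ eq = sym eq
      ... | inj₁ l = contradiction (λ _ → IsHi.inner isRk ≤-refl l) ¬c

      bottom-right : ¬ RightCorner → greatest≤ (n ∸ suc k) (λ v → inT? T (suc k , v)) ≡ n ∸ B k
      bottom-right ¬c = greatest-unique (n ∸ suc k) _ (n ∸ B k) (∸-monoʳ-≤ n (<B k<n)) at after
        where
        at : InT T (suc k , n ∸ B k)
        at with m≤n⇒m<n∨m≡n (B≤ k<n)
        ... | inj₂ eq = inj₂ (inj₁ (trans (cong (n ∸_) eq) (n∸n≡0 n)))
        ... | inj₁ B<n = F.from k<n B<n (inj₁ (<⇒≤ (<B k<n) , B k , <⇒≤ (<B k<n) , ≤-refl , IsHi.outer isBk B<n))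
        after : ∀ {v} → n ∸ B k < v → v ≤ n ∸ suc k → ¬ InT T (suc k , v)
        after {v} l u t with to-region k<n (≤-<-trans z≤n l) (≤-trans u (m∸n≤m n (suc k))) t
        ... | inj₂ (r<k , _) = <-asym r<k (subst (_≤ n ∸ v) (m∸[m∸n]≡n k<n) (∸-monoʳ-≤ n u))
        ... | inj₁ (_ , m , p , q , m≺k) with m≤n⇒m<n∨m≡n p
        ...   | inj₁ k<m = ≺-asym m≺k (IsHi.inner isBk k<m (≤-<-trans q r<B))
          where r<B = ∸-cancelʳ-< (subst (n ∸ B k <_) (sym (m∸[m∸n]≡n (≤-trans u (m∸n≤m n (suc k))))) l)
        ...   | inj₂ refl = ≺-asym m≺k m≺k

      RightCorner⇒ : RightCorner → B k ≡ suc k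
      RightCorner⇒ c with m≤n⇒m<n∨m≡n (<B k<n)
      ... | inj₂ eq = sym eq
      ... | inj₁ l = contradiction (c (<-≤-trans l (B≤ k<n))) (≺-asym (IsHi.inner isBk ≤-refl l))

      right-end : RightCorner → greatest≤ n (λ u → inT? T (u , n ∸ suc k)) ≡ R k
      right-end c = greatest-unique n _ (R k) (R≤ k<n) (at (R k) refl) after
        where
        at : ∀ m → R k ≡ m → InT T (m , n ∸ suc k)
        at zero eq = inj₁ refl
        at (suc c′) eq with suc k <? n
        ... | no K≮n = inj₂ (inj₁ (m≤n⇒m∸n≡0 (≮⇒≥ K≮n)))
        ... | yes K<n with c′ ≤? suc k
        ...   | yes p = F.from (subst (_≤ n) eq (R≤ k<n)) K<n (inj₁ (p , suc k , p , ≤-refl , c K<n))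
        ...   | no p = F.from (subst (_≤ n) eq (R≤ k<n)) K<n
          (inj₂ (≰⇒> p , λ l u → IsHi.inner isRk l (subst (_ <_) (sym eq) (s≤s u))))
        after : ∀ {u} → R k < u → u ≤ n → ¬ InT T (u , n ∸ suc k)
        after {suc c′} l u t = contradiction (hi-greatest (reverse o) isRk u all) (<⇒≱ l)
          where
          K<n : suc k < n
          K<n = <-≤-trans (≤-<-trans (<R k<n) l) u
          all : ∀ {i} → k < i → i < suc c′ → i ≺ k
          all {i} p q with F.to u K<n t
          ... | inj₁ (c≤K , _) = subst (_≺ k) (≤-antisym p (≤-trans (s≤s⁻¹ q) c≤K)) (c K<n)
          ... | inj₂ (_ , f) = f p (s≤s⁻¹ q)

    newRect-extents : newRect n T kᶠ ≡ rectOf E (toℕ kᶠ)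
    newRect-extents with inT? T (toℕ kᶠ , n ∸ toℕ kᶠ) | inT? T (suc (toℕ kᶠ) , n ∸ suc (toℕ kᶠ))
    ... | no p | no q = rect≡ (top-left ¬l) (sym (¬RightCorner⇒ ¬r)) (bottom-right ¬r) (cong (n ∸_) (sym (¬LeftCorner⇒ ¬l)))
      where
      ¬l : ¬ LeftCorner
      ¬l c = p (leftCorner⇐ c)
      ¬r : ¬ RightCorner
      ¬r c = q (rightCorner⇐ c)
    ... | no p | yes q = rect≡ (top-left ¬l) (right-end r) (cong (n ∸_) (sym (RightCorner⇒ r))) (cong (n ∸_) (sym (¬LeftCorner⇒ ¬l)))
      where
      ¬l : ¬ LeftCorner
      ¬l c = p (leftCorner⇐ c)
      r : RightCorner
      r = rightCorner⇒ q
    ... | yes p | no q = rect≡ (sym (LeftCorner⇒ (leftCorner⇒ p))) (sym (¬RightCorner⇒ ¬r)) (bottom-right ¬r) (top-end (leftCorner⇒ p))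
      where
      ¬r : ¬ RightCorner
      ¬r c = q (rightCorner⇐ c)
    ... | yes p | yes q = rect≡ (sym (LeftCorner⇒ (leftCorner⇒ p))) (right-end (rightCorner⇒ q))
        (cong (n ∸_) (sym (RightCorner⇒ (rightCorner⇒ q)))) (top-end (leftCorner⇒ p))

module _ {n} (x : Perm n) where

  word-at : ∀ {p} (p<n : p < n) → drawn (take (suc p) (word x)) ≡
    newRect n (drawn (take p (word x))) (x ⟨$⟩ʳ fromℕ< p<n) ∷ drawn (take p (word x))
  word-at {p} p<n = trans (cong drawn eq) (Listₚ.foldl-∷ʳ (λ T k → newRect n T k ∷ T) [] (x ⟨$⟩ʳ i) (take p (word x)))
    where
    i = fromℕ< p<n
    eq : take (suc p) (word x) ≡ take p (word x) List.∷ʳ (x ⟨$⟩ʳ i)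
    eq = subst (λ q → take (suc q) (word x) ≡ take q (word x) List.∷ʳ (x ⟨$⟩ʳ i))
      (toℕ-fromℕ< p<n) (Listₚ.take-suc-tabulate (x ⟨$⟩ʳ_) i)

  rank-word : ∀ {p} (p<n : p < n) → rank x (toℕ (x ⟨$⟩ʳ fromℕ< p<n)) ≡ p
  rank-word p<n = trans (rank-toℕ x _) (trans (cong toℕ (inverseˡ x)) (toℕ-fromℕ< p<n))

  -- Shapes and region are established by one induction: the region filled after p steps determines
  -- the next rectangle by `newRect-extents`, and this rectangle determines the region after the
  -- next step.
  drawn-fills : ∀ p → p ≤ n → Fills n (drawn (take p (word x))) (λ m → rank x m < p)
  drawn-fills zero _ c r c<n r<n = mk⇔ to′ from′
    where
    to′ : InT [] (suc c , n ∸ r) → Region (λ m → rank x m < 0) c r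
    to′ (inj₂ (inj₁ eq)) = contradiction eq (>⇒≢ (m<n⇒0<n∸m r<n))
    from′ : Region (λ m → rank x m < 0) c r → InT [] (suc c , n ∸ r)
    from′ (inj₁ (_ , _ , _ , _ , ()))
    from′ (inj₂ (r<c , all)) with all ≤-refl (<⇒≤ r<c)
    ... | ()
  drawn-fills (suc p) p<n c r c<n r<n = subst
      (λ T → InT T (suc c , n ∸ r) ⇔ Region (λ m → rank x m < suc p) c r)
      (sym (trans (word-at p<n) (cong (_∷ T) new≡))) (mk⇔ to′ from′)
    where
    T = drawn (take p (word x))
    kᶠ = x ⟨$⟩ʳ fromℕ< p<n
    k = toℕ kᶠ
    E = extentsOf x
    rk≡ = rank-word p<n
    k<n = toℕ<n kᶠ
    open Draw (before x) E kᶠ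
    fills : Fills n T (λ m → Before x m k)
    fills = subst (λ q → Fills n T (λ m → rank x m < q)) (sym rk≡) (drawn-fills p (<⇒≤ p<n))
    new≡ : newRect n T kᶠ ≡ rectOf E k
    new≡ = newRect-extents T fills
    upto⇒ : ∀ {m} → Upto m → rank x m < suc p
    upto⇒ (inj₁ q) = m≤n⇒m≤1+n (subst (_ <_) rk≡ q)
    upto⇒ (inj₂ eq) = s≤s (≤-reflexive (trans (cong (rank x) eq) rk≡))
    upto⇐ : ∀ {m} → rank x m < suc p → Upto m
    upto⇐ (s≤s q) with m≤n⇒m<n∨m≡n q
    ... | inj₁ lt = inj₁ (subst (_ <_) (sym rk≡) lt)
    ... | inj₂ eq = inj₂ (rank-injective x (trans eq (sym rk≡)))
    to′ : InT (rectOf E k ∷ T) (suc c , n ∸ r) → Region (λ m → rank x m < suc p) c r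
    to′ (inj₂ (inj₁ eq)) = contradiction eq (>⇒≢ (m<n⇒0<n∸m r<n))
    to′ (inj₂ (inj₂ (here (_ , u , _ , t)))) = Region-map upto⇒ (rect⇒region u
      (∸-cancelʳ-≤ (≤-trans (Extents.T≤ E k<n) (<⇒≤ k<n)) t))
    to′ (inj₂ (inj₂ (there a))) = Region-map (λ q → upto⇒ (inj₁ q)) (Equivalence.to (fills c r c<n r<n) (inj₂ (inj₂ a)))
    from′ : Region (λ m → rank x m < suc p) c r → InT (rectOf E k ∷ T) (suc c , n ∸ r)
    from′ g with region⇒rect c<n r<n (Region-map upto⇐ g)
    ... | inj₂ (l , u , t , b) = inj₂ (inj₂ (here (l , u , ∸-monoʳ-≤ n b , ∸-monoʳ-≤ n t)))
    ... | inj₁ old with Equivalence.from (fills c r c<n r<n) old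
    ...   | inj₂ (inj₁ e) = inj₂ (inj₁ e)
    ...   | inj₂ (inj₂ a) = inj₂ (inj₂ (there a))

  newRect-ρ : ∀ k → newRect n (drawn (take (toℕ (x ⟨$⟩ˡ k)) (word x))) k ≡ rectOf (extentsOf x) (toℕ k)
  newRect-ρ k = Draw.newRect-extents (before x) (extentsOf x) k T
      (subst (λ q → Fills n T (λ m → rank x m < q)) (sym (rank-toℕ x k)) (drawn-fills _ (<⇒≤ (toℕ<n (x ⟨$⟩ˡ k)))))
    where T = drawn (take (toℕ (x ⟨$⟩ˡ k)) (word x))

-- Tilings and walls

-- Repeats the conversion that is local to `ρ`; both unfold to the same term.
toℚ : ℕ → ℚ
toℚ m = mkℚ (ℤ.+ m) 0 (Coprimality.sym (Coprimality.1-coprimeTo m))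

toℚ-mono-≤ : ∀ {i j} → i ≤ j → toℚ i ℚ.≤ toℚ j
toℚ-mono-≤ {i} {j} p = *≤* (subst₂ ℤ._≤_ (sym (ℤₚ.*-identityʳ (ℤ.+ i))) (sym (ℤₚ.*-identityʳ (ℤ.+ j))) (ℤ.+≤+ p))

toℚ-cancel-≤ : ∀ {i j} → toℚ i ℚ.≤ toℚ j → i ≤ j
toℚ-cancel-≤ {i} {j} (*≤* p) = ℤₚ.drop‿+≤+ (subst₂ ℤ._≤_ (ℤₚ.*-identityʳ (ℤ.+ i)) (ℤₚ.*-identityʳ (ℤ.+ j)) p)

toℚ-mono-< : ∀ {i j} → i < j → toℚ i ℚ.< toℚ j
toℚ-mono-< p = ℚₚ.≰⇒> λ q → <⇒≱ p (toℚ-cancel-≤ q)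

toℚ-cancel-< : ∀ {i j} → toℚ i ℚ.< toℚ j → i < j
toℚ-cancel-< p = ≰⇒> λ q → ℚₚ.<-irrefl refl (ℚₚ.<-≤-trans p (toℚ-mono-≤ q))

toℚ-injective : ∀ {i j} → toℚ i ≡ toℚ j → i ≡ j
toℚ-injective p = ≤-antisym (toℚ-cancel-≤ (ℚₚ.≤-reflexive p)) (toℚ-cancel-≤ (ℚₚ.≤-reflexive (sym p)))

flipR : {A : Set} → Rect A → Rect A
flipR q = rect (bottom q) (top q) (left q) (right q)

record IsTiling (F : Rect ℚ) (t : Fin n → Rect ℚ) : Set where
  field
    nonEmpty : ∀ k → NonEmptyRect (t k)
    disjoint : ∀ {k l} → k ≢ l → ∀ {p} → Interior (t k) p → ¬ Interior (t l) p
    inside   : ∀ k {p} → Closed (t k) p → Closed F p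
    covers   : ∀ p → Closed F p → ∃ λ k → Closed (t k) p

flipTiling : {F : Rect ℚ} {t : Fin n → Rect ℚ} → IsTiling F t → IsTiling (flipR F) (flipR ∘ t)
flipTiling T = record
  { nonEmpty = λ k → let h , v = nonEmpty k in v , h
  ; disjoint = λ ne i j → disjoint ne (swap₄ i) (swap₄ j)
  ; inside   = λ k i → swap₄ (inside k (swap₄ i))
  ; covers   = λ { (x , y) i → let k , c = covers (y , x) (swap₄ i) in k , swap₄ c }
  }
  where
  open IsTiling T
  swap₄ : {A B C D : Set} → A × B × C × D → C × D × A × B
  swap₄ (a , b , c , d) = c , d , a , b

module _ (F : Rect ℚ) (t : Fin n → Rect ℚ) where

  record VAvoid (c a b : ℚ) : Set where
    field
      proper : a ℚ.< b
      inside : ∀ {y} → a ℚ.≤ y → y ℚ.≤ b → Closed F (c , y)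
      avoids : ∀ k {y} → a ℚ.≤ y → y ℚ.≤ b → ¬ Interior (t k) (c , y)

  -- The vertical walls of a tiling; the horizontal ones are those of the
  -- reflected tiling.
  record VWall (c a b : ℚ) : Set where
    field
      avoid   : VAvoid c a b
      c≢left  : c ≢ left F
      c≢right : c ≢ right F
      maximal : ∀ {a′ b′} → VAvoid c a′ b′ → a′ ℚ.≤ a → b ℚ.≤ b′ → a ℚ.≤ a′ × b′ ℚ.≤ b
    open VAvoid avoid public

-- Each end is on the boundary of the square or hits an edge of a rectangle,
-- so that the segment is maximal.
record NatWall (m : ℕ) (u : Fin n → Rect ℕ) (c a b : ℕ) : Set where
  field
    0<c    : 0 < c
    c<m    : c < m
    a<b    : a < b
    b≤m    : b ≤ m
    avoids : ∀ k → left (u k) < c → c < right (u k) → bottom (u k) < b → ¬ a < top (u k)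
    upper  : b ≡ m ⊎ ∃ λ k → left (u k) < c × c < right (u k) × bottom (u k) ≤ b × b < top (u k)
    lower  : a ≡ 0 ⊎ ∃ λ k → left (u k) < c × c < right (u k) × bottom (u k) < a × a ≤ top (u k)

square : ℕ → Rect ℚ
square m = mapRect toℚ (rect 0 m 0 m)

dense-above : ∀ {a b c} → a ℚ.< b → a ℚ.< c → ∃ λ y → a ℚ.< y × y ℚ.< b × y ℚ.< c
dense-above {a} {b} {c} p q with ℚₚ.≤-total b c
... | inj₁ b≤c = let y , l , r = ℚₚ.<-dense p in y , l , r , ℚₚ.<-≤-trans r b≤c
... | inj₂ c≤b = let y , l , r = ℚₚ.<-dense q in y , l , ℚₚ.<-≤-trans r c≤b , r

dense-below : ∀ {a b c} → b ℚ.< a → c ℚ.< a → ∃ λ y → b ℚ.< y × c ℚ.< y × y ℚ.< a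
dense-below {a} {b} {c} p q with ℚₚ.≤-total b c
... | inj₁ b≤c = let y , l , r = ℚₚ.<-dense q in y , ℚₚ.≤-<-trans b≤c l , l , r
... | inj₂ c≤b = let y , l , r = ℚₚ.<-dense p in y , l , ℚₚ.≤-<-trans c≤b l , r

natWall : ∀ {m c a b} {u : Fin n → Rect ℕ} {t : Fin n → Rect ℚ} →
  (∀ k → t k ≡ mapRect toℚ (u k)) → NatWall m u c a b → VWall (square m) t (toℚ c) (toℚ a) (toℚ b)
natWall {m = m} {c} {a} {b} {u} {t} t≡ W = record
  { avoid = record
    { proper = toℚ-mono-< a<b
    ; inside = λ p q → toℚ-mono-≤ z≤n , toℚ-mono-≤ (<⇒≤ c<m) , ℚₚ.≤-trans (toℚ-mono-≤ z≤n) p , ℚₚ.≤-trans q (toℚ-mono-≤ b≤m)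
    ; avoids = λ k p q i → no-interior k p q (subst (λ r → Interior r _) (t≡ k) i)
    }
  ; c≢left  = λ e → >⇒≢ 0<c (toℚ-injective e)
  ; c≢right = λ e → <⇒≢ c<m (toℚ-injective e)
  ; maximal = λ V p q → low V p q , high V p q
  }
  where
  open NatWall W
  no-interior : ∀ k {y} → toℚ a ℚ.≤ y → y ℚ.≤ toℚ b → ¬ Interior (mapRect toℚ (u k)) (toℚ c , y)
  no-interior k p q (l , r , b′ , t′) = avoids k (toℚ-cancel-< l) (toℚ-cancel-< r)
    (toℚ-cancel-< (ℚₚ.<-≤-trans b′ q)) (toℚ-cancel-< (ℚₚ.≤-<-trans p t′))
  a<b′ = toℚ-mono-< a<b
  module _ {a′ b′} (V : VAvoid (square m) t (toℚ c) a′ b′) (p : a′ ℚ.≤ toℚ a) (q : toℚ b ℚ.≤ b′) where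
    open VAvoid V renaming (avoids to avoidsⱽ; inside to insideⱽ; proper to properⱽ)
    bad : ∀ k {y} → Interior (mapRect toℚ (u k)) (toℚ c , y) → a′ ℚ.≤ y → ¬ y ℚ.≤ b′
    bad k i l r = avoidsⱽ k l r (subst (λ s → Interior s _) (sym (t≡ k)) i)
    high : b′ ℚ.≤ toℚ b
    high with upper
    ... | inj₁ refl = let _ , _ , _ , h = insideⱽ (ℚₚ.<⇒≤ properⱽ) ℚₚ.≤-refl in h
    -- A point of the prolongation shortly past the end would be interior to the rectangle that
    -- blocks the wall.
    ... | inj₂ (k , l , r , bo , to′) = ℚₚ.≮⇒≥ λ b<b′ →
      let y , y> , y<t , y<b′ = dense-above (toℚ-mono-< to′) b<b′
      in bad k (toℚ-mono-< l , toℚ-mono-< r , ℚₚ.≤-<-trans (toℚ-mono-≤ bo) y> , y<t)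
           (ℚₚ.≤-trans p (ℚₚ.<⇒≤ (ℚₚ.<-trans a<b′ y>))) (ℚₚ.<⇒≤ y<b′)
    low : toℚ a ℚ.≤ a′
    low with lower
    ... | inj₁ refl = let _ , _ , h , _ = insideⱽ ℚₚ.≤-refl (ℚₚ.<⇒≤ properⱽ) in h
    ... | inj₂ (k , l , r , bo , to′) = ℚₚ.≮⇒≥ λ a′<a →
      let y , b<y , a′<y , y<a = dense-below (toℚ-mono-< bo) a′<a
      in bad k (toℚ-mono-< l , toℚ-mono-< r , b<y , ℚₚ.<-≤-trans y<a (toℚ-mono-≤ to′))
           (ℚₚ.<⇒≤ a′<y) (ℚₚ.≤-trans (ℚₚ.<⇒≤ (ℚₚ.<-trans y<a a<b′)) q)

-- Diagonal rectangulations

tile-ρ : (x : Perm n) (k : Fin n) → tile (ρ x) k ≡ mapRect toℚ (rectOf (extentsOf x) (toℕ k))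
tile-ρ x k = trans (lookup∘tabulate _ k) (cong (mapRect toℚ) (newRect-ρ x k))

locate : ∀ m {y} → 0 < m → toℚ 0 ℚ.≤ y → y ℚ.≤ toℚ m → ∃ λ c → c < m × toℚ c ℚ.≤ y × y ℚ.≤ toℚ (suc c)
locate (suc m) {y} _ 0≤y y≤ with toℚ m ℚₚ.≤? y
... | yes p = m , ≤-refl , p , y≤
... | no p with m
...   | zero = contradiction 0≤y p
...   | suc m′ = let c , c< , l , r = locate (suc m′) (s≤s z≤n) 0≤y (ℚₚ.<⇒≤ (ℚₚ.≰⇒> p)) in c , m≤n⇒m≤1+n c< , l , r

module _ {_≺_ : ℕ → ℕ → Set} (o : StrictTotal _≺_) (E : Extents n _≺_) where
  open Extents E
  private
    module O = Tiles o E
    module P = Tiles (reverse o) (transposeᴱ E)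

  tileAt : ∀ {c r} → c < n → r < n → ∃ λ k → k < n × O.InTile k c r
  tileAt {c} {r} c<n r<n with ≤-total c r
  ... | inj₁ c≤r = O.tileBelow c≤r r<n
  ... | inj₂ r≤c = let k , k<n , t , b , l , r = P.tileBelow r≤c c<n in k , k<n , l , r , t , b

  tile-unique : ∀ {k k′ c r} → k < n → k′ < n → O.InTile k c r → O.InTile k′ c r → k ≡ k′
  tile-unique {c = c} {r} k<n k′<n i@(l , r₁ , t , b) i′@(l′ , r₁′ , t′ , b′) with ≤-total c r
  ... | inj₁ c≤r = O.uniqueBelow k<n k′<n c≤r i i′
  ... | inj₂ r≤c = P.uniqueBelow k<n k′<n r≤c (t , b , l , r₁) (t′ , b′ , l′ , r₁′)

  grid-tiling : 0 < n → {t : Fin n → Rect ℚ} → (∀ k → t k ≡ mapRect toℚ (rectOf E (toℕ k))) → IsTiling (square n) t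
  grid-tiling 0<n {t} t≡ = record
    { nonEmpty = λ k → subst NonEmptyRect (sym (t≡ k)) (nonEmpty′ k)
    ; disjoint = λ {k} {l} ne i j → ne (toℕ-injective (disjoint′ k l
        (subst (λ s → Interior s _) (t≡ k) i) (subst (λ s → Interior s _) (t≡ l) j)))
    ; inside   = λ k i → inside′ k (subst (λ s → Closed s _) (t≡ k) i)
    ; covers   = λ p i → let k , c = covers′ p i in k , subst (λ s → Closed s _) (sym (t≡ k)) c
    }
    where
    tileℚ : Fin n → Rect ℚ
    tileℚ k = mapRect toℚ (rectOf E (toℕ k))
    nonEmpty′ : ∀ k → NonEmptyRect (tileℚ k)
    nonEmpty′ k = toℚ-mono-< (≤-<-trans (L≤ k<n) (<R k<n)) ,
        toℚ-mono-< (∸-monoʳ-< (≤-<-trans (T≤ k<n) (<B k<n)) (B≤ k<n))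
      where k<n = toℕ<n k
    disjoint′ : ∀ k l {p} → Interior (tileℚ k) p → Interior (tileℚ l) p → toℕ k ≡ toℕ l
    -- Overlapping interiors share a whole grid cell, namely the one whose column and row are the
    -- greater of the two starting columns and rows.
    disjoint′ kᶠ lᶠ (a , b , c , d) (a′ , b′ , c′ , d′) = tile-unique k<n l<n
        (m≤m⊔n (L k) (L l) , ⊔-lub (≤-<-trans (L≤ k<n) (<R k<n)) (lt a′ b) ,
         m≤m⊔n (T k) (T l) , ⊔-lub (≤-<-trans (T≤ k<n) (<B k<n)) (∸-cancelʳ-< {o = n} (lt c d′)))
        (m≤n⊔m (L k) (L l) , ⊔-lub (lt a b′) (≤-<-trans (L≤ l<n) (<R l<n)) ,
         m≤n⊔m (T k) (T l) , ⊔-lub (∸-cancelʳ-< {o = n} (lt c′ d)) (≤-<-trans (T≤ l<n) (<B l<n)))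
      where
      k = toℕ kᶠ
      l = toℕ lᶠ
      k<n = toℕ<n kᶠ
      l<n = toℕ<n lᶠ
      lt : ∀ {i j y} → toℚ i ℚ.< y → y ℚ.< toℚ j → i < j
      lt p q = toℚ-cancel-< (ℚₚ.<-trans p q)
    inside′ : ∀ k {p} → Closed (tileℚ k) p → Closed (square n) p
    inside′ k (a , b , c , d) = ℚₚ.≤-trans (toℚ-mono-≤ z≤n) a , ℚₚ.≤-trans b (toℚ-mono-≤ (R≤ k<n)) ,
        ℚₚ.≤-trans (toℚ-mono-≤ z≤n) c , ℚₚ.≤-trans d (toℚ-mono-≤ (m∸n≤m n (T (toℕ k))))
      where k<n = toℕ<n k
    covers′ : ∀ p → Closed (square n) p → ∃ λ k → Closed (tileℚ k) p
    covers′ (x , y) (a , b , c , d) with locate n 0<n a b | locate n 0<n c d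
    ... | u , u<n , u≤x , x≤u | v , v<n , v≤y , y≤v with tileAt u<n r<n
      where
      r<n : n ∸ suc v < n
      r<n = ∸-monoʳ-< (s≤s z≤n) v<n
    ... | k , k<n , l , r , t′ , b′ = fromℕ< k<n , subst (λ j → Closed (mapRect toℚ (rectOf E j)) (x , y)) (sym (toℕ-fromℕ< k<n))
        (ℚₚ.≤-trans (toℚ-mono-≤ l) u≤x , ℚₚ.≤-trans x≤u (toℚ-mono-≤ r) ,
         ℚₚ.≤-trans (toℚ-mono-≤ bottom≤) v≤y , ℚₚ.≤-trans y≤v (toℚ-mono-≤ top≥))
      where
      bottom≤ : n ∸ B k ≤ v
      bottom≤ = ≤-trans (∸-monoʳ-≤ n b′) (≤-reflexive (trans (cong (n ∸_) (sym (+-∸-assoc 1 v<n))) (m∸[m∸n]≡n (<⇒≤ v<n))))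
      top≥ : suc v ≤ n ∸ T k
      top≥ = ≤-trans (≤-reflexive (sym (m∸[m∸n]≡n v<n))) (∸-monoʳ-≤ n t′)

  -- The walls through the diagonal point between J and K = J + 1.
  module _ {J : ℕ} (K<n : suc J < n) where
    private
      K = suc J
      J<n = <-trans (n<1+n J) K<n

    blockᶠ : ∀ {k} (k<n : k < n) {Q : Rect ℕ → Set} → Q (rectOf E k) → Q (rectOf E (toℕ (fromℕ< k<n)))
    blockᶠ k<n {Q} = subst (λ j → Q (rectOf E j)) (sym (toℕ-fromℕ< k<n))

    vertical-wall : J ≺ K → NatWall n (λ k → rectOf E (toℕ k)) K (n ∸ B J) (n ∸ T K)
    vertical-wall J≺K = record
      { 0<c = s≤s z≤n
      ; c<m = K<n
      ; a<b = ∸-monoʳ-< (O.wall-proper K<n J≺K) (B≤ J<n)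
      ; b≤m = m∸n≤m n (T K)
      ; avoids = λ k l r b t → O.wall-avoids K<n (toℕ<n k) J≺K l r (∸-cancelʳ-< b) (∸-cancelʳ-< t)
      ; upper = upper
      ; lower = lower
      }
      where
      upper : n ∸ T K ≡ n ⊎ _
      upper with O.wall-top K<n J≺K
      ... | inj₁ eq = inj₁ (cong (n ∸_) eq)
      ... | inj₂ (k , k<n , (l , r) , t , b) = inj₂ (fromℕ< k<n , blockᶠ k<n
        {λ q → left q < K × K < right q × bottom q ≤ n ∸ T K × n ∸ T K < top q}
        (l , r , ∸-monoʳ-≤ n b , ∸-monoʳ-< t (≤-trans (T≤ K<n) (<⇒≤ K<n))))
      lower : n ∸ B J ≡ 0 ⊎ _
      lower with O.wall-bottom K<n J≺K
      ... | inj₁ eq = inj₁ (trans (cong (n ∸_) eq) (n∸n≡0 n))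
      ... | inj₂ (k , k<n , (l , r) , t , b) = inj₂ (fromℕ< k<n , blockᶠ k<n
        {λ q → left q < K × K < right q × bottom q < n ∸ B J × n ∸ B J ≤ top q}
        (l , r , ∸-monoʳ-< b (B≤ k<n) , ∸-monoʳ-≤ n t))

    horizontal-wall : K ≺ J → NatWall n (λ k → flipR (rectOf E (toℕ k))) (n ∸ K) (L K) (R J)
    horizontal-wall K≺J = record
      { 0<c = m<n⇒0<n∸m K<n
      ; c<m = ∸-monoʳ-< (s≤s z≤n) (<⇒≤ K<n)
      ; a<b = P.wall-proper K<n K≺J
      ; b≤m = R≤ J<n
      ; avoids = λ k b t l r → P.wall-avoids K<n (toℕ<n k) K≺J (∸-cancelʳ-< t) (∸-cancelʳ-< b) r l
      ; upper = upper
      ; lower = lower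
      }
      where
      upper : R J ≡ n ⊎ _
      upper with P.wall-bottom K<n K≺J
      ... | inj₁ eq = inj₁ eq
      ... | inj₂ (k , k<n , (t , b) , l , r) = inj₂ (fromℕ< k<n , blockᶠ k<n
        {λ q → bottom q < n ∸ K × n ∸ K < top q × left q ≤ R J × R J < right q}
        (∸-monoʳ-< b (B≤ k<n) , ∸-monoʳ-< t (<⇒≤ K<n) , l , r))
      lower : L K ≡ 0 ⊎ _
      lower with P.wall-top K<n K≺J
      ... | inj₁ eq = inj₁ eq
      ... | inj₂ (k , k<n , (t , b) , l , r) = inj₂ (fromℕ< k<n , blockᶠ k<n
        {λ q → bottom q < n ∸ K × n ∸ K < top q × left q < L K × L K ≤ right q}
        (∸-monoʳ-< b (B≤ k<n) , ∸-monoʳ-< t (<⇒≤ K<n) , l , r))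

-- Sweeping along a wall

≤∧≢⇒<ℚ : ∀ {p q} → p ℚ.≤ q → p ≢ q → p ℚ.< q
≤∧≢⇒<ℚ p≤q p≢q = ℚₚ.≰⇒> λ q≤p → p≢q (ℚₚ.≤-antisym p≤q q≤p)

-- Stands in for a left limit: `c′` is so close to `c` that none of the finitely many values lies in
-- between. It makes it possible to ask for the tile immediately beside a wall.
just-below : ∀ {n} (f : Fin n → ℚ) {z c} → z ℚ.< c → ∃ λ c′ → z ℚ.< c′ × c′ ℚ.< c × (∀ k → f k ℚ.< c → f k ℚ.< c′)
just-below {zero} f z<c = let c′ , l , r = ℚₚ.<-dense z<c in c′ , l , r , λ ()
just-below {suc n} f {z} {c} z<c with just-below (f ∘ suc) z<c
... | c′ , z<c′ , c′<c , all with f zero ℚₚ.<? c′ | f zero ℚₚ.<? c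
...   | yes p | _ = c′ , z<c′ , c′<c , λ { zero _ → p ; (suc k) → all k }
...   | no _ | no ¬p = c′ , z<c′ , c′<c , λ { zero p → contradiction p ¬p ; (suc k) → all k }
...   | no c′≤ | yes p = let c″ , l , r = ℚₚ.<-dense p in
  c″ , ℚₚ.<-trans z<c′ (ℚₚ.≤-<-trans (ℚₚ.≮⇒≥ c′≤) l) , r ,
  λ { zero _ → l ; (suc k) q → ℚₚ.<-trans (all k q) (ℚₚ.≤-<-trans (ℚₚ.≮⇒≥ c′≤) l) }

just-above : ∀ {n} (f : Fin n → ℚ) {z c} → c ℚ.< z → ∃ λ c′ → c ℚ.< c′ × c′ ℚ.< z × (∀ k → c ℚ.< f k → c′ ℚ.< f k)
just-above {zero} f z<c = let c′ , l , r = ℚₚ.<-dense z<c in c′ , l , r , λ ()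
just-above {suc n} f {z} {c} c<z with just-above (f ∘ suc) c<z
... | c′ , c<c′ , c′<z , all with c′ ℚₚ.<? f zero | c ℚₚ.<? f zero
...   | yes p | _ = c′ , c<c′ , c′<z , λ { zero _ → p ; (suc k) → all k }
...   | no _ | no ¬p = c′ , c<c′ , c′<z , λ { zero p → contradiction p ¬p ; (suc k) → all k }
...   | no ≤c′ | yes p = let c″ , l , r = ℚₚ.<-dense p in
  c″ , l , ℚₚ.<-trans (ℚₚ.<-≤-trans r (ℚₚ.≮⇒≥ ≤c′)) c′<z ,
  λ { zero _ → r ; (suc k) q → ℚₚ.<-trans (ℚₚ.<-≤-trans r (ℚₚ.≮⇒≥ ≤c′)) (all k q) }

-- Contacts and the tiles on the two sides of a wall

module _ (t : Fin n → Rect ℚ) where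

  OnLeft OnRight : Fin n → ℚ → ℚ → ℚ → Set
  OnLeft  k c a b = right (t k) ≡ c × a ℚ.≤ bottom (t k) × top (t k) ℚ.≤ b
  OnRight k c a b = left  (t k) ≡ c × a ℚ.≤ bottom (t k) × top (t k) ℚ.≤ b

  -- The inequalities are weak because a contact in a single point counts in `LeftOf` and `Below`
  -- too.
  Touches : Fin n → Fin n → Set
  Touches k l = right (t k) ≡ left (t l) × bottom (t k) ℚ.≤ top (t l) × bottom (t l) ℚ.≤ top (t k)

  -- A chain of contacts that goes back and forth across a wall. An equation of the form `R k ≡ L l`
  -- that holds for contacts passes along such a chain to its ends.
  data Zigzag : Fin n → Fin n → Set where
    edge-of   : ∀ {k l} → Touches k l → Zigzag k l
    left-via  : ∀ {k m k′ l} → Touches k m → Touches k′ m → Zigzag k′ l → Zigzag k l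
    right-via : ∀ {k l′ m l} → Zigzag k l′ → Touches m l′ → Touches m l → Zigzag k l

-- The union of two collinear walls with a common point meets no interior of a tile, so it is no
-- longer than the first wall, which is maximal.
merge : ∀ {F} {t : Fin n → Rect ℚ} {c a b a′ b′ y} → VWall F t c a b → VWall F t c a′ b′ →
  a ℚ.≤ y → y ℚ.≤ b → a′ ℚ.≤ y → y ℚ.≤ b′ → a ℚ.≤ a′ × b′ ℚ.≤ b
merge {F = F} {t} {c} {a} {b} {a′} {b′} {y} V W p q p′ q′ =
    ℚₚ.≤-trans (proj₁ inV) (ℚₚ.p⊓q≤q a a′) , ℚₚ.≤-trans (ℚₚ.p≤q⊔p b b′) (proj₂ inV)
  where
  module V = VWall V
  module W = VWall W
  cases : ∀ {z} {A : Set} → a ℚ.⊓ a′ ℚ.≤ z → z ℚ.≤ b ℚ.⊔ b′ →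
    (a ℚ.≤ z → z ℚ.≤ b → A) → (a′ ℚ.≤ z → z ℚ.≤ b′ → A) → A
  cases {z} l r f g with ℚₚ.≤-total z y
  cases {z} l r f g | inj₁ z≤y with ℚₚ.⊓-sel a a′
  ... | inj₁ e = f (subst (ℚ._≤ z) e l) (ℚₚ.≤-trans z≤y q)
  ... | inj₂ e = g (subst (ℚ._≤ z) e l) (ℚₚ.≤-trans z≤y q′)
  cases {z} l r f g | inj₂ y≤z with ℚₚ.⊔-sel b b′
  ... | inj₁ e = f (ℚₚ.≤-trans p y≤z) (subst (z ℚ.≤_) e r)
  ... | inj₂ e = g (ℚₚ.≤-trans p′ y≤z) (subst (z ℚ.≤_) e r)
  U : VAvoid F t c (a ℚ.⊓ a′) (b ℚ.⊔ b′)
  U = record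
    { proper = ℚₚ.≤-<-trans (ℚₚ.p⊓q≤p a a′) (ℚₚ.<-≤-trans V.proper (ℚₚ.p≤p⊔q b b′))
    ; inside = λ l r → cases l r V.inside W.inside
    ; avoids = λ k l r → cases l r (V.avoids k) (W.avoids k)
    }
  inV = V.maximal U (ℚₚ.p⊓q≤p a a′) (ℚₚ.p≤p⊔q b b′)

-- What is known about the vertical walls of a tiling t of F that comes from
-- a diagonal rectangulation: R k and L l number the walls that contain the
-- right edge of k and the left edge of l, and ⊏ is the direction in which
-- vertical walls are crossed.
record Oriented (L R : Fin n → ℕ) (_⊏_ : Fin n → Fin n → Set) (F : Rect ℚ) (t : Fin n → Rect ℚ) : Set where
  field
    tiling     : IsTiling F t
    right-edge : ∀ k → right (t k) ≡ right F ⊎ ∃ λ c → ∃₂ λ a b → VWall F t c a b × OnLeft t k c a b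
    left-edge  : ∀ k → left (t k) ≡ left F ⊎ ∃ λ c → ∃₂ λ a b → VWall F t c a b × OnRight t k c a b
    same-wall⇒ : ∀ {k l c a b} → VWall F t c a b → OnLeft t k c a b → OnRight t l c a b → R k ≡ L l
    same-wall⇐ : ∀ {k l} → R k ≡ L l → ∃ λ c → ∃₂ λ a b → VWall F t c a b × OnLeft t k c a b × OnRight t l c a b
    ordered    : ∀ {k l} → R k ≡ L l → k ⊏ l

module Sides {F : Rect ℚ} {t : Fin n → Rect ℚ} {L R _⊏_} (O : Oriented L R _⊏_ F t) where
  open Oriented O
  open IsTiling tiling

  private
    l<r : ∀ k → left (t k) ℚ.< right (t k)
    l<r k = proj₁ (nonEmpty k)
    b<t : ∀ k → bottom (t k) ℚ.< top (t k)
    b<t k = proj₂ (nonEmpty k)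

  -- Finds the tile that fills the quadrant up and left of the point: cover a nearby point of that
  -- quadrant, so close that no right edge has a coordinate between it and `c` and no bottom edge
  -- one between `y` and it.
  tile-left : ∀ {c y} → left F ℚ.< c → c ℚ.≤ right F → bottom F ℚ.≤ y → y ℚ.< top F →
    ∃ λ k → left (t k) ℚ.< c × c ℚ.≤ right (t k) × bottom (t k) ℚ.≤ y × y ℚ.< top (t k)
  tile-left {c} {y} l r b u with just-below (right ∘ t) l | just-above (bottom ∘ t) u
  ... | c′ , l′ , c′<c , rights | y′ , y<y′ , u′ , bottoms
    with covers (c′ , y′) (ℚₚ.<⇒≤ l′ , ℚₚ.<⇒≤ (ℚₚ.<-≤-trans c′<c r) , ℚₚ.≤-trans b (ℚₚ.<⇒≤ y<y′) , ℚₚ.<⇒≤ u′)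
  ... | k , p , q , v , w = k , ℚₚ.≤-<-trans p c′<c ,
      ℚₚ.≮⇒≥ (λ s → ℚₚ.<-irrefl refl (ℚₚ.≤-<-trans q (rights k s))) ,
      ℚₚ.≮⇒≥ (λ s → ℚₚ.<-irrefl refl (ℚₚ.<-≤-trans (bottoms k s) v)) , ℚₚ.<-≤-trans y<y′ w

  tile-right : ∀ {c y} → left F ℚ.≤ c → c ℚ.< right F → bottom F ℚ.≤ y → y ℚ.< top F →
    ∃ λ k → left (t k) ℚ.≤ c × c ℚ.< right (t k) × bottom (t k) ℚ.≤ y × y ℚ.< top (t k)
  tile-right {c} {y} l r b u with just-above (left ∘ t) r | just-above (bottom ∘ t) u
  ... | c′ , c<c′ , r′ , lefts | y′ , y<y′ , u′ , bottoms
    with covers (c′ , y′) (ℚₚ.<⇒≤ (ℚₚ.≤-<-trans l c<c′) , ℚₚ.<⇒≤ r′ , ℚₚ.≤-trans b (ℚₚ.<⇒≤ y<y′) , ℚₚ.<⇒≤ u′)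
  ... | k , p , q , v , w = k ,
      ℚₚ.≮⇒≥ (λ s → ℚₚ.<-irrefl refl (ℚₚ.<-≤-trans (lefts k s) p)) , ℚₚ.<-≤-trans c<c′ q ,
      ℚₚ.≮⇒≥ (λ s → ℚₚ.<-irrefl refl (ℚₚ.<-≤-trans (bottoms k s) v)) , ℚₚ.<-≤-trans y<y′ w

  module AlongWall {c a b} (W : VWall F t c a b) where
    open VWall W renaming (inside to insideᵂ)

    private
      inner-point : ∀ {k y} → a ℚ.≤ y → y ℚ.< b → bottom (t k) ℚ.≤ y → y ℚ.< top (t k) →
        left (t k) ℚ.< c → ¬ c ℚ.< right (t k)
      inner-point {k} p q v w l r =
        let y′ , y<y′ , y′<t , y′<b = dense-above w q
        in avoids k (ℚₚ.<⇒≤ (ℚₚ.≤-<-trans p y<y′)) (ℚₚ.<⇒≤ y′<b) (l , r , ℚₚ.≤-<-trans v y<y′ , y′<t)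

      left≤c : left F ℚ.≤ c
      left≤c = proj₁ (insideᵂ ℚₚ.≤-refl (ℚₚ.<⇒≤ proper))
      c≤right : c ℚ.≤ right F
      c≤right = proj₁ (proj₂ (insideᵂ ℚₚ.≤-refl (ℚₚ.<⇒≤ proper)))
      bottom≤a : bottom F ℚ.≤ a
      bottom≤a = proj₁ (proj₂ (proj₂ (insideᵂ ℚₚ.≤-refl (ℚₚ.<⇒≤ proper))))
      b≤top : b ℚ.≤ top F
      b≤top = proj₂ (proj₂ (proj₂ (insideᵂ (ℚₚ.<⇒≤ proper) ℚₚ.≤-refl)))

    -- A tile extending past `c` would have an interior point on the wall, so its right edge is at
    -- `c`. That edge lies in some wall by `right-edge`, and this wall meets `W`; by `merge` the
    -- whole edge is in `W`.
    leftTile : ∀ {y} → a ℚ.≤ y → y ℚ.< b → ∃ λ k → OnLeft t k c a b × bottom (t k) ℚ.≤ y × y ℚ.< top (t k)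
    leftTile {y} p q with tile-left (≤∧≢⇒<ℚ left≤c (c≢left ∘ sym)) c≤right (ℚₚ.≤-trans bottom≤a p) (ℚₚ.<-≤-trans q b≤top)
    ... | k , l , r , v , w = k , on-left (right-edge k) , v , w
      where
      c≡ : right (t k) ≡ c
      c≡ with right (t k) ℚₚ.≤? c
      ... | yes le = ℚₚ.≤-antisym le r
      ... | no nle = contradiction (ℚₚ.≰⇒> nle) (inner-point p q v w l)
      on-left : _ → OnLeft t k c a b
      on-left (inj₁ e) = contradiction (trans (sym c≡) e) c≢right
      on-left (inj₂ (c′ , a′ , b′ , V , e , v′ , w′)) with trans (sym e) c≡
      ... | refl = let le , ge = merge W V p (ℚₚ.<⇒≤ q) (ℚₚ.≤-trans v′ v) (ℚₚ.<⇒≤ (ℚₚ.<-≤-trans w w′))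
                   in e , ℚₚ.≤-trans le v′ , ℚₚ.≤-trans w′ ge

    rightTile : ∀ {y} → a ℚ.≤ y → y ℚ.< b → ∃ λ k → OnRight t k c a b × bottom (t k) ℚ.≤ y × y ℚ.< top (t k)
    rightTile {y} p q with tile-right left≤c (≤∧≢⇒<ℚ c≤right c≢right) (ℚₚ.≤-trans bottom≤a p) (ℚₚ.<-≤-trans q b≤top)
    ... | k , l , r , v , w = k , on-right (left-edge k) , v , w
      where
      c≡ : left (t k) ≡ c
      c≡ with c ℚₚ.≤? left (t k)
      ... | yes le = ℚₚ.≤-antisym l le
      ... | no nle = contradiction r (inner-point p q v w (ℚₚ.≰⇒> nle))
      on-right : _ → OnRight t k c a b
      on-right (inj₁ e) = contradiction (trans (sym c≡) e) c≢left
      on-right (inj₂ (c′ , a′ , b′ , V , e , v′ , w′)) with trans (sym e) c≡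
      ... | refl = let le , ge = merge W V p (ℚₚ.<⇒≤ q) (ℚₚ.≤-trans v′ v) (ℚₚ.<⇒≤ (ℚₚ.<-≤-trans w w′))
                   in e , ℚₚ.≤-trans le v′ , ℚₚ.≤-trans w′ ge

  private
    tiles-overlap : ∀ {k l x} → left (t k) ℚ.< x → x ℚ.< right (t k) → left (t l) ℚ.< x → x ℚ.< right (t l) →
      bottom (t k) ℚ.< top (t l) → bottom (t l) ℚ.< top (t k) → k ≡ l
    tiles-overlap {k} {l} k<x x<k l<x x<l p q with k Finₚ.≟ l
    ... | yes k≡l = k≡l
    ... | no k≢l =
      let y , y> , y<l , y<k = dense-above (max< (b<t l) p) (max< q (b<t k))
      in contradiction (l<x , x<l , ℚₚ.≤-<-trans (ℚₚ.p≤p⊔q (bottom (t l)) (bottom (t k))) y> , y<l)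
           (disjoint k≢l (k<x , x<k , ℚₚ.≤-<-trans (ℚₚ.p≤q⊔p (bottom (t l)) (bottom (t k))) y> , y<k))
      where
      max< : ∀ {u v w} → u ℚ.< w → v ℚ.< w → u ℚ.⊔ v ℚ.< w
      max< {u} {v} p q with ℚₚ.⊔-sel u v
      ... | inj₁ e = subst (ℚ._< _) (sym e) p
      ... | inj₂ e = subst (ℚ._< _) (sym e) q

  overlap-left : ∀ {k l} → right (t k) ≡ right (t l) → bottom (t k) ℚ.< top (t l) → bottom (t l) ℚ.< top (t k) → k ≡ l
  overlap-left {k} {l} e =
    let x , k<x , l<x , x<k = dense-below (l<r k) (subst (left (t l) ℚ.<_) (sym e) (l<r l))
    in tiles-overlap k<x x<k l<x (subst (x ℚ.<_) e x<k)

  overlap-right : ∀ {k l} → left (t k) ≡ left (t l) → bottom (t k) ℚ.< top (t l) → bottom (t l) ℚ.< top (t k) → k ≡ l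
  overlap-right {k} {l} e =
    let x , k<x , x<k , x<l = dense-above (l<r k) (subst (ℚ._< right (t l)) (sym e) (l<r l))
    in tiles-overlap k<x x<k (subst (ℚ._< x) e k<x) x<l

  -- The two edges in contact cannot be on the frame, where one of the tiles would stick out. The
  -- walls containing them share a point, hence coincide.
  touches⇒ : ∀ {k l} → Touches t k l → R k ≡ L l
  touches⇒ {k} {l} (e , p , q) with right-edge k | left-edge l
  ... | inj₁ r | _ = contradiction (ℚₚ.≤-<-trans (ℚₚ.≤-reflexive (trans (sym r) e)) (l<r l))
      (λ s → ℚₚ.<-irrefl refl (ℚₚ.<-≤-trans s (proj₁ (proj₂ (inside l (ℚₚ.<⇒≤ (l<r l) , ℚₚ.≤-refl , ℚₚ.≤-refl , ℚₚ.<⇒≤ (b<t l)))))))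
  ... | inj₂ _ | inj₁ r = contradiction (ℚₚ.<-≤-trans (l<r k) (ℚₚ.≤-reflexive (trans e r)))
      (λ s → ℚₚ.<-irrefl refl (ℚₚ.≤-<-trans (proj₁ (inside k (ℚₚ.≤-refl , ℚₚ.<⇒≤ (l<r k) , ℚₚ.≤-refl , ℚₚ.<⇒≤ (b<t k)))) s))
  ... | inj₂ (c , a , b , V , kv@(ek , ak , bk)) | inj₂ (c′ , a′ , b′ , V′ , (el , al , bl)) with trans (sym ek) (trans e el)
  ...   | refl = same-wall⇒ V kv (el , ℚₚ.≤-trans (proj₁ m) al , ℚₚ.≤-trans bl (proj₂ m))
    where
    common : ∃ λ y → (bottom (t k) ℚ.≤ y × y ℚ.≤ top (t k)) × bottom (t l) ℚ.≤ y × y ℚ.≤ top (t l)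
    common with ℚₚ.≤-total (bottom (t k)) (bottom (t l))
    ... | inj₁ le = bottom (t l) , (le , q) , ℚₚ.≤-refl , ℚₚ.<⇒≤ (b<t l)
    ... | inj₂ le = bottom (t k) , (ℚₚ.≤-refl , ℚₚ.<⇒≤ (b<t k)) , le , p
    m = let y , (k₁ , k₂) , l₁ , l₂ = common in
      merge V V′ (ℚₚ.≤-trans ak k₁) (ℚₚ.≤-trans k₂ bk) (ℚₚ.≤-trans al l₁) (ℚₚ.≤-trans l₂ bl)

  same-wall : ∀ {k l} → R k ≡ L l → ∃ λ c → ∃₂ λ a b → VWall F t c a b ×
    (∀ {k′} → R k′ ≡ L l → OnLeft t k′ c a b) × (∀ {l′} → R k ≡ L l′ → OnRight t l′ c a b)
  same-wall {k} {l} e with same-wall⇐ e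
  ... | c , a , b , W , (ek , ak , bk) , (el , al , bl) = c , a , b , W , lefts , rights
    where
    lefts : ∀ {k′} → R k′ ≡ L l → OnLeft t k′ c a b
    lefts e′ with same-wall⇐ e′
    ... | c′ , a′ , b′ , W′ , (ek′ , ak′ , bk′) , (el′ , al′ , bl′) with trans (sym el′) el
    ...   | refl = let p , q = merge W W′ al (ℚₚ.≤-trans (ℚₚ.<⇒≤ (b<t l)) bl) al′ (ℚₚ.≤-trans (ℚₚ.<⇒≤ (b<t l)) bl′)
                   in ek′ , ℚₚ.≤-trans p ak′ , ℚₚ.≤-trans bk′ q
    rights : ∀ {l′} → R k ≡ L l′ → OnRight t l′ c a b
    rights e′ with same-wall⇐ e′
    ... | c′ , a′ , b′ , W′ , (ek′ , ak′ , bk′) , (el′ , al′ , bl′) with trans (sym ek′) ek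
    ...   | refl = let p , q = merge W W′ ak (ℚₚ.≤-trans (ℚₚ.<⇒≤ (b<t k)) bk) ak′ (ℚₚ.≤-trans (ℚₚ.<⇒≤ (b<t k)) bk′)
                   in el′ , ℚₚ.≤-trans p al′ , ℚₚ.≤-trans bl′ q

  -- Walls are followed upwards, which crosses horizontal walls and so descends
  -- in ⊏.
  module Sweep (wf : WellFounded _⊏_) (⊏-trans : ∀ {i j k} → i ⊏ j → j ⊏ k → i ⊏ k)
    (above : ∀ {k l} → Touches (flipR ∘ t) k l → l ⊏ k) where

    module _ {c a b} (W : VWall F t c a b) where
      open AlongWall W

      next-left : ∀ {k} → OnLeft t k c a b → top (t k) ℚ.< b →
        ∃ λ k′ → OnLeft t k′ c a b × bottom (t k′) ≡ top (t k) × k′ ⊏ k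
      next-left {k} (e , p , q) u with leftTile (ℚₚ.≤-trans p (ℚₚ.<⇒≤ (b<t k))) u
      ... | k′ , on@(e′ , _) , v , w = k′ , on , eq , above (sym eq , le k k′ e e′ , le k′ k e′ e)
        where
        le : ∀ k k′ → right (t k) ≡ c → right (t k′) ≡ c → left (t k) ℚ.≤ right (t k′)
        le k k′ e e′ = ℚₚ.<⇒≤ (ℚₚ.<-≤-trans (l<r k) (ℚₚ.≤-reflexive (trans e (sym e′))))
        eq : bottom (t k′) ≡ top (t k)
        eq with top (t k) ℚₚ.≤? bottom (t k′)
        ... | yes s = ℚₚ.≤-antisym v s
        ... | no s with overlap-left {k} {k′} (trans e (sym e′)) (ℚₚ.<-trans (b<t k) w) (ℚₚ.≰⇒> s)
        ...   | refl = contradiction w (ℚₚ.<-irrefl refl)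

      next-right : ∀ {k} → OnRight t k c a b → top (t k) ℚ.< b →
        ∃ λ k′ → OnRight t k′ c a b × bottom (t k′) ≡ top (t k) × k′ ⊏ k
      next-right {k} (e , p , q) u with rightTile (ℚₚ.≤-trans p (ℚₚ.<⇒≤ (b<t k))) u
      ... | k′ , on@(e′ , _) , v , w = k′ , on , eq , above (sym eq , le k k′ e e′ , le k′ k e′ e)
        where
        le : ∀ k k′ → left (t k) ≡ c → left (t k′) ≡ c → left (t k) ℚ.≤ right (t k′)
        le k k′ e e′ = ℚₚ.<⇒≤ (ℚₚ.≤-<-trans (ℚₚ.≤-reflexive (trans e (sym e′))) (l<r k′))
        eq : bottom (t k′) ≡ top (t k)
        eq with top (t k) ℚₚ.≤? bottom (t k′)
        ... | yes s = ℚₚ.≤-antisym v s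
        ... | no s with overlap-right {k} {k′} (trans e (sym e′)) (ℚₚ.<-trans (b<t k) w) (ℚₚ.≰⇒> s)
        ...   | refl = contradiction w (ℚₚ.<-irrefl refl)

      higher-left : ∀ {k l} → Acc _⊏_ k → OnLeft t k c a b → OnLeft t l c a b → top (t k) ℚ.≤ bottom (t l) → l ⊏ k
      higher-left {k} {l} (acc rec) ok ol@(el , pl , ql) le with next-left ok (ℚₚ.≤-<-trans le (ℚₚ.<-≤-trans (b<t l) ql))
      ... | k′ , ok′@(ek′ , _) , e , k′⊏k with top (t k′) ℚₚ.≤? bottom (t l)
      ...   | yes le′ = ⊏-trans (higher-left (rec k′⊏k) ok′ ol le′) k′⊏k
      ...   | no nle with overlap-left {k′} {l} (trans ek′ (sym el))
                 (ℚₚ.≤-<-trans (ℚₚ.≤-trans (ℚₚ.≤-reflexive e) le) (b<t l)) (ℚₚ.≰⇒> nle)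
      ...     | refl = k′⊏k

      higher-right : ∀ {k l} → Acc _⊏_ k → OnRight t k c a b → OnRight t l c a b → top (t k) ℚ.≤ bottom (t l) → l ⊏ k
      higher-right {k} {l} (acc rec) ok ol@(el , pl , ql) le with next-right ok (ℚₚ.≤-<-trans le (ℚₚ.<-≤-trans (b<t l) ql))
      ... | k′ , ok′@(ek′ , _) , e , k′⊏k with top (t k′) ℚₚ.≤? bottom (t l)
      ...   | yes le′ = ⊏-trans (higher-right (rec k′⊏k) ok′ ol le′) k′⊏k
      ...   | no nle with overlap-right {k′} {l} (trans ek′ (sym el))
                 (ℚₚ.≤-<-trans (ℚₚ.≤-trans (ℚₚ.≤-reflexive e) le) (b<t l)) (ℚₚ.≰⇒> nle)
      ...     | refl = k′⊏k

      -- If the edges do not meet, one ends below the other begins. The tile across the wall at the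
      -- upper end of the lower edge touches both the lower tile and the next one above it, so the
      -- chain gains two contacts and moves up. Each such move descends in `⊏`, on one side or the
      -- other.
      zigzag : ∀ {k l} → Acc _⊏_ k → Acc _⊏_ l → OnLeft t k c a b → OnRight t l c a b → Zigzag t k l
      zigzag {k} {l} (acc reck) (acc recl) ok@(ek , pk , qk) ol@(el , pl , ql)
        with bottom (t k) ℚₚ.≤? top (t l) | bottom (t l) ℚₚ.≤? top (t k)
      ... | yes p | yes q = edge-of (trans ek (sym el) , p , q)
      ... | _ | no ¬q with ℚₚ.≰⇒> ¬q
      ...   | q with rightTile (ℚₚ.≤-trans pk (ℚₚ.<⇒≤ (b<t k))) (ℚₚ.<-trans q (ℚₚ.<-≤-trans (b<t l) ql))
                 | next-left ok (ℚₚ.<-trans q (ℚₚ.<-≤-trans (b<t l) ql))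
      ...     | m , om@(em , _) , v , w | k′ , ok′@(ek′ , _) , e , k′⊏k = left-via
                  (trans ek (sym em) , ℚₚ.<⇒≤ (ℚₚ.<-trans (b<t k) w) , v)
                  (trans ek′ (sym em) , ℚₚ.<⇒≤ (ℚₚ.≤-<-trans (ℚₚ.≤-reflexive e) w) ,
                    ℚₚ.≤-trans v (ℚₚ.≤-trans (ℚₚ.≤-reflexive (sym e)) (ℚₚ.<⇒≤ (b<t k′))))
                  (zigzag (reck k′⊏k) (acc recl) ok′ ol)
      zigzag {k} {l} (acc reck) (acc recl) ok@(ek , pk , qk) ol@(el , pl , ql) | no ¬p | _ with ℚₚ.≰⇒> ¬p
      ...   | q with leftTile (ℚₚ.≤-trans pl (ℚₚ.<⇒≤ (b<t l))) (ℚₚ.<-trans q (ℚₚ.<-≤-trans (b<t k) qk))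
                 | next-right ol (ℚₚ.<-trans q (ℚₚ.<-≤-trans (b<t k) qk))
      ...     | m , om@(em , _) , v , w | l′ , ol′@(el′ , _) , e , l′⊏l = right-via
                  (zigzag (acc reck) (recl l′⊏l) ok ol′)
                  (trans em (sym el′) , ℚₚ.≤-trans v (ℚₚ.≤-trans (ℚₚ.≤-reflexive (sym e)) (ℚₚ.<⇒≤ (b<t l′))) ,
                    ℚₚ.<⇒≤ (ℚₚ.≤-<-trans (ℚₚ.≤-reflexive e) w))
                  (trans em (sym el) , v , ℚₚ.<⇒≤ (ℚₚ.<-trans (b<t l) w))

    touching-zigzag : ∀ {k l} → R k ≡ L l → Zigzag t k l
    touching-zigzag {k} {l} e with same-wall⇐ e
    ... | c , a , b , W , ok , ol = zigzag W (wf k) (wf l) ok ol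

-- Two tilings with the same contacts have the same order of the bottom edge
-- of k and the top edge of l on the wall between k and l: if l ended below k
-- in the second, then the rectangle left of the top end of l would touch both
-- l and the rectangle above l.
module _ {_⊏_ : Fin n → Fin n → Set} (wf : WellFounded _⊏_) (⊏-trans : ∀ {i j k} → i ⊏ j → j ⊏ k → i ⊏ k)
  {L R L′ R′ : Fin n → ℕ} {F F′ : Rect ℚ} {t t′ : Fin n → Rect ℚ}
  (O : Oriented L R _⊏_ F t) (O′ : Oriented L′ R′ _⊏_ F′ t′)
  (above : ∀ {k l} → Touches (flipR ∘ t) k l → l ⊏ k)
  (above′ : ∀ {k l} → Touches (flipR ∘ t′) k l → l ⊏ k)
  (touch : ∀ {i j} → Touches t′ i j → Touches t i j)
  where
  private
    module S = Sides O
    module S′ = Sides O′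
    module W = S.Sweep wf ⊏-trans above
    module W′ = S′.Sweep wf ⊏-trans above′

    ⊏-asym : ∀ {i j} → i ⊏ j → ¬ j ⊏ i
    ⊏-asym = wf⇒asym wf

  bottom-before-top : ∀ {k l} → R k ≡ L l → R′ k ≡ L′ l →
    bottom (t k) ℚ.< top (t l) → ¬ top (t′ l) ℚ.< bottom (t′ k)
  bottom-before-top {k} {l} e e′ p p′ with S.same-wall e | S′.same-wall e′
  ... | c , a , b , V , lefts , rights | c′ , a′ , b′ , V′ , lefts′ , rights′ = conclude
    where
    module A′ = S′.AlongWall V′
    b<t : ∀ k → bottom (t k) ℚ.< top (t k)
    b<t k = proj₂ (IsTiling.nonEmpty (Oriented.tiling O) k)
    b<t′ : ∀ k → bottom (t′ k) ℚ.< top (t′ k)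
    b<t′ k = proj₂ (IsTiling.nonEmpty (Oriented.tiling O′) k)
    ok′ = lefts′ e′
    ol′ = rights′ e′
    y = top (t′ l)
    a≤y : a′ ℚ.≤ y
    a≤y = ℚₚ.≤-trans (proj₁ (proj₂ ol′)) (ℚₚ.<⇒≤ (b<t′ l))
    y<b : y ℚ.< b′
    y<b = ℚₚ.<-trans p′ (ℚₚ.<-≤-trans (b<t′ k) (proj₂ (proj₂ ok′)))
    conclude : ⊥
    conclude with A′.leftTile a≤y y<b | A′.rightTile a≤y y<b
    ... | m , om′@(em , _) , m≤y , y<m | f , of′@(ef , _) , f≤y , y<f =
      -- In `t` the chain from the top of `l` over the bottom of `f` and the top of `m` to the
      -- bottom of `k` contradicts `p`.
      ℚₚ.<-irrefl refl (ℚₚ.<-≤-trans p (ℚₚ.≤-trans l≤f (ℚₚ.≤-trans f≤m m≤k)))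
      where
      m-l : Touches t m l
      m-l = touch (trans em (sym (proj₁ ol′)) , m≤y , ℚₚ.<⇒≤ (ℚₚ.<-trans (b<t′ l) y<m))
      m-f : Touches t m f
      m-f = touch (trans em (sym ef) , ℚₚ.<⇒≤ (ℚₚ.≤-<-trans m≤y y<f) , ℚₚ.≤-trans f≤y (ℚₚ.<⇒≤ y<m))
      Rm≡Ll = S.touches⇒ m-l
      Rk≡Lf : R k ≡ L f
      Rk≡Lf = trans e (trans (sym Rm≡Ll) (S.touches⇒ m-f))
      -- Along one side of a wall the heights are ordered by `⊏` in both tilings. So the order of
      -- `l` and `f`, and that of `m` and `k`, carries over from `t′` to `t`; only the comparison
      -- across the wall needs a contact.
      f⊏l : f ⊏ l
      f⊏l = W′.higher-right V′ (wf l) ol′ of′ (ℚₚ.≮⇒≥ λ s →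
        ℚₚ.<-irrefl (cong (λ i → top (t′ i)) (S′.overlap-right (trans (proj₁ ol′) (sym ef)) (ℚₚ.<-trans (b<t′ l) y<f) s)) y<f)
      k⊏m : k ⊏ m
      k⊏m = W′.higher-left V′ (wf m) om′ ok′ (ℚₚ.≮⇒≥ λ s →
        ℚₚ.<-irrefl (cong (λ i → bottom (t′ i)) (S′.overlap-left (trans em (sym (proj₁ ok′)))
          (ℚₚ.≤-<-trans m≤y (ℚₚ.<-trans p′ (b<t′ k))) s)) (ℚₚ.≤-<-trans m≤y p′))
      l≤f : top (t l) ℚ.≤ bottom (t f)
      l≤f with top (t l) ℚₚ.≤? bottom (t f) | top (t f) ℚₚ.≤? bottom (t l)
      ... | yes q | _ = q
      ... | no _ | yes q = contradiction (W.higher-right V (wf f) (rights Rk≡Lf) (rights e) q) (⊏-asym f⊏l)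
      ... | no q | no r with S.overlap-right (trans (proj₁ (rights e)) (sym (proj₁ (rights Rk≡Lf)))) (ℚₚ.≰⇒> r) (ℚₚ.≰⇒> q)
      ...   | refl = contradiction f⊏l (⊏-asym f⊏l)
      m≤k : top (t m) ℚ.≤ bottom (t k)
      m≤k with top (t m) ℚₚ.≤? bottom (t k) | top (t k) ℚₚ.≤? bottom (t m)
      ... | yes q | _ = q
      ... | no _ | yes q = contradiction (W.higher-left V (wf k) (lefts e) (lefts Rm≡Ll) q) (⊏-asym k⊏m)
      ... | no q | no r with S.overlap-left (trans (proj₁ (lefts e)) (sym (proj₁ (lefts Rm≡Ll)))) (ℚₚ.≰⇒> q) (ℚₚ.≰⇒> r)
      ...   | refl = contradiction k⊏m (⊏-asym k⊏m)
      f≤m : bottom (t f) ℚ.≤ top (t m)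
      f≤m = proj₂ (proj₂ m-f)

-- Segments and walls in the two directions

vert-⊆ : ∀ {c a b c′ a′ b′} → a ℚ.≤ b → ⟦ vert c a b ⟧ ⊆ ⟦ vert c′ a′ b′ ⟧ → c ≡ c′ × a′ ℚ.≤ a × b ℚ.≤ b′
vert-⊆ {c} {a} {b} a≤b s with s {c , a} (refl , ℚₚ.≤-refl , a≤b) | s {c , b} (refl , a≤b , ℚₚ.≤-refl)
... | e , p , _ | _ , _ , q = e , p , q

horiz-⊆ : ∀ {c a b c′ a′ b′} → a ℚ.≤ b → ⟦ horiz c a b ⟧ ⊆ ⟦ horiz c′ a′ b′ ⟧ → c ≡ c′ × a′ ℚ.≤ a × b ℚ.≤ b′
horiz-⊆ {c} {a} {b} a≤b s with s {a , c} (refl , ℚₚ.≤-refl , a≤b) | s {b , c} (refl , a≤b , ℚₚ.≤-refl)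
... | e , p , _ | _ , _ , q = e , p , q

vert-⊈horiz : ∀ {c a b c′ a′ b′} → a ℚ.< b → ¬ ⟦ vert c a b ⟧ ⊆ ⟦ horiz c′ a′ b′ ⟧
vert-⊈horiz {c} {a} {b} a<b s = ℚₚ.<-irrefl (trans
  (proj₁ (s {c , a} (refl , ℚₚ.≤-refl , ℚₚ.<⇒≤ a<b))) (sym (proj₁ (s {c , b} (refl , ℚₚ.<⇒≤ a<b , ℚₚ.≤-refl))))) a<b

horiz-⊈vert : ∀ {c a b c′ a′ b′} → a ℚ.< b → ¬ ⟦ horiz c a b ⟧ ⊆ ⟦ vert c′ a′ b′ ⟧
horiz-⊈vert {c} {a} {b} a<b s = ℚₚ.<-irrefl (trans
  (proj₁ (s {a , c} (refl , ℚₚ.≤-refl , ℚₚ.<⇒≤ a<b))) (sym (proj₁ (s {b , c} (refl , ℚₚ.<⇒≤ a<b , ℚₚ.≤-refl))))) a<b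

-- `view` turns the walls of one direction into vertical ones, so that the transfer along wall
-- slides is carried out once for both.
record Direction : Set₁ where
  field
    seg     : ℚ → ℚ → ℚ → Segment
    lowE highE : Edge
    view    : Rect ℚ → Rect ℚ
    wall⇒   : ∀ (T : Layout n) {c a b} → Wall T (seg c a b) → VWall (view (frame T)) (view ∘ tile T) c a b
    wall⇐   : ∀ (T : Layout n) {c a b} → VWall (view (frame T)) (view ∘ tile T) c a b → Wall T (seg c a b)
    high⇒   : ∀ (T : Layout n) k W → NonEmptyRect (tile T k) → EdgeIn T highE k W →
              ∃ λ c → ∃₂ λ a b → W ≡ seg c a b × OnLeft (view ∘ tile T) k c a b
    high⇐   : ∀ (T : Layout n) {k c a b} → OnLeft (view ∘ tile T) k c a b → EdgeIn T highE k (seg c a b)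
    low⇒    : ∀ (T : Layout n) k W → NonEmptyRect (tile T k) → EdgeIn T lowE k W →
              ∃ λ c → ∃₂ λ a b → W ≡ seg c a b × OnRight (view ∘ tile T) k c a b
    low⇐    : ∀ (T : Layout n) {k c a b} → OnRight (view ∘ tile T) k c a b → EdgeIn T lowE k (seg c a b)
    high-seg : ∀ r → edge highE r ≡ seg (right (view r)) (bottom (view r)) (top (view r))
    low-seg  : ∀ r → edge lowE r ≡ seg (left (view r)) (bottom (view r)) (top (view r))
    view-tiling : ∀ {F} {t : Fin n → Rect ℚ} → IsTiling F t → IsTiling (view F) (view ∘ t)
    seg-injective : ∀ {c a b c′ a′ b′} → seg c a b ≡ seg c′ a′ b′ → c ≡ c′ × a ≡ a′ × b ≡ b′

module _ (T : Layout n) where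

  vert-avoid⇒ : ∀ {c a b} → AvoidsInteriors T (vert c a b) → VAvoid (frame T) (tile T) c a b
  vert-avoid⇒ (a<b , ins , av) = record
    { proper = a<b ; inside = λ p q → ins (refl , p , q) ; avoids = λ k p q i → av k (_ , (refl , p , q) , i) }

  vert-avoid⇐ : ∀ {c a b} → VAvoid (frame T) (tile T) c a b → AvoidsInteriors T (vert c a b)
  vert-avoid⇐ V = proper , (λ { (refl , p , q) → inside p q }) , λ { k (_ , (refl , p , q) , i) → avoids k p q i }
    where open VAvoid V

  vert-wall⇒ : ∀ {c a b} → Wall T (vert c a b) → VWall (frame T) (tile T) c a b
  vert-wall⇒ {c} {a} {b} (av , notEdge , max) = record
    { avoid = V
    ; c≢left = λ { refl → notEdge leftE λ { (refl , p , q) → let _ , _ , u , v = VAvoid.inside V p q in refl , u , v } }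
    ; c≢right = λ { refl → notEdge rightE λ { (refl , p , q) → let _ , _ , u , v = VAvoid.inside V p q in refl , u , v } }
    ; maximal = λ {a′} {b′} U p q → proj₂ (vert-⊆ {c} {a′} {b′} {c} {a} {b} (ℚₚ.<⇒≤ (VAvoid.proper U)) 
        (max (vert c a′ b′) (vert-avoid⇐ U) λ { (refl , u , v) → refl , ℚₚ.≤-trans p u , ℚₚ.≤-trans v q }))
    }
    where V = vert-avoid⇒ av

  vert-wall⇐ : ∀ {c a b} → VWall (frame T) (tile T) c a b → Wall T (vert c a b)
  vert-wall⇐ {c} {a} {b} W = vert-avoid⇐ avoid , notEdge , max
    where
    open VWall W
    notEdge : ∀ e → ¬ (⟦ vert c a b ⟧ ⊆ ⟦ edge e (frame T) ⟧)
    notEdge leftE   s = c≢left (proj₁ (vert-⊆ (ℚₚ.<⇒≤ proper) s))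
    notEdge rightE  s = c≢right (proj₁ (vert-⊆ (ℚₚ.<⇒≤ proper) s))
    notEdge bottomE s = vert-⊈horiz proper s
    notEdge topE    s = vert-⊈horiz proper s
    max : ∀ V → AvoidsInteriors T V → ⟦ vert c a b ⟧ ⊆ ⟦ V ⟧ → ⟦ V ⟧ ⊆ ⟦ vert c a b ⟧
    max (vert c′ a′ b′) av s with vert-⊆ (ℚₚ.<⇒≤ proper) s
    ... | refl , p , q = λ { (refl , u , v) → let l , r = maximal (vert-avoid⇒ av) p q in
      refl , ℚₚ.≤-trans l u , ℚₚ.≤-trans v r }
    max (horiz c′ a′ b′) av s = contradiction (λ {p} → s {p}) (vert-⊈horiz proper)

  private
    swap₄ : {A B C D : Set} → A × B × C × D → C × D × A × B
    swap₄ (a , b , c , d) = c , d , a , b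

  horiz-avoid⇒ : ∀ {c a b} → AvoidsInteriors T (horiz c a b) → VAvoid (flipR (frame T)) (flipR ∘ tile T) c a b
  horiz-avoid⇒ (a<b , ins , av) = record
    { proper = a<b ; inside = λ p q → swap₄ (ins (refl , p , q)) ; avoids = λ k p q i → av k (_ , (refl , p , q) , swap₄ i) }

  horiz-avoid⇐ : ∀ {c a b} → VAvoid (flipR (frame T)) (flipR ∘ tile T) c a b → AvoidsInteriors T (horiz c a b)
  horiz-avoid⇐ V = proper , (λ { (refl , p , q) → swap₄ (inside p q) }) , λ { k (_ , (refl , p , q) , i) → avoids k p q (swap₄ i) }
    where open VAvoid V

  horiz-wall⇒ : ∀ {c a b} → Wall T (horiz c a b) → VWall (flipR (frame T)) (flipR ∘ tile T) c a b
  horiz-wall⇒ {c} {a} {b} (av , notEdge , max) = record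
    { avoid = V
    ; c≢left = λ { refl → notEdge bottomE λ { (refl , p , q) → let _ , _ , u , v = VAvoid.inside V p q in refl , u , v } }
    ; c≢right = λ { refl → notEdge topE λ { (refl , p , q) → let _ , _ , u , v = VAvoid.inside V p q in refl , u , v } }
    ; maximal = λ {a′} {b′} U p q → proj₂ (horiz-⊆ {c} {a′} {b′} {c} {a} {b} (ℚₚ.<⇒≤ (VAvoid.proper U)) 
        (max (horiz c a′ b′) (horiz-avoid⇐ U) λ { (refl , u , v) → refl , ℚₚ.≤-trans p u , ℚₚ.≤-trans v q }))
    }
    where V = horiz-avoid⇒ av

  horiz-wall⇐ : ∀ {c a b} → VWall (flipR (frame T)) (flipR ∘ tile T) c a b → Wall T (horiz c a b)
  horiz-wall⇐ {c} {a} {b} W = horiz-avoid⇐ avoid , notEdge , max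
    where
    open VWall W
    notEdge : ∀ e → ¬ (⟦ horiz c a b ⟧ ⊆ ⟦ edge e (frame T) ⟧)
    notEdge bottomE s = c≢left (proj₁ (horiz-⊆ (ℚₚ.<⇒≤ proper) s))
    notEdge topE    s = c≢right (proj₁ (horiz-⊆ (ℚₚ.<⇒≤ proper) s))
    notEdge leftE   s = horiz-⊈vert proper s
    notEdge rightE  s = horiz-⊈vert proper s
    max : ∀ V → AvoidsInteriors T V → ⟦ horiz c a b ⟧ ⊆ ⟦ V ⟧ → ⟦ V ⟧ ⊆ ⟦ horiz c a b ⟧
    max (horiz c′ a′ b′) av s with horiz-⊆ (ℚₚ.<⇒≤ proper) s
    ... | refl , p , q = λ { (refl , u , v) → let l , r = maximal (horiz-avoid⇒ av) p q in
      refl , ℚₚ.≤-trans l u , ℚₚ.≤-trans v r }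
    max (vert c′ a′ b′) av s = contradiction (λ {p} → s {p}) (horiz-⊈vert proper)

vert-in : ∀ {W c a b} → a ℚ.< b → ⟦ vert c a b ⟧ ⊆ ⟦ W ⟧ → ∃ λ c′ → ∃₂ λ a′ b′ → W ≡ vert c′ a′ b′ × c ≡ c′ × a′ ℚ.≤ a × b ℚ.≤ b′
vert-in {vert c′ a′ b′} a<b s = c′ , a′ , b′ , refl , vert-⊆ (ℚₚ.<⇒≤ a<b) s
vert-in {horiz c′ a′ b′} a<b s = contradiction (λ {p} → s {p}) (vert-⊈horiz a<b)

horiz-in : ∀ {W c a b} → a ℚ.< b → ⟦ horiz c a b ⟧ ⊆ ⟦ W ⟧ → ∃ λ c′ → ∃₂ λ a′ b′ → W ≡ horiz c′ a′ b′ × c ≡ c′ × a′ ℚ.≤ a × b ℚ.≤ b′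
horiz-in {horiz c′ a′ b′} a<b s = c′ , a′ , b′ , refl , horiz-⊆ (ℚₚ.<⇒≤ a<b) s
horiz-in {vert c′ a′ b′} a<b s = contradiction (λ {p} → s {p}) (horiz-⊈vert a<b)

vertical horizontal : Direction
vertical = record
  { view-tiling = id ; seg = vert ; lowE = leftE ; highE = rightE ; view = id
  ; wall⇒ = vert-wall⇒ ; wall⇐ = vert-wall⇐
  ; high⇒ = λ T k W ne s → vert-in (proj₂ ne) s
  ; high⇐ = λ { T (refl , p , q) (refl , u , v) → refl , ℚₚ.≤-trans p u , ℚₚ.≤-trans v q }
  ; low⇒ = λ T k W ne s → vert-in (proj₂ ne) s
  ; low⇐ = λ { T (refl , p , q) (refl , u , v) → refl , ℚₚ.≤-trans p u , ℚₚ.≤-trans v q }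
  ; high-seg = λ _ → refl ; low-seg = λ _ → refl
  ; seg-injective = λ { refl → refl , refl , refl } }
horizontal = record
  { view-tiling = flipTiling ; seg = horiz ; lowE = bottomE ; highE = topE ; view = flipR
  ; wall⇒ = horiz-wall⇒ ; wall⇐ = horiz-wall⇐
  ; high⇒ = λ T k W ne s → horiz-in (proj₁ ne) s
  ; high⇐ = λ { T (refl , p , q) (refl , u , v) → refl , ℚₚ.≤-trans p u , ℚₚ.≤-trans v q }
  ; low⇒ = λ T k W ne s → horiz-in (proj₁ ne) s
  ; low⇐ = λ { T (refl , p , q) (refl , u , v) → refl , ℚₚ.≤-trans p u , ℚₚ.≤-trans v q }
  ; high-seg = λ _ → refl ; low-seg = λ _ → refl
  ; seg-injective = λ { refl → refl , refl , refl } }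

-- Wall slides

-- The part of `WallSlide` that composes along a sequence of slides; the shuffles change on the way.
record SameMosaic (T U : Layout n) : Set where
  field
    walls-to    : ∀ V → Wall T V → ∃ λ V′ → Wall U V′ × SameWall T V U V′
    walls-from  : ∀ V′ → Wall U V′ → ∃ λ V → Wall T V × SameWall T V U V′
    frame-edges : ∀ e k → EdgeIn T e k (edge e (frame T)) ⇔ EdgeIn U e k (edge e (frame U))

same-mosaic : {T U : Layout n} → Star WallSlide T U → SameMosaic T U
same-mosaic ε = record
  { walls-to = λ V W → V , W , λ _ _ → ⇔-id _
  ; walls-from = λ V W → V , W , λ _ _ → ⇔-id _
  ; frame-edges = λ _ _ → ⇔-id _ }
same-mosaic {n} {T} {U} (s ◅ ss) = record
  { walls-to = λ V W → let V₁ , W₁ , e₁ = S.walls-to V W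
                           V₂ , W₂ , e₂ = M.walls-to V₁ W₁
                       in V₂ , W₂ , λ e k → comp (e₁ e k) (e₂ e k)
  ; walls-from = λ V W → let V₁ , W₁ , e₁ = M.walls-from V W
                             V₂ , W₂ , e₂ = S.walls-from V₁ W₁
                         in V₂ , W₂ , λ e k → comp (e₂ e k) (e₁ e k)
  ; frame-edges = λ e k → comp (S.frame-edges e k) (M.frame-edges e k)
  }
  where
  module S = WallSlide s
  module M = SameMosaic (same-mosaic ss)
  comp : {A B C : Set} → A ⇔ B → B ⇔ C → A ⇔ C
  comp f g = mk⇔ (to g ∘ to f) (from f ∘ from g)

generic⇒tiling : {T : Layout n} → IsGenericTiling T → IsTiling (frame T) (tile T)
generic⇒tiling G = record
  { nonEmpty = tile-nonEmpty
  ; disjoint = λ {k} {l} ne i j → disjoint k l ne (_ , i , j)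
  ; inside = λ k i → inside k i
  ; covers = covers
  } where open IsGenericTiling G

slides-tiling : {T U : Layout n} → Star WallSlide T U → IsTiling (frame T) (tile T) → IsTiling (frame U) (tile U)
slides-tiling ε t = t
slides-tiling (s ◅ ss) _ = slides-tiling ss (generic⇒tiling (WallSlide.generic-U s))

module _ (D : Direction) {T U : Layout n} (M : SameMosaic T U)
  (tT : IsTiling (frame T) (tile T)) (tU : IsTiling (frame U) (tile U)) where
  open Direction D
  open SameMosaic M

  private
    neT = IsTiling.nonEmpty tT
    neU = IsTiling.nonEmpty tU
    vT = view-tiling tT
    F = view (frame T)
    F′ = view (frame U)

    corners : ∀ k → let r = view (tile T k) in Closed F (right r , bottom r) × Closed F (left r , top r)
    corners k = let h , v = IsTiling.nonEmpty vT k in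
      IsTiling.inside vT k (ℚₚ.<⇒≤ h , ℚₚ.≤-refl , ℚₚ.≤-refl , ℚₚ.<⇒≤ v) ,
      IsTiling.inside vT k (ℚₚ.≤-refl , ℚₚ.<⇒≤ h , ℚₚ.<⇒≤ v , ℚₚ.≤-refl)

    high-to : ∀ {k c a b} → Wall T (seg c a b) → EdgeIn T highE k (seg c a b) →
      ∃ λ c′ → ∃₂ λ a′ b′ → VWall F′ (view ∘ tile U) c′ a′ b′ × OnLeft (view ∘ tile U) k c′ a′ b′ ×
        SameWall T (seg c a b) U (seg c′ a′ b′)
    high-to {k} W e with walls-to _ W
    ... | V′ , W′ , same with high⇒ U k V′ (neU k) (λ {p} → to (same highE k) (λ {p} → e {p}) {p})
    ... | c′ , a′ , b′ , refl , on = c′ , a′ , b′ , wall⇒ U W′ , on , same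

    low-to : ∀ {k c a b} → Wall T (seg c a b) → EdgeIn T lowE k (seg c a b) →
      ∃ λ c′ → ∃₂ λ a′ b′ → VWall F′ (view ∘ tile U) c′ a′ b′ × OnRight (view ∘ tile U) k c′ a′ b′ ×
        SameWall T (seg c a b) U (seg c′ a′ b′)
    low-to {k} W e with walls-to _ W
    ... | V′ , W′ , same with low⇒ U k V′ (neU k) (λ {p} → to (same lowE k) (λ {p} → e {p}) {p})
    ... | c′ , a′ , b′ , refl , on = c′ , a′ , b′ , wall⇒ U W′ , on , same

  wall-between : ∀ {k l c a b} → Wall T (seg c a b) → OnLeft (view ∘ tile T) k c a b → OnRight (view ∘ tile T) l c a b →
    ∃ λ c′ → ∃₂ λ a′ b′ → Wall U (seg c′ a′ b′) × SameWall T (seg c a b) U (seg c′ a′ b′) ×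
      OnLeft (view ∘ tile U) k c′ a′ b′ × OnRight (view ∘ tile U) l c′ a′ b′
  wall-between {k} {l} W ok ol with high-to W (high⇐ T ok)
  ... | c′ , a′ , b′ , W′ , ok′ , same with low⇒ U l _ (neU l) (λ {p} → to (same lowE l) (λ {p} → low⇐ T ol {p}) {p})
  ... | c″ , a″ , b″ , eq , ol′ with seg-injective eq
  ... | refl , refl , refl = c′ , a′ , b′ , wall⇐ U W′ , same , ok′ , ol′

  -- Slides change coordinates, but the numbers `L` and `R` are carried over unchanged. What is then
  -- asked is only which edges lie together in a wall or in the frame, and this is what `SameMosaic`
  -- preserves.
  oriented-transfer : ∀ {L R _⊏_} → Oriented L R _⊏_ F (view ∘ tile T) → Oriented L R _⊏_ F′ (view ∘ tile U)
  oriented-transfer {L} {R} O = record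
    { tiling = view-tiling tU
    ; right-edge = right-edge′
    ; left-edge = left-edge′
    ; same-wall⇒ = same-wall⇒′
    ; same-wall⇐ = same-wall⇐′
    ; ordered = ordered
    }
    where
    open Oriented O
    right-edge′ : ∀ k → right (view (tile U k)) ≡ right F′ ⊎ _
    right-edge′ k with right-edge k
    ... | inj₂ (c , a , b , W , on) = let c′ , a′ , b′ , W′ , on′ , _ = high-to (wall⇐ T W) (high⇐ T on) in
          inj₂ (c′ , a′ , b′ , W′ , on′)
    ... | inj₁ e with high⇒ U k _ (neU k) (to (frame-edges highE k) (λ {p} → in-frame {p}))
      where
      in-frame : EdgeIn T highE k (edge highE (frame T))
      in-frame = subst (λ W → ⟦ edge highE (tile T k) ⟧ ⊆ ⟦ W ⟧) (sym (high-seg (frame T)))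
        (high⇐ T (e , proj₁ (proj₂ (proj₂ (proj₁ (corners k)))) , proj₂ (proj₂ (proj₂ (proj₂ (corners k))))))
    ...   | c , a , b , eq , (e′ , _) = inj₁ (trans e′ (sym (proj₁ (seg-injective (trans (sym (high-seg (frame U))) eq)))))
    left-edge′ : ∀ k → left (view (tile U k)) ≡ left F′ ⊎ _
    left-edge′ k with left-edge k
    ... | inj₂ (c , a , b , W , on) = let c′ , a′ , b′ , W′ , on′ , _ = low-to (wall⇐ T W) (low⇐ T on) in
          inj₂ (c′ , a′ , b′ , W′ , on′)
    ... | inj₁ e with low⇒ U k _ (neU k) (to (frame-edges lowE k) (λ {p} → in-frame {p}))
      where
      in-frame : EdgeIn T lowE k (edge lowE (frame T))
      in-frame = subst (λ W → ⟦ edge lowE (tile T k) ⟧ ⊆ ⟦ W ⟧) (sym (low-seg (frame T)))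
        (low⇐ T (e , proj₁ (proj₂ (proj₂ (proj₁ (corners k)))) , proj₂ (proj₂ (proj₂ (proj₂ (corners k))))))
    ...   | c , a , b , eq , (e′ , _) = inj₁ (trans e′ (sym (proj₁ (seg-injective (trans (sym (low-seg (frame U))) eq)))))
    same-wall⇒′ : ∀ {k l c a b} → VWall F′ (view ∘ tile U) c a b → OnLeft (view ∘ tile U) k c a b →
      OnRight (view ∘ tile U) l c a b → R k ≡ L l
    same-wall⇒′ {k} {l} W ok ol with walls-from _ (wall⇐ U W)
    ... | V , WT , same with high⇒ T k V (neT k) (λ {p} → from (same highE k) (λ {p} → high⇐ U ok {p}) {p})
    ... | c , a , b , refl , ok′ with low⇒ T l V (neT l) (λ {p} → from (same lowE l) (λ {p} → low⇐ U ol {p}) {p})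
    ... | c′ , a′ , b′ , eq , ol′ with seg-injective eq
    ... | refl , refl , refl = same-wall⇒ (wall⇒ T WT) ok′ ol′
    same-wall⇐′ : ∀ {k l} → R k ≡ L l → _
    same-wall⇐′ e with same-wall⇐ e
    ... | c , a , b , W , ok , ol with wall-between (wall⇐ T W) ok ol
    ... | c′ , a′ , b′ , W′ , _ , ok′ , ol′ = c′ , a′ , b′ , wall⇒ U W′ , ok′ , ol′

-- The walls of a diagonal rectangulation

predecessor : ∀ {i m} → i < m → ∃ λ j → m ≡ suc j
predecessor {m = suc j} _ = j , refl

module Diagonal {_≺_ : ℕ → ℕ → Set} (o : StrictTotal _≺_) (E : Extents n _≺_) (t : Fin n → Rect ℚ)
  (t≡ : ∀ k → t k ≡ mapRect toℚ (rectOf E (toℕ k))) where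
  open StrictTotal o
  open Extents E
  module O = Tiles o E
  module P = Tiles (reverse o) (transposeᴱ E)

  left≡ : ∀ k → left (t k) ≡ toℚ (L (toℕ k))
  left≡ k = cong left (t≡ k)
  right≡ : ∀ k → right (t k) ≡ toℚ (R (toℕ k))
  right≡ k = cong right (t≡ k)
  bottom≡ : ∀ k → bottom (t k) ≡ toℚ (n ∸ B (toℕ k))
  bottom≡ k = cong bottom (t≡ k)
  top≡ : ∀ k → top (t k) ≡ toℚ (n ∸ T (toℕ k))
  top≡ k = cong top (t≡ k)

  private
    ≤-left : ∀ {p q i j} → p ≡ toℚ i → q ≡ toℚ j → i ≤ j → p ℚ.≤ q
    ≤-left e e′ le = subst₂ ℚ._≤_ (sym e) (sym e′) (toℚ-mono-≤ le)

  vWall : ∀ {J} → suc J < n → J ≺ suc J → VWall (square n) t (toℚ (suc J)) (toℚ (n ∸ B J)) (toℚ (n ∸ T (suc J)))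
  vWall K<n J≺K = natWall t≡ (vertical-wall o E K<n J≺K)

  hWall : ∀ {J} → suc J < n → suc J ≺ J → VWall (square n) (flipR ∘ t) (toℚ (n ∸ suc J)) (toℚ (L (suc J))) (toℚ (R J))
  hWall K<n K≺J = natWall (λ k → cong flipR (t≡ k)) (horizontal-wall o E K<n K≺J)

  vLeft : ∀ {J k} → suc J < n → R (toℕ k) ≡ suc J → OnLeft t k (toℚ (suc J)) (toℚ (n ∸ B J)) (toℚ (n ∸ T (suc J)))
  vLeft {J} {k} K<n e = let _ , T≤T , B≤B = O.right-on-wall K<n (toℕ<n k) e in
    trans (right≡ k) (cong toℚ e) , ≤-left refl (bottom≡ k) (∸-monoʳ-≤ n B≤B) , ≤-left (top≡ k) refl (∸-monoʳ-≤ n T≤T)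

  vRight : ∀ {J l} → L (toℕ l) ≡ suc J → OnRight t l (toℚ (suc J)) (toℚ (n ∸ B J)) (toℚ (n ∸ T (suc J)))
  vRight {J} {l} e = let _ , T≤T , B≤B = O.left-on-wall (toℕ<n l) e in
    trans (left≡ l) (cong toℚ e) , ≤-left refl (bottom≡ l) (∸-monoʳ-≤ n B≤B) , ≤-left (top≡ l) refl (∸-monoʳ-≤ n T≤T)

  hBelow : ∀ {J k} → T (toℕ k) ≡ suc J → OnLeft (flipR ∘ t) k (toℚ (n ∸ suc J)) (toℚ (L (suc J))) (toℚ (R J))
  hBelow {J} {k} e = let _ , T≤T , B≤B = P.left-on-wall (toℕ<n k) e in
    trans (top≡ k) (cong (toℚ ∘ (n ∸_)) e) , ≤-left refl (left≡ k) T≤T , ≤-left (right≡ k) refl B≤B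

  hAbove : ∀ {J l} → suc J < n → B (toℕ l) ≡ suc J → OnRight (flipR ∘ t) l (toℚ (n ∸ suc J)) (toℚ (L (suc J))) (toℚ (R J))
  hAbove {J} {l} K<n e = let _ , T≤T , B≤B = P.right-on-wall K<n (toℕ<n l) e in
    trans (bottom≡ l) (cong (toℚ ∘ (n ∸_)) e) , ≤-left refl (left≡ l) T≤T , ≤-left (right≡ l) refl B≤B

  module _ (0<n : 0 < n) where

    v-oriented : Oriented (L ∘ toℕ) (R ∘ toℕ) Fin._<_ (square n) t
    v-oriented = record
      { tiling = grid-tiling o E 0<n t≡
      ; right-edge = right-edge
      ; left-edge = left-edge
      ; same-wall⇒ = λ { {k} {l} _ (e , _) (e′ , _) → toℚ-injective (trans (sym (right≡ k)) (trans e (trans (sym e′) (left≡ l)))) }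
      ; same-wall⇐ = same-wall⇐
      ; ordered = λ {k} {l} e → <-≤-trans (<R (toℕ<n k)) (≤-trans (≤-reflexive e) (L≤ (toℕ<n l)))
      }
      where
      right-edge : ∀ k → right (t k) ≡ toℚ n ⊎ ∃ λ c → ∃₂ λ a b → VWall (square n) t c a b × OnLeft t k c a b
      right-edge k with m≤n⇒m<n∨m≡n (R≤ (toℕ<n k)) | predecessor (<R (toℕ<n k))
      ... | inj₂ e | _ = inj₁ (trans (right≡ k) (cong toℚ e))
      ... | inj₁ R<n | J , e = inj₂ (_ , _ , _ , vWall K<n (proj₁ (O.right-on-wall K<n (toℕ<n k) e)) , vLeft K<n e)
        where K<n = subst (_< n) e R<n
      left-edge : ∀ k → left (t k) ≡ toℚ 0 ⊎ ∃ λ c → ∃₂ λ a b → VWall (square n) t c a b × OnRight t k c a b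
      left-edge k with L (toℕ k) in e
      ... | zero = inj₁ (trans (left≡ k) (cong toℚ e))
      ... | suc J = inj₂ (_ , _ , _ , vWall K<n (proj₁ (O.left-on-wall (toℕ<n k) e)) , vRight e)
        where K<n = ≤-<-trans (subst (_≤ toℕ k) e (L≤ (toℕ<n k))) (toℕ<n k)
      same-wall⇐ : ∀ {k l} → R (toℕ k) ≡ L (toℕ l) → ∃ λ c → ∃₂ λ a b → VWall (square n) t c a b × OnLeft t k c a b × OnRight t l c a b
      same-wall⇐ {k} {l} e with predecessor (<R (toℕ<n k))
      ... | J , eJ = _ , _ , _ , vWall K<n (proj₁ (O.right-on-wall K<n (toℕ<n k) eJ)) , vLeft K<n eJ , vRight (trans (sym e) eJ)
        where K<n = ≤-<-trans (≤-trans (≤-reflexive (trans (sym eJ) e)) (L≤ (toℕ<n l))) (toℕ<n l)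

    h-oriented : Oriented (B ∘ toℕ) (T ∘ toℕ) (λ k l → l Fin.< k) (square n) (flipR ∘ t)
    h-oriented = record
      { tiling = flipTiling (grid-tiling o E 0<n t≡)
      ; right-edge = right-edge
      ; left-edge = left-edge
      ; same-wall⇒ = λ { {k} {l} _ (e , _) (e′ , _) → ∸-cancelˡ-≡
          (≤-trans (T≤ (toℕ<n k)) (<⇒≤ (toℕ<n k))) (B≤ (toℕ<n l))
          (toℚ-injective (trans (sym (top≡ k)) (trans e (trans (sym e′) (bottom≡ l))))) }
      ; same-wall⇐ = same-wall⇐
      ; ordered = λ {k} {l} e → <-≤-trans (<B (toℕ<n l)) (≤-trans (≤-reflexive (sym e)) (T≤ (toℕ<n k)))
      }
      where
      left-edge : ∀ k → bottom (t k) ≡ toℚ 0 ⊎ ∃ λ c → ∃₂ λ a b → VWall (square n) (flipR ∘ t) c a b × OnRight (flipR ∘ t) k c a b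
      left-edge k with m≤n⇒m<n∨m≡n (B≤ (toℕ<n k)) | predecessor (<B (toℕ<n k))
      ... | inj₂ e | _ = inj₁ (trans (bottom≡ k) (cong toℚ (trans (cong (n ∸_) e) (n∸n≡0 n))))
      ... | inj₁ B<n | J , e = inj₂ (_ , _ , _ , hWall K<n (proj₁ (P.right-on-wall K<n (toℕ<n k) e)) , hAbove K<n e)
        where K<n = subst (_< n) e B<n
      right-edge : ∀ k → top (t k) ≡ toℚ n ⊎ ∃ λ c → ∃₂ λ a b → VWall (square n) (flipR ∘ t) c a b × OnLeft (flipR ∘ t) k c a b
      right-edge k with T (toℕ k) in e
      ... | zero = inj₁ (trans (top≡ k) (cong (toℚ ∘ (n ∸_)) e))
      ... | suc J = inj₂ (_ , _ , _ , hWall K<n (proj₁ (P.left-on-wall (toℕ<n k) e)) , hBelow e)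
        where K<n = ≤-<-trans (subst (_≤ toℕ k) e (T≤ (toℕ<n k))) (toℕ<n k)
      same-wall⇐ : ∀ {k l} → T (toℕ k) ≡ B (toℕ l) →
        ∃ λ c → ∃₂ λ a b → VWall (square n) (flipR ∘ t) c a b × OnLeft (flipR ∘ t) k c a b × OnRight (flipR ∘ t) l c a b
      same-wall⇐ {k} {l} e with predecessor (<B (toℕ<n l))
      ... | J , eJ = _ , _ , _ , hWall K<n (proj₁ (P.left-on-wall (toℕ<n k) (trans e eJ))) , hBelow (trans e eJ) , hAbove K<n eJ
        where K<n = ≤-<-trans (≤-trans (≤-reflexive (trans (sym eJ) (sym e))) (T≤ (toℕ<n k))) (toℕ<n k)

-- Wall shuffles

Precedes : Perm n → Fin n → Fin n → Set
Precedes x u v = x ⟨$⟩ˡ u Fin.< x ⟨$⟩ˡ v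

precedes⇒ : (x : Perm n) {u v : Fin n} → Before x (toℕ u) (toℕ v) → Precedes x u v
precedes⇒ x = subst₂ _<_ (rank-toℕ x _) (rank-toℕ x _)

precedes⇐ : (x : Perm n) {u v : Fin n} → Precedes x u v → Before x (toℕ u) (toℕ v)
precedes⇐ x = subst₂ _<_ (sym (rank-toℕ x _)) (sym (rank-toℕ x _))

AllPairs-⊑ : {A : Set} {Q : A → A → Set} {σ τ : List A} → σ ⊑ τ → AllPairs Q τ → AllPairs Q σ
AllPairs-⊑ []         []       = []
AllPairs-⊑ (_ ∷ʳ s)   (_ ∷ ps) = AllPairs-⊑ s ps
AllPairs-⊑ (refl ∷ s) (p ∷ ps) = All-resp-⊆ s p ∷ AllPairs-⊑ s ps

word-sorted : (x : Perm n) → AllPairs (Precedes x) (word x)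
word-sorted x = AllPairsₚ.tabulate⁺-< λ i<j → subst₂ Fin._<_ (sym (inverseˡ x)) (sym (inverseˡ x)) i<j

pair-in-order : {A : Set} {Q R : A → A → Set} {σ : List A} → (∀ {u v} → R u v → ¬ R v u) →
  AllPairs Q σ → AllPairs R σ → ∀ {u v} → u ∈ σ → v ∈ σ → R u v → Q u v
pair-in-order asym (q ∷ qs) (r ∷ rs) (here refl) (here refl) p = contradiction p (asym p)
pair-in-order asym (q ∷ qs) (r ∷ rs) (here refl) (there v∈)  p = All.lookup q v∈
pair-in-order asym (q ∷ qs) (r ∷ rs) (there u∈)  (here refl) p = contradiction p (asym (All.lookup r u∈))
pair-in-order asym (q ∷ qs) (r ∷ rs) (there u∈)  (there v∈)  p = pair-in-order asym qs rs u∈ v∈ p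

module DiagonalOf (x : Perm n) where
  open Extents (extentsOf x) public
  open Diagonal (before x) (extentsOf x) (tile (ρ x)) (tile-ρ x) public

  private
    _≺_ = Before x

  vSegment hSegment : ℕ → Segment
  vSegment J = vert (toℚ (suc J)) (toℚ (n ∸ B J)) (toℚ (n ∸ T (suc J)))
  hSegment J = horiz (toℚ (n ∸ suc J)) (toℚ (L (suc J))) (toℚ (R J))

  -- The bottom rectangle on the left of this wall is `J`, so the last inequality says that `k` is
  -- not the bottom one. Then `k + 1` comes before `k`, and the horizontal wall through the diagonal
  -- point between them carries the bottom edge of `k` and ends at the vertical wall.
  records-left : ∀ {J} k → suc J < n → R (toℕ k) ≡ suc J → suc (toℕ k) ≢ R (toℕ k) → Recorded (ρ x) (vSegment J) k
  records-left {J} kᶠ K<n e ne = left/above , _ , _ , _ , horiz-wall⇐ (ρ x) (hWall k⁺<n k⁺≺k) ,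
      (cong toℚ e , toℚ-mono-≤ (∸-monoʳ-≤ n (subst (_≤ B J) B≡ B≤B)) ,
        toℚ-mono-≤ (∸-monoʳ-≤ n (≤-trans T≤T (≤-trans (T≤ k<n) (n≤1+n k))))) ,
      (λ {p} → Direction.high⇐ vertical (ρ x) (vLeft K<n e) {p}) , (λ {p} → Direction.low⇐ horizontal (ρ x) (hAbove k⁺<n B≡) {p})
    where
    k = toℕ kᶠ
    k<n = toℕ<n kᶠ
    k⁺<R = ≤∧≢⇒< (<R k<n) ne
    k⁺<n = <-≤-trans k⁺<R (R≤ k<n)
    k⁺≺k : suc k ≺ k
    k⁺≺k = IsHi.inner (isR k<n) ≤-refl k⁺<R
    B≡ : B k ≡ suc k
    B≡ = P.R-step k⁺<n k⁺≺k
    T≤T = proj₁ (proj₂ (O.right-on-wall K<n k<n e))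
    B≤B = proj₂ (proj₂ (O.right-on-wall K<n k<n e))

  records-right : ∀ {J} l → L (toℕ l) ≡ suc J → toℕ l ≢ L (toℕ l) → Recorded (ρ x) (vSegment J) l
  records-right {J} lᶠ e ne = go (toℕ lᶠ) refl
    where
    l = toℕ lᶠ
    l<n = toℕ<n lᶠ
    go : ∀ m → l ≡ m → Recorded (ρ x) (vSegment J) lᶠ
    go zero eq = contradiction (trans eq (sym (n≤0⇒n≡0 (subst (L l ≤_) eq (L≤ l<n))))) ne
    go (suc i) eq = right/below , _ , _ , _ , horiz-wall⇐ (ρ x) (hWall i⁺<n i⁺≺i) ,
        (cong toℚ (trans (cong L (sym eq)) e) ,
         toℚ-mono-≤ (∸-monoʳ-≤ n (subst (_≤ B J) eq (≤-trans (<⇒≤ (<B l<n)) B≤B))) ,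
         toℚ-mono-≤ (∸-monoʳ-≤ n (subst (T (suc J) ≤_) T≡ T≤T))) ,
        (λ {p} → Direction.low⇐ vertical (ρ x) (vRight e) {p}) , (λ {p} → Direction.high⇐ horizontal (ρ x) (hBelow T≡) {p})
      where
      i⁺<n = subst (_< n) eq l<n
      i⁺≺i : suc i ≺ i
      i⁺≺i = subst (_≺ i) eq (IsLo.inner (isL l<n) (s≤s⁻¹ (subst (L l <_) eq (≤∧≢⇒< (L≤ l<n) (ne ∘ sym)))) (≤-reflexive (sym eq)))
      T≡ : T l ≡ suc i
      T≡ = trans (cong T eq) (P.L-step i⁺<n i⁺≺i)
      T≤T = proj₁ (proj₂ (O.left-on-wall l<n e))
      B≤B = proj₂ (proj₂ (O.left-on-wall l<n e))

  records-above : ∀ {J} k → suc J < n → B (toℕ k) ≡ suc J → suc (toℕ k) ≢ B (toℕ k) → Recorded (ρ x) (hSegment J) k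
  records-above {J} kᶠ K<n e ne = left/above , _ , _ , _ , vert-wall⇐ (ρ x) (vWall k⁺<n k≺k⁺) ,
      (cong (toℚ ∘ (n ∸_)) e , toℚ-mono-≤ (≤-trans L≤L (≤-trans (L≤ k<n) (n≤1+n k))) ,
        toℚ-mono-≤ (subst (_≤ R J) R≡ R≤R)) ,
      (λ {p} → Direction.low⇐ horizontal (ρ x) (hAbove K<n e) {p}) , (λ {p} → Direction.high⇐ vertical (ρ x) (vLeft k⁺<n R≡) {p})
    where
    k = toℕ kᶠ
    k<n = toℕ<n kᶠ
    k⁺<B = ≤∧≢⇒< (<B k<n) ne
    k⁺<n = <-≤-trans k⁺<B (B≤ k<n)
    k≺k⁺ : k ≺ suc k
    k≺k⁺ = IsHi.inner (isB k<n) ≤-refl k⁺<B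
    R≡ : R k ≡ suc k
    R≡ = O.R-step k⁺<n k≺k⁺
    L≤L = proj₁ (proj₂ (P.right-on-wall K<n k<n e))
    R≤R = proj₂ (proj₂ (P.right-on-wall K<n k<n e))

  records-below : ∀ {J} l → T (toℕ l) ≡ suc J → toℕ l ≢ T (toℕ l) → Recorded (ρ x) (hSegment J) l
  records-below {J} lᶠ e ne = go (toℕ lᶠ) refl
    where
    l = toℕ lᶠ
    l<n = toℕ<n lᶠ
    go : ∀ m → l ≡ m → Recorded (ρ x) (hSegment J) lᶠ
    go zero eq = contradiction (trans eq (sym (n≤0⇒n≡0 (subst (T l ≤_) eq (T≤ l<n))))) ne
    go (suc i) eq = right/below , _ , _ , _ , vert-wall⇐ (ρ x) (vWall i⁺<n i≺i⁺) ,
        (cong (toℚ ∘ (n ∸_)) (trans (cong T (sym eq)) e) ,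
         toℚ-mono-≤ (subst (L (suc J) ≤_) L≡ L≤L) ,
         toℚ-mono-≤ (subst (_≤ R J) eq (≤-trans (<⇒≤ (<R l<n)) R≤R))) ,
        (λ {p} → Direction.high⇐ horizontal (ρ x) (hBelow e) {p}) , (λ {p} → Direction.low⇐ vertical (ρ x) (vRight L≡) {p})
      where
      i⁺<n = subst (_< n) eq l<n
      i≺i⁺ : i ≺ suc i
      i≺i⁺ = subst (i ≺_) eq (IsLo.inner (isT l<n) (s≤s⁻¹ (subst (T l <_) eq (≤∧≢⇒< (T≤ l<n) (ne ∘ sym)))) (≤-reflexive (sym eq)))
      L≡ : L l ≡ suc i
      L≡ = trans (cong L eq) (O.L-step i⁺<n i≺i⁺)
      L≤L = proj₁ (proj₂ (P.left-on-wall l<n e))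
      R≤R = proj₂ (proj₂ (P.left-on-wall l<n e))

module _ {T : Layout n} (tT : IsTiling (frame T) (tile T)) where
  private
    ne = IsTiling.nonEmpty tT

  -- A rectangle left of the wall cannot have been recorded from the right, since its width is
  -- positive; so the recorded height is that of its bottom edge.
  decode-left : ∀ {c a b s k h} → RecordsFrom T (vert c a b) s k h → OnLeft (tile T) k c a b → bottom (tile T k) ≡ h
  decode-left {s = left/above} {k} (_ , _ , _ , _ , _ , e) _ = proj₁ (horiz-⊆ (ℚₚ.<⇒≤ (proj₁ (ne k))) e)
  decode-left {s = right/below} {k} (_ , _ , _ , _ , e , _) (e′ , _) =
    contradiction (proj₁ (ne k)) (ℚₚ.<-irrefl (trans (proj₁ (vert-⊆ (ℚₚ.<⇒≤ (proj₂ (ne k))) e)) (sym e′)))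

  decode-right : ∀ {c a b s k h} → RecordsFrom T (vert c a b) s k h → OnRight (tile T) k c a b → top (tile T k) ≡ h
  decode-right {s = right/below} {k} (_ , _ , _ , _ , _ , e) _ = proj₁ (horiz-⊆ (ℚₚ.<⇒≤ (proj₁ (ne k))) e)
  decode-right {s = left/above} {k} (_ , _ , _ , _ , e , _) (e′ , _) =
    contradiction (proj₁ (ne k)) (ℚₚ.<-irrefl (trans e′ (sym (proj₁ (vert-⊆ (ℚₚ.<⇒≤ (proj₂ (ne k))) e)))))

  decode-below : ∀ {c a b s k h} → RecordsFrom T (horiz c a b) s k h → OnLeft (flipR ∘ tile T) k c a b → left (tile T k) ≡ h
  decode-below {s = right/below} {k} (_ , _ , _ , _ , _ , e) _ = proj₁ (vert-⊆ (ℚₚ.<⇒≤ (proj₂ (ne k))) e)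
  decode-below {s = left/above} {k} (_ , _ , _ , _ , e , _) (e′ , _) =
    contradiction (proj₂ (ne k)) (ℚₚ.<-irrefl (trans (proj₁ (horiz-⊆ (ℚₚ.<⇒≤ (proj₁ (ne k))) e)) (sym e′)))

  decode-above : ∀ {c a b s k h} → RecordsFrom T (horiz c a b) s k h → OnRight (flipR ∘ tile T) k c a b → right (tile T k) ≡ h
  decode-above {s = left/above} {k} (_ , _ , _ , _ , _ , e) _ = proj₁ (vert-⊆ (ℚₚ.<⇒≤ (proj₂ (ne k))) e)
  decode-above {s = right/below} {k} (_ , _ , _ , _ , e , _) (e′ , _) =
    contradiction (proj₂ (ne k)) (ℚₚ.<-irrefl (trans e′ (sym (proj₁ (horiz-⊆ (ℚₚ.<⇒≤ (proj₁ (ne k))) e)))))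

-- A numbered representative of γ(x)

module FiberData {n} (0<n : 0 < n) (x : Perm n) {R′ : Layout n} (g : x γ↦ R′) where
  open _γ↦_ g renaming (Numbered to N) public
  open DiagonalOf x public

  mosaic : SameMosaic (ρ x) N
  mosaic = same-mosaic slides

  ρ-tiling : IsTiling (frame (ρ x)) (tile (ρ x))
  ρ-tiling = Oriented.tiling (v-oriented 0<n)

  N-tiling : IsTiling (frame N) (tile N)
  N-tiling = slides-tiling slides ρ-tiling

  vN : Oriented (L ∘ toℕ) (R ∘ toℕ) Fin._<_ (frame N) (tile N)
  vN = oriented-transfer vertical mosaic ρ-tiling N-tiling (v-oriented 0<n)

  hN : Oriented (B ∘ toℕ) (T ∘ toℕ) (λ k l → l Fin.< k) (flipR (frame N)) (flipR ∘ tile N)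
  hN = oriented-transfer horizontal mosaic ρ-tiling N-tiling (h-oriented 0<n)

  -- The shuffle is sorted in two ways, by positions in `x` as a subsequence of its word, and by
  -- coordinates along the wall of `N`. For two of its members the first order therefore implies the
  -- second.
  recorded-before : ∀ {V W j k} → Wall (ρ x) V → Wall N W → SameWall (ρ x) V N W →
    Recorded (ρ x) V j → Recorded (ρ x) V k → Before x (toℕ j) (toℕ k) → RecordedBefore N W j k
  recorded-before {V} {W} {j} {k} wV wW same rj rk j≺k with shuffles V W wV wW same
  ... | σ , σ⊑ , mem , _ , sorted = pair-in-order (λ p q → <-asym p q) sorted (AllPairs-⊑ σ⊑ (word-sorted x))
    (from (mem j) rj) (from (mem k) rk) (precedes⇒ x j≺k)

  module _ {k l : Fin n} (e : R (toℕ k) ≡ L (toℕ l)) (k≢ : suc (toℕ k) ≢ R (toℕ k)) (l≢ : toℕ l ≢ L (toℕ l)) where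
    private
      vdata : ∃ λ J → suc J < n × R (toℕ k) ≡ suc J
      vdata = let J , eq = predecessor (<R (toℕ<n k)) in
        J , ≤-<-trans (≤-trans (≤-reflexive (trans (sym eq) e)) (L≤ (toℕ<n l))) (toℕ<n l) , eq

      order : ∀ {j j′} {P : Set} → (∀ {V} → Recorded (ρ x) V k → Recorded (ρ x) V l → Recorded (ρ x) V j × Recorded (ρ x) V j′) →
        Before x (toℕ j) (toℕ j′) →
        (∀ {c a b} → OnLeft (tile N) k c a b → OnRight (tile N) l c a b → RecordedBefore N (vert c a b) j j′ → P) → P
      order pick j≺ cont =
        let J , K<n , eJ = vdata
            wall = vert-wall⇐ (ρ x) (vWall K<n (proj₁ (O.right-on-wall K<n (toℕ<n k) eJ)))
            _ , _ , _ , wall′ , same , ok , ol = wall-between vertical mosaic ρ-tiling N-tiling wall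
              (vLeft K<n eJ) (vRight (trans (sym e) eJ))
            rj , rj′ = pick (records-left k K<n eJ k≢) (records-right l (trans (sym e) eJ) l≢)
        in cont ok ol (recorded-before wall wall′ same rj rj′ j≺)

    v-shuffle< : Before x (toℕ k) (toℕ l) → bottom (tile N k) ℚ.< top (tile N l)
    v-shuffle< k≺l = order {k} {l} (λ p q → p , q) k≺l λ { ok ol (_ , _ , _ , _ , r , r′ , lt) →
      subst₂ ℚ._<_ (sym (decode-left N-tiling r ok)) (sym (decode-right N-tiling r′ ol)) lt }

    v-shuffle> : Before x (toℕ l) (toℕ k) → top (tile N l) ℚ.< bottom (tile N k)
    v-shuffle> l≺k = order {l} {k} (λ p q → q , p) l≺k λ { ok ol (_ , _ , _ , _ , r , r′ , lt) →
      subst₂ ℚ._<_ (sym (decode-right N-tiling r ol)) (sym (decode-left N-tiling r′ ok)) lt }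

  module _ {k l : Fin n} (e : T (toℕ k) ≡ B (toℕ l)) (k≢ : toℕ k ≢ T (toℕ k)) (l≢ : suc (toℕ l) ≢ B (toℕ l)) where
    private
      hdata : ∃ λ J → suc J < n × B (toℕ l) ≡ suc J
      hdata = let J , eq = predecessor (<B (toℕ<n l)) in
        J , ≤-<-trans (≤-trans (≤-reflexive (trans (sym eq) (sym e))) (T≤ (toℕ<n k))) (toℕ<n k) , eq

      order : ∀ {j j′} {P : Set} → (∀ {V} → Recorded (ρ x) V k → Recorded (ρ x) V l → Recorded (ρ x) V j × Recorded (ρ x) V j′) →
        Before x (toℕ j) (toℕ j′) →
        (∀ {c a b} → OnLeft (flipR ∘ tile N) k c a b → OnRight (flipR ∘ tile N) l c a b → RecordedBefore N (horiz c a b) j j′ → P) → P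
      order pick j≺ cont =
        let J , K<n , eJ = hdata
            wall = horiz-wall⇐ (ρ x) (hWall K<n (proj₁ (P.right-on-wall K<n (toℕ<n l) eJ)))
            _ , _ , _ , wall′ , same , ok , ol = wall-between horizontal mosaic ρ-tiling N-tiling wall
              (hBelow (trans e eJ)) (hAbove K<n eJ)
            rj , rj′ = pick (records-below k (trans e eJ) k≢) (records-above l K<n eJ l≢)
        in cont ok ol (recorded-before wall wall′ same rj rj′ j≺)

    h-shuffle< : Before x (toℕ k) (toℕ l) → left (tile N k) ℚ.< right (tile N l)
    h-shuffle< k≺l = order {k} {l} (λ p q → p , q) k≺l λ { ok ol (_ , _ , _ , _ , r , r′ , lt) →
      subst₂ ℚ._<_ (sym (decode-below N-tiling r ok)) (sym (decode-above N-tiling r′ ol)) lt }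

    h-shuffle> : Before x (toℕ l) (toℕ k) → right (tile N l) ℚ.< left (tile N k)
    h-shuffle> l≺k = order {l} {k} (λ p q → q , p) l≺k λ { ok ol (_ , _ , _ , _ , r , r′ , lt) →
      subst₂ ℚ._<_ (sym (decode-above N-tiling r ol)) (sym (decode-below N-tiling r′ ok)) lt }

-- Recovering a diagonal rectangulation and its wall shuffles

module _ (T : Layout n) (tT : IsTiling (frame T) (tile T)) where
  private
    b<t : ∀ k → bottom (tile T k) ℚ.≤ top (tile T k)
    b<t k = ℚₚ.<⇒≤ (proj₂ (IsTiling.nonEmpty tT k))
    l<r : ∀ k → left (tile T k) ℚ.≤ right (tile T k)
    l<r k = ℚₚ.<⇒≤ (proj₁ (IsTiling.nonEmpty tT k))

    meet : ∀ {a b a′ b′} → a ℚ.≤ b → a′ ℚ.≤ b′ → a ℚ.≤ b′ → a′ ℚ.≤ b → ∃ λ y → (a ℚ.≤ y × y ℚ.≤ b) × a′ ℚ.≤ y × y ℚ.≤ b′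
    meet {a} {b} {a′} p q r s with ℚₚ.≤-total a a′
    ... | inj₁ le = a′ , (le , s) , ℚₚ.≤-refl , q
    ... | inj₂ le = a , (ℚₚ.≤-refl , p) , le , r

  leftOf⇒ : ∀ k l → LeftOf T k l → Touches (tile T) k l
  leftOf⇒ _ _ (_ , (e , p , q) , (e′ , p′ , q′)) = trans (sym e) e′ , ℚₚ.≤-trans p q′ , ℚₚ.≤-trans p′ q

  leftOf⇐ : ∀ k l → Touches (tile T) k l → LeftOf T k l
  leftOf⇐ k l (e , p , q) = let y , (u , v) , w = meet (b<t k) (b<t l) p q in (_ , y) , (refl , u , v) , e , w

  below⇒ : ∀ k l → Below T k l → Touches (flipR ∘ tile T) k l
  below⇒ _ _ (_ , (e , p , q) , (e′ , p′ , q′)) = trans (sym e) e′ , ℚₚ.≤-trans p q′ , ℚₚ.≤-trans p′ q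

  below⇐ : ∀ k l → Touches (flipR ∘ tile T) k l → Below T k l
  below⇐ k l (e , p , q) = let y , (u , v) , w = meet (l<r k) (l<r l) p q in (y , _) , (refl , u , v) , e , w

zigzag-map : ∀ {t : Fin n → Rect ℚ} {L R : Fin n → ℕ} (ψ : Fin n → Fin n) →
  (∀ {i j} → Touches t i j → R (ψ i) ≡ L (ψ j)) → ∀ {k l} → Zigzag t k l → R (ψ k) ≡ L (ψ l)
zigzag-map ψ f (edge-of p) = f p
zigzag-map {L = L} {R} ψ f (left-via p q z) = trans (f p) (trans (sym (f q)) (zigzag-map {L = L} {R} ψ f z))
zigzag-map {L = L} {R} ψ f (right-via z p q) = trans (zigzag-map {L = L} {R} ψ f z) (trans (sym (f p)) (f q))

increasing⇒≥ : (ψ : Fin n → Fin n) → (∀ {i j} → toℕ j ≡ suc (toℕ i) → ψ i Fin.< ψ j) → ∀ k → toℕ k ≤ toℕ (ψ k)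
increasing⇒≥ {n} ψ inc k = go (toℕ k) k refl
  where
  go : ∀ m k → toℕ k ≡ m → m ≤ toℕ (ψ k)
  go zero k eq = z≤n
  go (suc m) k eq = ≤-<-trans (go m i i≡m) (inc (trans eq (cong suc (sym i≡m))))
    where
    m<n : m < n
    m<n = <-trans (≤-reflexive (sym eq)) (toℕ<n k)
    i = fromℕ< m<n
    i≡m = toℕ-fromℕ< m<n

increasing⇒id : (ψ : Permutation′ n) → (∀ {i j} → toℕ j ≡ suc (toℕ i) → (ψ ⟨$⟩ʳ i) Fin.< (ψ ⟨$⟩ʳ j)) →
  (∀ {i j} → toℕ j ≡ suc (toℕ i) → (ψ ⟨$⟩ˡ i) Fin.< (ψ ⟨$⟩ˡ j)) → ∀ k → ψ ⟨$⟩ʳ k ≡ k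
increasing⇒id ψ inc inc′ k = toℕ-injective (≤-antisym
  (subst (λ i → toℕ (ψ ⟨$⟩ʳ k) ≤ toℕ i) (inverseˡ ψ) (increasing⇒≥ (ψ ⟨$⟩ˡ_) inc′ (ψ ⟨$⟩ʳ k)))
  (increasing⇒≥ (ψ ⟨$⟩ʳ_) inc k))

module _ {R₁ R₂ : ℕ → ℕ → Set} (o₁ : StrictTotal R₁) (E₁ : Extents n R₁) (o₂ : StrictTotal R₂) (E₂ : Extents n R₂)
  (same : ∀ {k l} → k < n → l < n → Extents.R E₁ k ≡ Extents.L E₁ l → Extents.R E₂ k ≡ Extents.L E₂ l) where
  private
    module E₁ = Extents E₁
    module E₂ = Extents E₂
    module O₁ = Tiles o₁ E₁

    -- Knowing which labels face each other across a wall reveals the number of the wall: `J` and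
    -- `J + 1` still face each other in the second tiling, and `L (suc J) ≤ suc J ≤ R J` leaves a
    -- single value for both.
    diagonal-wall : ∀ {J} → suc J < n → R₁ J (suc J) → E₂.R J ≡ suc J × E₂.L (suc J) ≡ suc J
    diagonal-wall {J} K<n p = trans e L≡ , L≡
      where
      J<n = <-trans (n<1+n J) K<n
      e = same J<n K<n (trans (O₁.R-step K<n p) (sym (O₁.L-step K<n p)))
      L≡ = ≤-antisym (E₂.L≤ K<n) (≤-trans (E₂.<R J<n) (≤-reflexive e))

  R-determined : ∀ {k} → k < n → E₁.R k < n → E₂.R k ≡ E₁.R k
  R-determined {k} k<n R<n with predecessor (E₁.<R k<n)
  ... | J , eq = trans (same k<n K<n (trans eq (sym (O₁.L-step K<n p)))) (trans (proj₂ (diagonal-wall K<n p)) (sym eq))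
    where
    K<n = subst (_< n) eq R<n
    p = proj₁ (O₁.right-on-wall K<n k<n eq)

  L-determined : ∀ {l} → l < n → 0 < E₁.L l → E₂.L l ≡ E₁.L l
  L-determined {l} l<n 0<L with predecessor 0<L
  ... | J , eq = trans (sym (same J<n l<n (trans (O₁.R-step K<n p) (sym eq)))) (trans (proj₁ (diagonal-wall K<n p)) (sym eq))
    where
    K<n = ≤-<-trans (subst (_≤ l) eq (E₁.L≤ l<n)) l<n
    J<n = <-trans (n<1+n J) K<n
    p = proj₁ (O₁.left-on-wall l<n eq)

module _ {R₁ R₂ : ℕ → ℕ → Set} (o₁ : StrictTotal R₁) (E₁ : Extents n R₁) (o₂ : StrictTotal R₂) (E₂ : Extents n R₂)
  (same : ∀ {k l} → k < n → l < n → Extents.R E₁ k ≡ Extents.L E₁ l → Extents.R E₂ k ≡ Extents.L E₂ l)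
  (same′ : ∀ {k l} → k < n → l < n → Extents.R E₂ k ≡ Extents.L E₂ l → Extents.R E₁ k ≡ Extents.L E₁ l) where
  private
    module E₁ = Extents E₁
    module E₂ = Extents E₂

  R-same : ∀ {k} → k < n → E₁.R k ≡ E₂.R k
  R-same k<n with m≤n⇒m<n∨m≡n (E₁.R≤ k<n) | m≤n⇒m<n∨m≡n (E₂.R≤ k<n)
  ... | inj₁ p | _ = sym (R-determined o₁ E₁ o₂ E₂ same k<n p)
  ... | inj₂ _ | inj₁ q = R-determined o₂ E₂ o₁ E₁ same′ k<n q
  ... | inj₂ e | inj₂ e′ = trans e (sym e′)

  L-same : ∀ {l} → l < n → E₁.L l ≡ E₂.L l
  L-same {l} l<n with n≡0⊎0<n (E₁.L l) | n≡0⊎0<n (E₂.L l)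
    where
    n≡0⊎0<n : ∀ m → m ≡ 0 ⊎ 0 < m
    n≡0⊎0<n zero = inj₁ refl
    n≡0⊎0<n (suc _) = inj₂ (s≤s z≤n)
  ... | inj₂ p | _ = sym (L-determined o₁ E₁ o₂ E₂ same l<n p)
  ... | inj₁ _ | inj₂ q = L-determined o₂ E₂ o₁ E₁ same′ l<n q
  ... | inj₁ e | inj₁ e′ = trans e (sym e′)

-- The data of γ(x) that matter for descents: the rectangles of ρ(x), and the
-- order of two labels on opposite sides of a wall.
record SameData (x y : Perm n) : Set where
  private
    module X = Extents (extentsOf x)
    module Y = Extents (extentsOf y)
  field
    L≡ : ∀ {k} → k < n → X.L k ≡ Y.L k
    R≡ : ∀ {k} → k < n → X.R k ≡ Y.R k
    T≡ : ∀ {k} → k < n → X.T k ≡ Y.T k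
    B≡ : ∀ {k} → k < n → X.B k ≡ Y.B k
    v-order : ∀ {a e} → a < n → e < n → X.R a ≡ X.L e → Before x e a → Before y e a
    h-order : ∀ {a e} → a < n → e < n → X.T e ≡ X.B a → Before x e a → Before y e a

on-labels : (P : ℕ → ℕ → Set) → (∀ (k l : Fin n) → P (toℕ k) (toℕ l)) → ∀ {k l} → k < n → l < n → P k l
on-labels P h k<n l<n = subst₂ P (toℕ-fromℕ< k<n) (toℕ-fromℕ< l<n) (h (fromℕ< k<n) (fromℕ< l<n))

Renumbering : Layout n → Layout n → (Fin n → Fin n) → Set
Renumbering T U ψ = ∀ k l → (Below T k l → Below U (ψ k) (ψ l)) × (LeftOf T k l → LeftOf U (ψ k) (ψ l))

-- Two permutations in the same fiber

module _ {n} (0<n : 0 < n) {x y : Perm n} {S S′ : Layout n} (gx : x γ↦ S) (gy : y γ↦ S′) where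
  private
    module X = FiberData 0<n x gx
    module Y = FiberData 0<n y gy
    module VX = Sides X.vN
    module HX = Sides X.hN
    module VY = Sides Y.vN
    module HY = Sides Y.hN

  module _ (ψ : Fin n → Fin n) (ren : Renumbering X.N Y.N ψ) where

    v-renumber : ∀ {k l} → X.R (toℕ k) ≡ X.L (toℕ l) → Y.R (toℕ (ψ k)) ≡ Y.L (toℕ (ψ l))
    v-renumber e = zigzag-map {t = tile X.N} {Y.L ∘ toℕ} {Y.R ∘ toℕ} ψ
      (λ {i} {j} p → VY.touches⇒ (leftOf⇒ Y.N Y.N-tiling (ψ i) (ψ j) (proj₂ (ren i j) (leftOf⇐ X.N X.N-tiling i j p))))
      (VX.Sweep.touching-zigzag <ᶠ-wellFounded <-trans (λ p → Oriented.ordered X.hN (HX.touches⇒ p)) e)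

    h-renumber : ∀ {k l} → X.T (toℕ k) ≡ X.B (toℕ l) → Y.T (toℕ (ψ k)) ≡ Y.B (toℕ (ψ l))
    h-renumber e = zigzag-map {t = flipR ∘ tile X.N} {Y.B ∘ toℕ} {Y.T ∘ toℕ} ψ
      (λ {i} {j} p → HY.touches⇒ (below⇒ Y.N Y.N-tiling (ψ i) (ψ j) (proj₁ (ren i j) (below⇐ X.N X.N-tiling i j p))))
      (HX.Sweep.touching-zigzag >-wellFounded (λ p q → <-trans q p) (λ p → Oriented.ordered X.vN (VX.touches⇒ p)) e)

    -- The walls between consecutive labels are vertical or horizontal according to their order in
    -- `x`. Contacts carry either case over to `y`, where labels increase across walls from left to
    -- right and from top to bottom.
    renumber-increasing : ∀ {i j} → toℕ j ≡ suc (toℕ i) → ψ i Fin.< ψ j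
    renumber-increasing {i} {j} eq with StrictTotal.≺-conn (before x) (<⇒≢ (n<1+n (toℕ i)))
    ... | inj₁ i≺ = Oriented.ordered Y.vN (v-renumber {i} {j}
        (trans (X.O.R-step K<n i≺) (sym (trans (cong X.L eq) (X.O.L-step K<n i≺)))))
      where K<n = subst (_< n) eq (toℕ<n j)
    ... | inj₂ ≺i = Oriented.ordered Y.hN (h-renumber {j} {i}
        (trans (trans (cong X.T eq) (X.P.L-step K<n ≺i)) (sym (X.P.R-step K<n ≺i))))
      where K<n = subst (_< n) eq (toℕ<n j)

module _ {n} (0<n : 0 < n) {x y : Perm n} {S : Layout n} (gx : x γ↦ S) (gy : y γ↦ S) where
  private
    module X = FiberData 0<n x gx
    module Y = FiberData 0<n y gy

  renumbering : Permutation′ n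
  renumbering = proj₁ X.class ∘ₚ flip (proj₁ Y.class)

  renumbers : Renumbering X.N Y.N (renumbering ⟨$⟩ʳ_)
  renumbers k l =
      (λ b → from (proj₁ (proj₂ Y.class (ψ k) (ψ l))) (subst₂ (Below S) (back k) (back l) (to (proj₁ (proj₂ X.class k l)) b))) ,
      (λ b → from (proj₂ (proj₂ Y.class (ψ k) (ψ l))) (subst₂ (LeftOf S) (back k) (back l) (to (proj₂ (proj₂ X.class k l)) b)))
    where
    ψ = renumbering ⟨$⟩ʳ_
    back : ∀ k → proj₁ X.class ⟨$⟩ʳ k ≡ proj₁ Y.class ⟨$⟩ʳ ψ k
    back k = sym (inverseʳ (proj₁ Y.class))

module _ {n} (0<n : 0 < n) {x y : Perm n} {S : Layout n} (gx : x γ↦ S) (gy : y γ↦ S) where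
  private
    module X = FiberData 0<n x gx
    module Y = FiberData 0<n y gy
    module VX = Sides X.vN
    module HX = Sides X.hN
    module VY = Sides Y.vN
    module HY = Sides Y.hN

  same-numbering : ∀ k → renumbering 0<n gx gy ⟨$⟩ʳ k ≡ k
  same-numbering = increasing⇒id (renumbering 0<n gx gy)
    (renumber-increasing 0<n gx gy _ (renumbers 0<n gx gy))
    (renumber-increasing 0<n gy gx _ (renumbers 0<n gy gx))

  same-contacts : Renumbering X.N Y.N id
  same-contacts k l =
    (λ b → subst₂ (Below Y.N) (same-numbering k) (same-numbering l) (proj₁ (renumbers 0<n gx gy k l) b)) ,
    (λ b → subst₂ (LeftOf Y.N) (same-numbering k) (same-numbering l) (proj₂ (renumbers 0<n gx gy k l) b))

  v-same : ∀ {k l} → k < n → l < n → X.R k ≡ X.L l → Y.R k ≡ Y.L l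
  v-same = on-labels (λ k l → X.R k ≡ X.L l → Y.R k ≡ Y.L l) λ k l → v-renumber 0<n gx gy id same-contacts

  h-same : ∀ {k l} → k < n → l < n → X.B k ≡ X.T l → Y.B k ≡ Y.T l
  h-same = on-labels (λ k l → X.B k ≡ X.T l → Y.B k ≡ Y.T l) λ k l e → sym (h-renumber 0<n gx gy id same-contacts (sym e))

  v-order-same : ∀ (a e : Fin n) → X.R (toℕ a) ≡ X.L (toℕ e) → Y.R (toℕ a) ≡ X.R (toℕ a) → Y.L (toℕ e) ≡ X.L (toℕ e) →
    Before x (toℕ e) (toℕ a) → ¬ Before y (toℕ a) (toℕ e)
  v-order-same a e eq R≡ L≡ e≺a a≺e = bottom-before-top <ᶠ-wellFounded <-trans Y.vN X.vN
      (λ p → Oriented.ordered Y.hN (HY.touches⇒ p)) (λ p → Oriented.ordered X.hN (HX.touches⇒ p))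
      (λ {i} {j} p → leftOf⇒ Y.N Y.N-tiling i j (proj₂ (same-contacts i j) (leftOf⇐ X.N X.N-tiling i j p)))
      eq′ eq
      (Y.v-shuffle< eq′ (λ s → a≢ (trans s R≡)) (λ s → e≢ (trans s L≡)) a≺e)
      (X.v-shuffle> eq a≢ e≢ e≺a)
    where
    eq′ = trans R≡ (trans eq (sym L≡))
    -- If `a` were the bottom rectangle on the left of the wall, or `e` the top one on the right,
    -- then `a` would come before `e` in `x`. So both take part in the shuffle.
    a≢ : suc (toℕ a) ≢ X.R (toℕ a)
    a≢ s = <-asym e≺a (IsLo.outer (X.isL (toℕ<n e)) (trans s eq))
    e≢ : toℕ e ≢ X.L (toℕ e)
    e≢ s = <-asym e≺a (subst (Before x (toℕ a)) (trans eq (sym s))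
      (IsHi.outer (X.isR (toℕ<n a)) (subst (_< n) (sym (trans eq (sym s))) (toℕ<n e))))

  h-order-same : ∀ (a e : Fin n) → X.T (toℕ e) ≡ X.B (toℕ a) → Y.B (toℕ a) ≡ X.B (toℕ a) → Y.T (toℕ e) ≡ X.T (toℕ e) →
    Before x (toℕ e) (toℕ a) → ¬ Before y (toℕ a) (toℕ e)
  -- In the reflected view the larger label `e` is on the left of the wall, so `x` and `y` exchange
  -- their roles.
  h-order-same a e eq B≡ T≡ e≺a a≺e = bottom-before-top >-wellFounded (λ p q → <-trans q p) X.hN Y.hN
      (λ p → Oriented.ordered X.vN (VX.touches⇒ p)) (λ p → Oriented.ordered Y.vN (VY.touches⇒ p))
      (λ {i} {j} p → below⇒ X.N X.N-tiling i j (proj₁ (contacts⁻ i j) (below⇐ Y.N Y.N-tiling i j p)))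
      eq eq′
      (X.h-shuffle< eq (λ s → e≢ (trans s (sym T≡))) (λ s → a≢ (trans s (sym B≡))) e≺a)
      (Y.h-shuffle> eq′ e≢ a≢ a≺e)
    where
    eq′ = trans T≡ (trans eq (sym B≡))
    e≢ : toℕ e ≢ Y.T (toℕ e)
    e≢ s = <-asym a≺e (subst (λ i → Before y i (toℕ a)) (sym (trans s eq′))
      (IsHi.outer (Y.isB (toℕ<n a)) (subst (_< n) (trans s eq′) (toℕ<n e))))
    a≢ : suc (toℕ a) ≢ Y.B (toℕ a)
    a≢ s = <-asym a≺e (IsLo.outer (Y.isT (toℕ<n e)) (trans s (sym eq′)))
    contacts⁻ : Renumbering Y.N X.N id
    contacts⁻ k l = (λ b → subst₂ (Below X.N) (inv k) (inv l) (proj₁ (renumbers 0<n gy gx k l) b)) ,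
        (λ b → subst₂ (LeftOf X.N) (inv k) (inv l) (proj₂ (renumbers 0<n gy gx k l) b))
      where
      inv : ∀ k → renumbering 0<n gy gx ⟨$⟩ʳ k ≡ k
      inv = increasing⇒id (renumbering 0<n gy gx)
        (renumber-increasing 0<n gy gx _ (renumbers 0<n gy gx))
        (renumber-increasing 0<n gx gy _ (renumbers 0<n gx gy))

fiber⇒same-data : 0 < n → {x y : Perm n} {S : Layout n} → x γ↦ S → y γ↦ S → SameData x y
fiber⇒same-data {n} 0<n {x} {y} gx gy = record
  { L≡ = L≡ ; R≡ = R≡ ; T≡ = T≡ ; B≡ = B≡
  ; v-order = on-labels (λ a e → X.R a ≡ X.L e → Before x e a → Before y e a) λ a e eq e≺a →
      otherwise (v-order-same 0<n gx gy a e eq (sym (R≡ (toℕ<n a))) (sym (L≡ (toℕ<n e))) e≺a)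
        (<⇒≢ (<-≤-trans (X.<R (toℕ<n a)) (≤-trans (≤-reflexive eq) (X.L≤ (toℕ<n e)))))
  ; h-order = on-labels (λ a e → X.T e ≡ X.B a → Before x e a → Before y e a) λ a e eq e≺a →
      otherwise (h-order-same 0<n gx gy a e eq (sym (B≡ (toℕ<n a))) (sym (T≡ (toℕ<n e))) e≺a)
        (<⇒≢ (<-≤-trans (X.<B (toℕ<n a)) (≤-trans (≤-reflexive (sym eq)) (X.T≤ (toℕ<n e)))))
  }
  where
  module X = Extents (extentsOf x)
  module Y = Extents (extentsOf y)
  R≡ = R-same (before x) (extentsOf x) (before y) (extentsOf y) (v-same 0<n gx gy) (v-same 0<n gy gx)
  L≡ = L-same (before x) (extentsOf x) (before y) (extentsOf y) (v-same 0<n gx gy) (v-same 0<n gy gx)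
  T≡ = L-same (reverse (before x)) (transposeᴱ (extentsOf x)) (reverse (before y)) (transposeᴱ (extentsOf y))
    (h-same 0<n gx gy) (h-same 0<n gy gx)
  B≡ = R-same (reverse (before x)) (transposeᴱ (extentsOf x)) (reverse (before y)) (transposeᴱ (extentsOf y))
    (h-same 0<n gx gy) (h-same 0<n gy gx)
  otherwise : ∀ {a e} → ¬ Before y a e → a ≢ e → Before y e a
  otherwise ¬p a≢e with StrictTotal.≺-conn (before y) a≢e
  ... | inj₁ p = contradiction p ¬p
  ... | inj₂ p = p

-- Permutations with the same rectangulation

ρ-cong : (x y : Perm n) → (∀ {k} → k < n → rectOf (extentsOf x) k ≡ rectOf (extentsOf y) k) → ρ x ≡ ρ y
ρ-cong {n} x y h = cong (layout (square n)) (tabulate-cong λ k →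
  cong (mapRect toℚ) (trans (newRect-ρ x k) (trans (h (toℕ<n k)) (sym (newRect-ρ y k)))))

positive-is-suc : {τ : List (Fin (suc n))} → All (zero {n} Fin.<_) τ → AllPairs Fin._<_ τ →
  ∃ λ τ′ → τ ≡ List.map suc τ′ × AllPairs Fin._<_ τ′
positive-is-suc [] [] = [] , refl , []
positive-is-suc {τ = suc i ∷ _} (_ ∷ ps) (q ∷ qs) with positive-is-suc ps qs
... | τ′ , refl , qs′ = i ∷ τ′ , refl , All.map (λ {j} → s<s⁻¹ {toℕ i} {toℕ j}) (Allₚ.map⁻ q) ∷ qs′

increasing-⊑ : {A : Set} (f : Fin n → A) {τ : List (Fin n)} → AllPairs Fin._<_ τ → List.map f τ ⊑ List.tabulate f
increasing-⊑ {zero}  f {[]} [] = []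
increasing-⊑ {suc n} f {[]} [] = minimum _
increasing-⊑ {suc n} f {zero ∷ τ} (q ∷ qs) with positive-is-suc q qs
... | τ′ , refl , qs′ = refl ∷ subst (_⊑ List.tabulate (f ∘ suc)) (Listₚ.map-∘ τ′) (increasing-⊑ (f ∘ suc) qs′)
increasing-⊑ {suc n} f {suc i ∷ τ} (q ∷ qs) with positive-is-suc (s≤s z≤n ∷ All.map (≤-<-trans z≤n) q) (q ∷ qs)
... | τ′ , eq , qs′ = f zero ∷ʳ subst (_⊑ List.tabulate (f ∘ suc))
  (trans (Listₚ.map-∘ τ′) (cong (List.map f) (sym eq))) (increasing-⊑ (f ∘ suc) qs′)

sorted-⊑word : (x : Perm n) {σ : List (Fin n)} → AllPairs (Precedes x) σ → σ ⊑ word x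
sorted-⊑word x {σ} s = subst (_⊑ word x) eq (increasing-⊑ (x ⟨$⟩ʳ_) (AllPairsₚ.map⁺ s))
  where
  eq : List.map (x ⟨$⟩ʳ_) (List.map (x ⟨$⟩ˡ_) σ) ≡ σ
  eq = trans (sym (Listₚ.map-∘ σ)) (trans (Listₚ.map-cong (λ _ → inverseʳ x) σ) (Listₚ.map-id σ))

AllPairs-map∈ : {A : Set} {Q R : A → A → Set} {σ : List A} → (∀ {u v} → u ∈ σ → v ∈ σ → Q u v → R u v) →
  AllPairs Q σ → AllPairs R σ
AllPairs-map∈ f [] = []
AllPairs-map∈ f (q ∷ qs) = All.tabulate (λ v∈ → f (here refl) (there v∈) (All.lookup q v∈)) ∷
  AllPairs-map∈ (λ u v → f (there u) (there v)) qs

-- The numbered tiling and its shuffles serve for `y` as they are: a shuffle is sorted by positions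
-- in `y` as well, and any such list is a subsequence of the word of `y`.
fiber-transfer : (x y : Perm n) {S : Layout n} → ρ x ≡ ρ y →
  (∀ {V u v} → Recorded (ρ x) V u → Recorded (ρ x) V v → Precedes x u v → Precedes y u v) → x γ↦ S → y γ↦ S
fiber-transfer x y ρ≡ order g = record
  { Numbered = N
  ; slides = subst (λ D → Star WallSlide D N) ρ≡ slides
  ; shuffles = subst Shuffles ρ≡ λ V W wV wW same → let σ , σ⊑ , mem , shuf = shuffles V W wV wW same in
      σ , sorted-⊑word y (AllPairs-map∈ (λ u∈ v∈ → order (to (mem _) u∈) (to (mem _) v∈)) (AllPairs-⊑ σ⊑ (word-sorted x))) , mem , shuf
  ; class = class
  }
  where
  open _γ↦_ g renaming (Numbered to N)
  Shuffles : Layout _ → Set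
  Shuffles D = ∀ V W → Wall D V → Wall N W → SameWall D V N W →
    ∃ λ σ → σ ⊑ word y × (∀ k → (k ∈ σ) ⇔ Recorded D V k) × IsWallShuffle N W σ

-- Swapping two labels

-- If e, a is a descent, this says that it has at least three clumps.
Alternating : (ℕ → ℕ → Set) → ℕ → ℕ → Set
Alternating _≺_ a e = ∃ λ b → ∃₂ λ c d → a < b × b < c × c < d × d < e ×
  ((Pre b × Post c × Pre d) ⊎ (Post b × Pre c × Post d))
  where
  Pre Post : ℕ → Set
  Pre v  = v ≺ a × v ≺ e
  Post v = a ≺ v × e ≺ v

module _ (_≺_ : ℕ → ℕ → Set) {a e : ℕ} where

  pre-between : Alternating _≺_ a e → ∃ λ z → a < z × z < e × z ≺ a × z ≺ e
  pre-between (b , c , d , a<b , b<c , c<d , d<e , inj₁ ((p , q) , _)) = b , a<b , <-trans b<c (<-trans c<d d<e) , p , q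
  pre-between (b , c , d , a<b , b<c , c<d , d<e , inj₂ (_ , (p , q) , _)) = c , <-trans a<b b<c , <-trans c<d d<e , p , q

  alternating-reverse : Alternating _≺_ a e → Alternating (_≺_ ᵒ) a e
  alternating-reverse (b , c , d , p , q , r , s , alt) = b , c , d , p , q , r , s , swap alt

module _ {_≺_ _≺′_ : ℕ → ℕ → Set} (o : StrictTotal _≺_) {s t z : ℕ}
  (imp : ∀ {u v} → u ≺ v → u ≺′ v ⊎ (u ≡ s × v ≡ t))
  (z≺s : z ≺ s) (z≺t : z ≺ t) where
  open StrictTotal o

  -- The changed comparison of `s` and `t` matters only to a run of later labels from one of them
  -- that reaches to the other. But such a run stops at `z`, which comes before both.
  lo-transfer : (s < z × z < t) ⊎ (t < z × z < s) → ∀ {k c} → IsLo _≺_ k c → IsLo _≺′_ k c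
  lo-transfer mid {k} {c} (isLo c≤k inn out) = isLo c≤k inner′ outer′
    where
    inner′ : ∀ {i} → c ≤ i → i < k → k ≺′ i
    inner′ p q with imp (inn p q)
    ... | inj₁ r = r
    ... | inj₂ (refl , refl) = [ (λ (l , r) → contradiction (<-trans l r) (<-asym q)) ,
        (λ (l , r) → contradiction (inn (≤-trans p (<⇒≤ l)) r) (≺-asym z≺s)) ]′ mid
    outer′ : ∀ {i} → suc i ≡ c → i ≺′ k
    outer′ eq with imp (out eq)
    ... | inj₁ r = r
    ... | inj₂ (refl , refl) = [ (λ (l , r) → contradiction (inn (subst (_≤ z) eq l) r) (≺-asym z≺t)) ,
        (λ (l , r) → contradiction (subst (_≤ k) (sym eq) c≤k) (<⇒≯ (<-trans l r))) ]′ mid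

  hi-transfer : (s < z × z < t) ⊎ (t < z × z < s) → ∀ {k d} → IsHi n _≺_ k d → IsHi n _≺′_ k d
  hi-transfer {n} mid {k} {d} (isHi k<d d≤n inn out) = isHi k<d d≤n inner′ outer′
    where
    inner′ : ∀ {i} → k < i → i < d → k ≺′ i
    inner′ p q with imp (inn p q)
    ... | inj₁ r = r
    ... | inj₂ (refl , refl) = [ (λ (l , r) → contradiction (inn l (<-trans r q)) (≺-asym z≺s)) ,
        (λ (l , r) → contradiction p (<-asym (<-trans l r))) ]′ mid
    outer′ : d < n → d ≺′ k
    outer′ p with imp (out p)
    ... | inj₁ r = r
    ... | inj₂ (refl , refl) = [ (λ (l , r) → contradiction k<d (<-asym (<-trans l r))) ,
        (λ (l , r) → contradiction (inn l r) (≺-asym z≺t)) ]′ mid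

-- On a common wall, the labels between a and e that come before both would be
-- separated from those that come after both by the label of the wall.
module _ {_≺_ : ℕ → ℕ → Set} (o : StrictTotal _≺_) (E : Extents n _≺_) {a e : ℕ} (a<n : a < n) (e<n : e < n)
  (a<e : a < e) where
  open StrictTotal o
  open Extents E

  private
    early : ∀ {z} → a < z → a ≺ z → R a ≤ z
    early a<z p = ≮⇒≥ λ q → ≺-asym p (IsHi.inner (isR a<n) a<z q)
    late : ∀ {z} → L e ≤ z → z < e → ¬ z ≺ e
    late q r p = ≺-asym p (IsLo.inner (isL e<n) q r)

  no-common-wall : Alternating _≺_ a e → (R a ≡ R e ⊎ L a ≡ L e) ⊎ (R a ≡ L e ⊎ L a ≡ R e) → ⊥
  no-common-wall alt (inj₁ (inj₁ eq)) = let z , a<z , z<e , a≺z , _ = pre-between (_≺_ ᵒ) (alternating-reverse _≺_ alt) in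
    ≺-asym a≺z (IsHi.inner (isR a<n) a<z (subst (z <_) (sym eq) (<-trans z<e (<R e<n))))
  no-common-wall alt (inj₁ (inj₂ eq)) = let z , a<z , z<e , _ , z≺e = pre-between _≺_ alt in
    ≺-asym z≺e (IsLo.inner (isL e<n) (≤-trans (≤-reflexive (sym eq)) (≤-trans (L≤ a<n) (<⇒≤ a<z))) z<e)
  no-common-wall alt (inj₂ (inj₂ eq)) = <-irrefl eq (≤-<-trans (L≤ a<n) (<-trans a<e (<R e<n)))
  no-common-wall (b , c , d , a<b , b<c , c<d , d<e , inj₁ (_ , (a≺c , _) , (_ , d≺e))) (inj₂ (inj₁ eq)) =
    late (≤-trans (≤-reflexive (sym eq)) (≤-trans (early (<-trans a<b b<c) a≺c) (<⇒≤ c<d))) d<e d≺e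
  no-common-wall (b , c , d , a<b , b<c , c<d , d<e , inj₂ ((a≺b , _) , (_ , c≺e) , _)) (inj₂ (inj₁ eq)) =
    late (≤-trans (≤-reflexive (sym eq)) (≤-trans (early a<b a≺b) (<⇒≤ b<c))) (<-trans c<d d<e) c≺e

module _ (x : Perm n) where
  private
    module D = DiagonalOf x
    b<t : ∀ k → bottom (tile (ρ x) k) ℚ.≤ top (tile (ρ x) k)
    b<t k = subst₂ ℚ._≤_ (sym (D.bottom≡ k)) (sym (D.top≡ k))
      (toℚ-mono-≤ (∸-monoʳ-≤ n (<⇒≤ (≤-<-trans (D.T≤ (toℕ<n k)) (D.<B (toℕ<n k))))))
    l<r : ∀ k → left (tile (ρ x) k) ℚ.≤ right (tile (ρ x) k)
    l<r k = subst₂ ℚ._≤_ (sym (D.left≡ k)) (sym (D.right≡ k))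
      (toℚ-mono-≤ (<⇒≤ (≤-<-trans (D.L≤ (toℕ<n k)) (D.<R (toℕ<n k)))))

    v-coordinate : ∀ {c a b k} → Recorded (ρ x) (vert c a b) k → toℚ (D.R (toℕ k)) ≡ c ⊎ toℚ (D.L (toℕ k)) ≡ c
    v-coordinate {k = k} (left/above , _ , _ , _ , _ , _ , e , _) = inj₁ (trans (sym (D.right≡ k)) (proj₁ (vert-⊆ (b<t k) e)))
    v-coordinate {k = k} (right/below , _ , _ , _ , _ , _ , e , _) = inj₂ (trans (sym (D.left≡ k)) (proj₁ (vert-⊆ (b<t k) e)))

    h-coordinate : ∀ {c a b k} → Recorded (ρ x) (horiz c a b) k → toℚ (n ∸ D.B (toℕ k)) ≡ c ⊎ toℚ (n ∸ D.T (toℕ k)) ≡ c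
    h-coordinate {k = k} (left/above , _ , _ , _ , _ , _ , e , _) = inj₁ (trans (sym (D.bottom≡ k)) (proj₁ (horiz-⊆ (l<r k) e)))
    h-coordinate {k = k} (right/below , _ , _ , _ , _ , _ , e , _) = inj₂ (trans (sym (D.top≡ k)) (proj₁ (horiz-⊆ (l<r k) e)))

  not-both-recorded : ∀ {V} {a e : Fin n} → a Fin.< e → Alternating (Before x) (toℕ a) (toℕ e) →
    Recorded (ρ x) V a → ¬ Recorded (ρ x) V e
  not-both-recorded {vert c _ _} {a} {e} a<e alt ra re =
      no-common-wall (before x) (extentsOf x) (toℕ<n a) (toℕ<n e) a<e alt (cases (v-coordinate ra) (v-coordinate re))
    where
    cases : _ → _ → _
    cases (inj₁ p) (inj₁ q) = inj₁ (inj₁ (toℚ-injective (trans p (sym q))))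
    cases (inj₂ p) (inj₂ q) = inj₁ (inj₂ (toℚ-injective (trans p (sym q))))
    cases (inj₁ p) (inj₂ q) = inj₂ (inj₁ (toℚ-injective (trans p (sym q))))
    cases (inj₂ p) (inj₁ q) = inj₂ (inj₂ (toℚ-injective (trans p (sym q))))
  not-both-recorded {horiz c _ _} {a} {e} a<e alt ra re =
      no-common-wall (reverse (before x)) (transposeᴱ (extentsOf x)) (toℕ<n a) (toℕ<n e) a<e
      (alternating-reverse (Before x) alt) (cases (h-coordinate ra) (h-coordinate re))
    where
    B≤ : ∀ k → D.B (toℕ k) ≤ n
    B≤ k = D.B≤ (toℕ<n k)
    T≤ : ∀ k → D.T (toℕ k) ≤ n
    T≤ k = ≤-trans (D.T≤ (toℕ<n k)) (<⇒≤ (toℕ<n k))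
    cases : _ → _ → _
    cases (inj₁ p) (inj₁ q) = inj₁ (inj₁ (∸-cancelˡ-≡ (B≤ a) (B≤ e) (toℚ-injective (trans p (sym q)))))
    cases (inj₂ p) (inj₂ q) = inj₁ (inj₂ (∸-cancelˡ-≡ (T≤ a) (T≤ e) (toℚ-injective (trans p (sym q)))))
    cases (inj₁ p) (inj₂ q) = inj₂ (inj₁ (∸-cancelˡ-≡ (B≤ a) (T≤ e) (toℚ-injective (trans p (sym q)))))
    cases (inj₂ p) (inj₁ q) = inj₂ (inj₂ (∸-cancelˡ-≡ (T≤ a) (B≤ e) (toℚ-injective (trans p (sym q)))))

-- No third label fits between two adjacent positions, so every comparison except that of `a` and
-- `e` survives; injectivity excludes the ties.
adjacent-swap : ∀ {f g : ℕ → ℕ} {a e p} → (∀ {u v} → f u ≡ f v → u ≡ v) → (∀ {u v} → g u ≡ g v → u ≡ v) →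
  f a ≡ p → f e ≡ suc p → g e ≡ p → g a ≡ suc p → (∀ v → v ≢ a → v ≢ e → f v ≡ g v) →
  ∀ {u v} → f u < f v → g u < g v ⊎ (u ≡ a × v ≡ e)
adjacent-swap {f} {g} {a} {e} {p} f-inj g-inj fa fe ge ga others {u} {v} lt with u ≟ a | u ≟ e | v ≟ a | v ≟ e
... | yes refl | _ | yes refl | _ = contradiction lt (<-irrefl refl)
... | yes refl | _ | no _ | yes refl = inj₂ (refl , refl)
... | yes refl | _ | no v≢a | no v≢e = inj₁ (≤∧≢⇒<
      (subst (_≤ g v) (sym (trans ga (cong suc (sym fa)))) (subst (f u <_) (others v v≢a v≢e) lt)) (λ eq → v≢a (sym (g-inj eq))))
... | no u≢a | yes refl | yes refl | _ = contradiction (subst₂ _<_ fe fa lt) (<-asym (n<1+n p))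
... | no u≢a | yes refl | no _ | yes refl = contradiction lt (<-irrefl refl)
... | no u≢a | yes refl | no v≢a | no v≢e = inj₁ (subst₂ _<_ (sym ge) (others v v≢a v≢e) (<-trans (n<1+n p) (subst (_< f v) fe lt)))
... | no u≢a | no u≢e | yes refl | _ = inj₁ (subst₂ _<_ (others u u≢a u≢e) (sym ga) (<-trans (subst (f u <_) fa lt) (n<1+n p)))
... | no u≢a | no u≢e | no _ | yes refl = inj₁ (subst₂ _<_ (others u u≢a u≢e) (sym ge)
      (≤∧≢⇒< (s≤s⁻¹ (subst (f u <_) fe lt)) (λ eq → u≢a (f-inj (trans eq (sym fa))))))
... | no u≢a | no u≢e | no v≢a | no v≢e = inj₁ (subst₂ _<_ (others u u≢a u≢e) (others v v≢a v≢e) lt)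

module _ (x y : Perm n) {s t : Fin n}
  (imp : ∀ {u v} → Before x u v → Before y u v ⊎ (u ≡ toℕ s × v ≡ toℕ t))
  where
  private
    Separated : Set
    Separated = (s Fin.< t × Alternating (Before x) (toℕ s) (toℕ t)) ⊎ (t Fin.< s × Alternating (Before x) (toℕ t) (toℕ s))

    Z : (ℕ → ℕ → Set) → Set
    Z _≺_ = ∃ λ z → z ≺ toℕ s × z ≺ toℕ t × ((toℕ s < z × z < toℕ t) ⊎ (toℕ t < z × z < toℕ s))

    pre : Separated → Z (Before x)
    pre (inj₁ (_ , al)) = let z , p , q , u , v = pre-between (Before x) al in z , u , v , inj₁ (p , q)
    pre (inj₂ (_ , al)) = let z , p , q , u , v = pre-between (Before x) al in z , v , u , inj₂ (p , q)

    post : Separated → Z (Before x ᵒ)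
    post (inj₁ (_ , al)) =
      let z , p , q , u , v = pre-between (Before x ᵒ) (alternating-reverse (Before x) al) in z , u , v , inj₁ (p , q)
    post (inj₂ (_ , al)) =
      let z , p , q , u , v = pre-between (Before x ᵒ) (alternating-reverse (Before x) al) in z , v , u , inj₂ (p , q)

    impᵒ : ∀ {u v} → (Before x ᵒ) u v → (Before y ᵒ) u v ⊎ (u ≡ toℕ t × v ≡ toℕ s)
    impᵒ lt with imp lt
    ... | inj₁ p = inj₁ p
    ... | inj₂ (p , q) = inj₂ (q , p)

    module X = Extents (extentsOf x)
    module Y = Extents (extentsOf y)

    extents-same : Separated → ∀ {k} → k < n → rectOf (extentsOf x) k ≡ rectOf (extentsOf y) k
    -- `L` and `B` end runs of later labels and need an early label between `s` and `t`; `R` and `T`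
    -- end runs of earlier labels and need a late one.
    extents-same alt {k} k<n = rect≡
        (lo-unique (before y) (lo-transfer (before x) imp z≺s z≺t mid (X.isL k<n)) (Y.isL k<n))
        (hi-unique (reverse (before y)) (hi-transfer (reverse (before x)) impᵒ t≺w s≺w (swap mid′) (X.isR k<n)) (Y.isR k<n))
        (cong (n ∸_) (hi-unique (before y) (hi-transfer (before x) imp z≺s z≺t mid (X.isB k<n)) (Y.isB k<n)))
        (cong (n ∸_) (lo-unique (reverse (before y)) (lo-transfer (reverse (before x)) impᵒ t≺w s≺w (swap mid′) (X.isT k<n)) (Y.isT k<n)))
      where
      z≺s = proj₁ (proj₂ (pre alt))
      z≺t = proj₁ (proj₂ (proj₂ (pre alt)))
      mid = proj₂ (proj₂ (proj₂ (pre alt)))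
      s≺w = proj₁ (proj₂ (post alt))
      t≺w = proj₁ (proj₂ (proj₂ (post alt)))
      mid′ = proj₂ (proj₂ (proj₂ (post alt)))

  swap-fiber : (s Fin.< t × Alternating (Before x) (toℕ s) (toℕ t)) ⊎ (t Fin.< s × Alternating (Before x) (toℕ t) (toℕ s)) →
    {S : Layout n} → x γ↦ S → y γ↦ S
  swap-fiber alt = fiber-transfer x y (ρ-cong x y (extents-same alt)) order
    where
    order : ∀ {V u v} → Recorded (ρ x) V u → Recorded (ρ x) V v → Precedes x u v → Precedes y u v
    order {V} {u} {v} ru rv p = [ precedes⇒ y {u} {v} ,
        (λ (eq , eq′) → ⊥-elim (clash (subst (Recorded (ρ x) V) (toℕ-injective eq) ru)
          (subst (Recorded (ρ x) V) (toℕ-injective eq′) rv))) ]′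
        (imp (precedes⇐ x {u} {v} p))
      where
      clash : Recorded (ρ x) V s → ¬ Recorded (ρ x) V t
      clash rs rt = [ (λ (lt , al) → not-both-recorded x {V} lt al rs rt) , (λ (lt , al) → not-both-recorded x {V} lt al rt rs) ]′ alt

-- Uniqueness of two-clumped permutations

-- The two-clumped condition in terms of ranks: `E` stands immediately before `A` in `z`.
DescentsTame : Perm n → Set
DescentsTame {n} z = ∀ {A E} → A < E → E < n → rank z A ≡ suc (rank z E) → ¬ Alternating (Before z) A E

module _ (z : Perm n) (tame : DescentsTame z) {A E : ℕ} (A<E : A < E) (E<n : E < n) (adj : rank z A ≡ suc (rank z E)) where
  open Extents (extentsOf z)
  private
    A<n = <-trans A<E E<n
    E≺A : Before z E A
    E≺A = ≤-reflexive (sym adj)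
    none-between : ∀ {v} → Before z E v → ¬ Before z v A
    none-between {v} p q = <⇒≱ p (s≤s⁻¹ (subst (rank z v <_) adj q))
    side : ∀ {v} → A < v → v < E → Before z v E ⊎ Before z A v
    side {v} A<v v<E with StrictTotal.≺-conn (before z) (<⇒≢ A<v) | StrictTotal.≺-conn (before z) (<⇒≢ v<E)
    ... | inj₁ p | _ = inj₂ p
    ... | inj₂ p | inj₁ q = inj₁ q
    ... | inj₂ p | inj₂ q = contradiction p (none-between q)
    alternates : ∀ {b c d} → A < b → b < c → c < d → d < E → Before z A b → Before z c E → Before z A d → ⊥
    alternates p q r s pb pc pd = tame A<E E<n adj (_ , _ , _ , p , q , r , s ,
      inj₂ ((pb , <-trans E≺A pb) , (<-trans pc E≺A , pc) , (pd , <-trans E≺A pd)))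
    alternates′ : ∀ {b c d} → A < b → b < c → c < d → d < E → Before z b E → Before z A c → Before z d E → ⊥
    alternates′ p q r s pb pc pd = tame A<E E<n adj (_ , _ , _ , p , q , r , s ,
      inj₁ ((<-trans pb E≺A , pb) , (pc , <-trans E≺A pc) , (<-trans pd E≺A , pd)))
    -- The least label above `A` that comes before `A`; it is at most `E`.
    m = B A
    A<m : A < m
    A<m = <B A<n
    m≤E : m ≤ E
    m≤E = ≮⇒≥ λ p → <-asym E≺A (IsHi.inner (isB A<n) A<E p)
    not-early : ∀ {i} → A ≤ i → i < m → ¬ Before z i E
    not-early p q r with m≤n⇒m<n∨m≡n p
    ... | inj₁ A<i = <-asym (<-trans r E≺A) (IsHi.inner (isB A<n) A<i q)
    ... | inj₂ refl = <-asym r E≺A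
    -- Otherwise `m - 1`, which is `A` or comes after `A`, would be in the run of labels before `E`.
    -- If the two ends agree, the wall is horizontal; if not, there is a late label `c` above the
    -- early label `m`.
    m≤T : m ≤ T E
    m≤T = ≮⇒≥ λ p → below p (predecessor (≤-<-trans z≤n p))
      where
      below : T E < m → (∃ λ i → m ≡ suc i) → ⊥
      below T<m (i , eq) = not-early (s≤s⁻¹ (subst (A <_) eq A<m)) (≤-reflexive (sym eq))
        (IsLo.inner (isT E<n) (s≤s⁻¹ (subst (T E <_) eq T<m)) (subst (_≤ E) eq m≤E))

  -- A and E are on opposite sides of a horizontal, or of a vertical wall.
  descent-wall : T E ≡ B A ⊎ R A ≡ L E
  descent-wall with T E ≤? m
  ... | yes T≤m = inj₁ (≤-antisym T≤m m≤T)
  ... | no T≰m = inj₂ (after (T E) refl (≰⇒> T≰m))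
    where
    after : ∀ t → T E ≡ t → m < t → R A ≡ L E
    after (suc c) eq (s≤s m≤c) = ≤-antisym K≤L L≤K
      where
      E≺c : Before z E c
      E≺c = IsLo.outer (isT E<n) (sym eq)
      c<E : c < E
      c<E = subst (_≤ E) eq (T≤ E<n)
      m<n = ≤-<-trans m≤E E<n
      m≺A : Before z m A
      m≺A = IsHi.outer (isB A<n) m<n
      m<E = ≤-<-trans m≤c c<E
      m≺E : Before z m E
      m≺E = [ id , (λ p → contradiction m≺A (<-asym p)) ]′ (side A<m m<E)
      m<c : m < c
      m<c = ≤∧≢⇒< m≤c λ { refl → <-asym m≺E E≺c }
      A<c = <-trans A<m m<c
      A≺c : Before z A c
      A≺c = [ (λ p → contradiction E≺c (<-asym p)) , id ]′ (side A<c c<E)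
      -- A label between `A` and `m` would be late and form an alternation with the early `m` and
      -- the late `c`.
      m≡ : m ≡ suc A
      m≡ with m≤n⇒m<n∨m≡n A<m
      ... | inj₂ e = sym e
      ... | inj₁ p = ⊥-elim (alternates (n<1+n A) p m<c c<E (IsHi.inner (isB A<n) (n<1+n A) p) m≺E A≺c)
      K = R A
      K≤c : K ≤ c
      K≤c = ≮⇒≥ λ p → <-asym A≺c (IsHi.inner (isR A<n) A<c p)
      K<E = ≤-<-trans K≤c c<E
      A≺K : Before z A K
      A≺K = IsHi.outer (isR A<n) (<-trans K<E E<n)
      m<K : m < K
      m<K = ≤∧≢⇒< (≤-trans (≤-reflexive m≡) (<R A<n)) λ e → <-asym A≺K (subst (λ k → Before z k A) e m≺A)
      -- `K` is the first late label above `A`, and `m` is an early one below it. An early label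
      -- above `K` would complete an alternation, so all labels from `K` up to `E` are late and form
      -- a run of `E`.
      L≤K : L E ≤ K
      L≤K = lo-least (before z) (isL E<n) (<⇒≤ K<E) λ {v} K≤v v<E →
        [ (λ v≺E → ⊥-elim (alternates′ A<m m<K
            (≤∧≢⇒< K≤v λ e → <-asym A≺K (subst (λ k → Before z k A) (sym e) (<-trans v≺E E≺A))) v<E m≺E A≺K v≺E)) ,
          <-trans E≺A ]′ (side (<-trans A<m (<-≤-trans m<K K≤v)) v<E)
      K≤L : K ≤ L E
      K≤L = ≮⇒≥ λ p → below K refl p
        where
        below : ∀ k → K ≡ k → L E < k → ⊥
        below (suc i) e (s≤s L≤i) = none-between
          (IsLo.inner (isL E<n) L≤i (<-trans (≤-reflexive (sym e)) K<E))
          (IsHi.inner (isR A<n) (<-≤-trans A<m (s≤s⁻¹ (subst (m <_) e m<K))) (≤-reflexive (sym e)))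

module _ (z y : Perm n) (tame : DescentsTame z) (same : SameData z y) where
  open SameData same
  private
    module Z = Extents (extentsOf z)
    module Y = Extents (extentsOf y)

    label-at : ∀ {p} → p < n → ∃ λ w → w < n × rank z w ≡ p
    label-at p<n = toℕ (z ⟨$⟩ʳ fromℕ< p<n) , toℕ<n _ , rank-word z p<n

    rank<n : ∀ {a} → a < n → rank z a < n
    rank<n {a} a<n with a <? n
    ... | yes p = toℕ<n _
    ... | no ¬p = contradiction a<n ¬p

    -- The runs of `A` and `E` are the same in `y`. If the wall is horizontal, they place `e` before
    -- `E` and `a` after `A` in `y`, and `h-order` places `E` before `A`. If it is vertical, then
    -- `a = A` or `e = E`, since otherwise `e < R A ≤ a`; the one that differs lies in a run of the
    -- other, and if both agree, `v-order` decides.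
    around-descent : ∀ {A a e E} → A ≤ a → a < e → e ≤ E → E < n → rank z A ≡ suc (rank z E) →
      rank z e ≤ rank z E → rank z A ≤ rank z a → Before y e a
    around-descent {A} {a} {e} {E} A≤a a<e e≤E E<n adj re ra with descent-wall z tame A<E E<n adj
      where A<E = ≤-<-trans A≤a (<-≤-trans a<e e≤E)
    ... | inj₁ T≡B′ = chain (m≤n⇒m<n∨m≡n A≤a) (m≤n⇒m<n∨m≡n e≤E)
      where
      A<n = ≤-<-trans A≤a (<-trans a<e (≤-<-trans e≤E E<n))
      E≺A : Before z E A
      E≺A = ≤-reflexive (sym adj)
      E≺yA : Before y E A
      E≺yA = h-order A<n E<n T≡B′ E≺A
      after : A < a → Before y A a
      after A<a = IsHi.inner (Y.isB A<n) A<a (subst (a <_) (B≡ A<n) (≰⇒> λ B≤a →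
        <-asym (<-≤-trans E≺A ra) (IsLo.inner (Z.isT E<n) (≤-trans (≤-reflexive T≡B′) B≤a) (<-≤-trans a<e e≤E))))
      early : e < E → Before y e E
      early e<E = IsLo.inner (Y.isT E<n) (subst (_≤ e) (T≡ E<n) (≮⇒≥ λ e<T →
        <-asym (≤-<-trans re E≺A) (IsHi.inner (Z.isB A<n) (≤-<-trans A≤a a<e) (subst (e <_) T≡B′ e<T)))) e<E
      chain : A < a ⊎ A ≡ a → e < E ⊎ e ≡ E → Before y e a
      chain (inj₁ p) (inj₁ q) = <-trans (early q) (<-trans E≺yA (after p))
      chain (inj₁ p) (inj₂ refl) = <-trans E≺yA (after p)
      chain (inj₂ refl) (inj₁ q) = <-trans (early q) E≺yA
      chain (inj₂ refl) (inj₂ refl) = E≺yA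
    ... | inj₂ R≡L′ = cases (m≤n⇒m<n∨m≡n A≤a) (m≤n⇒m<n∨m≡n e≤E)
      where
      A<n = ≤-<-trans A≤a (<-trans a<e (≤-<-trans e≤E E<n))
      E≺A : Before z E A
      E≺A = ≤-reflexive (sym adj)
      K≤a : A < a → Z.R A ≤ a
      K≤a A<a = ≮⇒≥ λ p → <⇒≱ (IsHi.inner (Z.isR A<n) A<a p) ra
      e<K : e < E → e < Z.R A
      e<K e<E = ≰⇒> λ K≤e → <⇒≱ (IsLo.inner (Z.isL E<n) (subst (_≤ e) R≡L′ K≤e) e<E) re
      cases : A < a ⊎ A ≡ a → e < E ⊎ e ≡ E → Before y e a
      cases (inj₂ refl) (inj₂ refl) = v-order A<n E<n R≡L′ E≺A
      cases (inj₁ p) (inj₂ refl) = IsLo.inner (Y.isL E<n) (subst (_≤ a) (trans R≡L′ (L≡ E<n)) (K≤a p)) a<e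
      cases (inj₂ refl) (inj₁ q) = IsHi.inner (Y.isR A<n) a<e (subst (e <_) (R≡ A<n) (e<K q))
      cases (inj₁ p) (inj₁ q) = contradiction (<-≤-trans (e<K q) (K≤a p)) (<-asym a<e)

    mutual
      -- `f` bounds the distance of the positions of `e` and `a` in `z`. An inversion either
      -- surrounds a descent from a label at least `e` to a label at most `a`, or splits into two
      -- inversions with closer positions.
      keeps : ∀ f {a e} → a < e → e < n → Before z e a → rank z a ≤ f + rank z e → Before y e a
      keeps f a<e e<n p le = walk f f a<e e<n ≤-refl e<n ≤-refl p le le

      -- Follow z from e towards a until it first drops to a label ≤ a.
      walk : ∀ f g {a e E} → a < e → e < n → e ≤ E → E < n → rank z e ≤ rank z E → Before z E a →
        rank z a ≤ f + rank z e → rank z a ≤ g + rank z E → Before y e a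
      walk f zero a<e e<n e≤E E<n re Ea lf lg = contradiction lg (<⇒≱ Ea)
      walk f (suc g) {a} {e} {E} a<e e<n e≤E E<n re Ea lf lg with label-at (≤-<-trans Ea (rank<n (<-trans a<e e<n)))
      ... | w , w<n , rw with w ≤? a
      ...   | yes w≤a = around-descent w≤a a<e e≤E E<n rw re (≤-trans (≤-reflexive rw) Ea)
      ...   | no w≰a with e ≤? w
      ...     | yes e≤w = walk f g a<e e<n e≤w w<n (≤-trans re (≤-trans (n≤1+n _) (≤-reflexive (sym rw)))) w≺a lf
                  (≤-trans lg (≤-reflexive (trans (sym (+-suc g _)) (cong (g +_) (sym rw)))))
        where
        w≺a : Before z w a
        w≺a = ≤∧≢⇒< (≤-trans (≤-reflexive rw) Ea) λ eq → w≰a (≤-reflexive (rank-injective z eq))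
      -- The label `w` lies strictly between `a` and `e` both in value and in position.
      ...     | no e≰w = split f lf
        where
        w≺a : Before z w a
        w≺a = ≤∧≢⇒< (≤-trans (≤-reflexive rw) Ea) λ eq → w≰a (≤-reflexive (rank-injective z eq))
        e≺w : Before z e w
        e≺w = ≤-<-trans re (≤-reflexive (sym rw))
        split : ∀ f → rank z a ≤ f + rank z e → Before y e a
        split zero lf = contradiction lf (<⇒≱ (≤-<-trans re Ea))
        split (suc f) lf = <-trans
          (keeps f (≰⇒> e≰w) e<n e≺w (s≤s⁻¹ (<-≤-trans w≺a lf)))
          (keeps f (≰⇒> w≰a) w<n w≺a (≤-trans lf (≤-trans (≤-reflexive (sym (+-suc f _))) (+-monoʳ-≤ f e≺w))))

  inversions-kept : ∀ {a e} → a < e → e < n → Before z e a → Before y e a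
  inversions-kept {a} {e} a<e e<n p = keeps (rank z a) a<e e<n p (m≤m+n _ _)

tame-unique : (x y : Perm n) → DescentsTame x → DescentsTame y → SameData x y → SameData y x → x ≈ y
tame-unique {n} x y tx ty same same′ i = trans (sym (inverseʳ y)) (cong (y ⟨$⟩ʳ_)
    (increasing⇒id (x ∘ₚ flip y) (increasing x y order) (increasing y x order′) i))
  where
  kept : ∀ x y → (∀ {a e} → a < e → e < n → Before x e a → Before y e a) →
    (∀ {a e} → a < e → e < n → Before y e a → Before x e a) →
    ∀ {u v} → u < n → v < n → Before x u v → Before y u v
  kept x y f g {u} {v} u<n v<n p with <-cmp u v
  ... | tri≈ _ refl _ = contradiction p (<-irrefl refl)
  ... | tri> _ _ v<u = f v<u u<n p
  ... | tri< u<v _ _ with StrictTotal.≺-conn (before y) (<⇒≢ u<v)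
  ...   | inj₁ q = q
  ...   | inj₂ q = contradiction p (<-asym (g u<v v<n q))
  f = inversions-kept x y tx same
  g = inversions-kept y x ty same′
  order = kept x y f g
  order′ = kept y x g f
  increasing : ∀ x y → (∀ {u v} → u < n → v < n → Before x u v → Before y u v) →
    ∀ {i j} → toℕ j ≡ suc (toℕ i) → (y ⟨$⟩ˡ (x ⟨$⟩ʳ i)) Fin.< (y ⟨$⟩ˡ (x ⟨$⟩ʳ j))
  increasing x y h {i} {j} eq = precedes⇒ y (h (toℕ<n _) (toℕ<n _) (precedes⇐ x
    (subst₂ Fin._<_ (sym (inverseˡ x)) (sym (inverseˡ x)) (≤-reflexive (sym eq)))))

-- Clumps and alternating labels

-- The condition that `ΓCover` puts on the swapped pair, separated from the cover itself.
Alternates : Perm n → Fin n → Fin n → Set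
Alternates {n} x i j = Σ (Fin n) λ b → Σ (Fin n) λ c → Σ (Fin n) λ d →
    (x ⟨$⟩ʳ j) Fin.< b × b Fin.< c × c Fin.< d × d Fin.< (x ⟨$⟩ʳ i)
  × (  (LeftOfPair  x i j b × LeftOfPair  x i j d × RightOfPair x i j c)
     ⊎ (RightOfPair x i j b × RightOfPair x i j d × LeftOfPair  x i j c))

module Pair (x : Perm n) (i j : Fin n) (adj : Adjacent i j) (desc : (x ⟨$⟩ʳ j) Fin.< (x ⟨$⟩ʳ i)) where

  private
    Lft Rgt : Fin n → Set
    Lft = LeftOfPair x i j
    Rgt = RightOfPair x i j

    Within : Fin n → Set
    Within v = (x ⟨$⟩ʳ j) Fin.< v × v Fin.< (x ⟨$⟩ʳ i)

    i<j : i Fin.< j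
    i<j = ≤-reflexive (sym adj)

    left-or-right : ∀ {v} → Within v → Lft v ⊎ Rgt v
    left-or-right {v} (p , q) with <-cmp (toℕ (x ⟨$⟩ˡ v)) (toℕ i)
    ... | tri< lt _ _ = inj₁ lt
    ... | tri≈ _ eq _ = contradiction (cong toℕ (trans (sym (inverseʳ x)) (cong (x ⟨$⟩ʳ_) (toℕ-injective eq)))) (<⇒≢ q)
    ... | tri> _ _ gt = inj₂ (≤∧≢⇒< (subst (_≤ toℕ (x ⟨$⟩ˡ v)) (sym adj) gt)
        λ eq → <⇒≢ p (cong toℕ (trans (cong (x ⟨$⟩ʳ_) (toℕ-injective eq)) (inverseʳ x))))

    not-both : ∀ {v} → Lft v → ¬ Rgt v
    not-both p q = <-asym p (<-trans i<j q)

  -- S is one side of the pair and S′ the other.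
  module OneSide (S S′ : Fin n → Set) (disjoint : ∀ {v} → S v → ¬ S′ v) (split : ∀ {v} → Within v → S v ⊎ S′ v)
    (run : ∀ {lo hi} → (x ⟨$⟩ʳ j) Fin.< lo → lo Fin.≤ hi → hi Fin.< (x ⟨$⟩ʳ i) →
      (∀ v → lo Fin.≤ v → v Fin.≤ hi → S v) → OneSidedRun x i j (lo , hi))
    (run⁻ : ∀ {lo hi} → OneSidedRun x i j (lo , hi) →
      (∀ v → lo Fin.≤ v → v Fin.≤ hi → S v) ⊎ (∀ v → lo Fin.≤ v → v Fin.≤ hi → S′ v))
    where

    -- A value of the other side inside the hull of the two clumps would be flanked by values of
    -- this side, one from each end of the hull. So the hull is a run, and both clumps, being
    -- maximal, are equal to it.
    clumps-equal : (∀ {b c d} → (x ⟨$⟩ʳ j) Fin.< b → b Fin.< c → c Fin.< d → d Fin.< (x ⟨$⟩ʳ i) → S b → S′ c → ¬ S d) →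
      ∀ {C C′} → Clump x i j C → Clump x i j C′ →
      (∀ v → proj₁ C Fin.≤ v → v Fin.≤ proj₂ C → S v) → (∀ v → proj₁ C′ Fin.≤ v → v Fin.≤ proj₂ C′ → S v) → C ≡ C′
    clumps-equal noalt {lo , hi} {lo′ , hi′} ((a<lo , lo≤hi , hi<e , _) , max) ((a<lo′ , lo′≤hi′ , hi′<e , _) , max′) all all′ =
      let u , u≤lo , u≤lo′ , a<u , Su = low
          v , hi≤v , hi′≤v , v<e , Sv = high
          hull = run a<u (≤-trans u≤lo (≤-trans lo≤hi hi≤v)) v<e (fill u v a<u v<e Su Sv)
          p , q = max _ _ hull u≤lo hi≤v
          p′ , q′ = max′ _ _ hull u≤lo′ hi′≤v
      in cong₂ _,_ (trans (sym p) p′) (trans (sym q) q′)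
      where
      low : ∃ λ u → u Fin.≤ lo × u Fin.≤ lo′ × (x ⟨$⟩ʳ j) Fin.< u × S u
      low with ≤-total (toℕ lo) (toℕ lo′)
      ... | inj₁ le = lo , ≤-refl , le , a<lo , all lo ≤-refl lo≤hi
      ... | inj₂ le = lo′ , le , ≤-refl , a<lo′ , all′ lo′ ≤-refl lo′≤hi′
      high : ∃ λ v → hi Fin.≤ v × hi′ Fin.≤ v × v Fin.< (x ⟨$⟩ʳ i) × S v
      high with ≤-total (toℕ hi) (toℕ hi′)
      ... | inj₁ le = hi′ , le , ≤-refl , hi′<e , all′ hi′ lo′≤hi′ ≤-refl
      ... | inj₂ le = hi , ≤-refl , le , hi<e , all hi lo≤hi ≤-refl
      fill : ∀ u v → (x ⟨$⟩ʳ j) Fin.< u → v Fin.< (x ⟨$⟩ʳ i) → S u → S v → ∀ w → u Fin.≤ w → w Fin.≤ v → S w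
      fill u v a<u v<e Su Sv w u≤w w≤v with split (<-≤-trans a<u u≤w , ≤-<-trans w≤v v<e)
      ... | inj₁ Sw = Sw
      ... | inj₂ S′w = contradiction Sv (noalt a<u
          (≤∧≢⇒< u≤w λ eq → disjoint Su (subst S′ (sym (toℕ-injective eq)) S′w))
          (≤∧≢⇒< w≤v λ eq → disjoint Sv (subst S′ (toℕ-injective eq) S′w)) v<e Su S′w)

    -- Grow from `b` in both directions while the values stay within the descent and on this side.
    -- The result is maximal among all runs because a run that contains `b` must be on the side of
    -- `b`.
    clump-around : (S? : ∀ v → Dec (S v)) → ∀ {b} → Within b → S b →
      ∃ λ C → Clump x i j C × proj₁ C Fin.≤ b × b Fin.≤ proj₂ C × (∀ v → proj₁ C Fin.≤ v → v Fin.≤ proj₂ C → S v)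
    clump-around S? {b} (a<b , b<e) Sb = result
      where
      Good : ℕ → Set
      Good k = ∃ λ v → toℕ v ≡ k × Within v × S v
      good? : ∀ k → Dec (Good k)
      good? k = Finₚ.any? λ v → (toℕ v ≟ k) ×-dec ((toℕ (x ⟨$⟩ʳ j) <? toℕ v) ×-dec (toℕ v <? toℕ (x ⟨$⟩ʳ i))) ×-dec S? v
      good-b : Good (toℕ b)
      good-b = b , refl , (a<b , b<e) , Sb
      good : ∀ {v} → Good (toℕ v) → Within v × S v
      good (v , eq , w) with toℕ-injective eq
      ... | refl = w
      down = runDown good? (toℕ b)
      up = runUp good? (suc (toℕ b)) n
      l = proj₁ down
      l≤b = proj₁ (proj₂ down)
      downAll = proj₁ (proj₂ (proj₂ down))
      downMax = proj₂ (proj₂ (proj₂ down))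
      result : _
      result with up
      ... | suc h , s≤s b≤h , _ , upAll , upMax = (lo , hi) , (lohi , maximal) , lo≤b , b≤hi , λ v p q → proj₂ (inside v p q)
        where
        all : ∀ k → l ≤ k → k ≤ h → Good k
        all k p q with <-cmp k (toℕ b)
        ... | tri< lt _ _ = downAll p lt
        ... | tri≈ _ refl _ = good-b
        ... | tri> _ _ gt = upAll gt (s≤s q)
        l<n : l < n
        l<n = ≤-<-trans l≤b (toℕ<n b)
        h<n : h < n
        h<n = let v , eq , _ = all h (≤-trans l≤b b≤h) ≤-refl in subst (_< n) eq (toℕ<n v)
        lo = fromℕ< l<n
        hi = fromℕ< h<n
        lo≡ = toℕ-fromℕ< l<n
        hi≡ = toℕ-fromℕ< h<n
        lo≤b : toℕ lo ≤ toℕ b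
        lo≤b = ≤-trans (≤-reflexive lo≡) l≤b
        b≤hi : toℕ b ≤ toℕ hi
        b≤hi = ≤-trans b≤h (≤-reflexive (sym hi≡))
        inside : ∀ v → lo Fin.≤ v → v Fin.≤ hi → Within v × S v
        inside v p q = good (all (toℕ v) (subst (_≤ toℕ v) lo≡ p) (subst (toℕ v ≤_) hi≡ q))
        lo≤hi = ≤-trans lo≤b b≤hi
        lohi : OneSidedRun x i j (lo , hi)
        lohi = run (proj₁ (proj₁ (inside lo ≤-refl lo≤hi))) lo≤hi (proj₂ (proj₁ (inside hi lo≤hi ≤-refl))) λ v p q → proj₂ (inside v p q)
        maximal : ∀ lo′ hi′ → OneSidedRun x i j (lo′ , hi′) → lo′ Fin.≤ lo → hi Fin.≤ hi′ → lo′ ≡ lo × hi′ ≡ hi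
        maximal lo′ hi′ r@(a<lo′ , _ , hi′<e , _) lo′≤lo hi≤hi′ with run⁻ r
        ... | inj₂ all′ = contradiction (all′ b (≤-trans lo′≤lo lo≤b) (≤-trans b≤hi hi≤hi′)) (disjoint Sb)
        ... | inj₁ all′ = toℕ-injective (≤-antisym lo′≤lo (≮⇒≥ λ p → lower l refl (subst (toℕ lo′ <_) lo≡ p))) ,
            toℕ-injective (≤-antisym (≮⇒≥ λ p → upper (subst (_< toℕ hi′) hi≡ p)) hi≤hi′)
          where
          within′ : ∀ {k} → toℕ lo′ ≤ k → k ≤ toℕ hi′ → Good k
          within′ {k} p q = v , eq , (<-≤-trans a<lo′ p′ , ≤-<-trans q′ hi′<e) , all′ v p′ q′
            where
            v = fromℕ< (≤-<-trans q (toℕ<n hi′))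
            eq = toℕ-fromℕ< (≤-<-trans q (toℕ<n hi′))
            p′ = ≤-trans p (≤-reflexive (sym eq))
            q′ = ≤-trans (≤-reflexive eq) q
          lower : ∀ m → l ≡ m → ¬ toℕ lo′ < m
          lower (suc k) eq p = downMax (sym eq) (within′ (s≤s⁻¹ p)
            (≤-trans (<⇒≤ (subst (_≤ toℕ b) eq l≤b)) (≤-trans b≤hi hi≤hi′)))
          upper : ¬ h < toℕ hi′
          upper p = upMax (≤-<-trans p (<-≤-trans (toℕ<n hi′) (m≤n⇒m≤1+n (m≤n+m n (toℕ b)))))
            (within′ (≤-trans lo′≤lo (≤-trans lo≤b (≤-trans b≤h (n≤1+n h)))) p)

  module Lefts = OneSide Lft Rgt not-both left-or-right (λ p q r s → p , q , r , inj₁ s) (λ (_ , _ , _ , s) → s)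
  module Rights = OneSide Rgt Lft (λ p q → not-both q p) (swap ∘ left-or-right)
    (λ p q r s → p , q , r , inj₂ s) (λ (_ , _ , _ , s) → swap s)

  few-clumps : ¬ Alternates x i j → ∀ C₁ C₂ C₃ → Clump x i j C₁ → Clump x i j C₂ → Clump x i j C₃ → C₁ ≡ C₂ ⊎ C₁ ≡ C₃ ⊎ C₂ ≡ C₃
  few-clumps noalt C₁ C₂ C₃ c₁@((_ , _ , _ , s₁) , _) c₂@((_ , _ , _ , s₂) , _) c₃@((_ , _ , _ , s₃) , _) = pigeonhole s₁ s₂ s₃
    where
    L= : ∀ {C C′} → Clump x i j C → Clump x i j C′ → _ → _ → C ≡ C′
    L= = Lefts.clumps-equal λ {b} {c} {d} p q r s u v w → noalt (b , c , d , p , q , r , s , inj₁ (u , w , v))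
    R= : ∀ {C C′} → Clump x i j C → Clump x i j C′ → _ → _ → C ≡ C′
    R= = Rights.clumps-equal λ {b} {c} {d} p q r s u v w → noalt (b , c , d , p , q , r , s , inj₂ (u , w , v))
    pigeonhole : _ → _ → _ → _
    pigeonhole (inj₁ p) (inj₁ q) _ = inj₁ (L= c₁ c₂ p q)
    pigeonhole (inj₂ p) (inj₂ q) _ = inj₁ (R= c₁ c₂ p q)
    pigeonhole (inj₁ p) (inj₂ q) (inj₁ r) = inj₂ (inj₁ (L= c₁ c₃ p r))
    pigeonhole (inj₁ p) (inj₂ q) (inj₂ r) = inj₂ (inj₂ (R= c₂ c₃ q r))
    pigeonhole (inj₂ p) (inj₁ q) (inj₁ r) = inj₂ (inj₂ (L= c₂ c₃ q r))
    pigeonhole (inj₂ p) (inj₁ q) (inj₂ r) = inj₂ (inj₁ (R= c₁ c₃ p r))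

  -- The clumps around `b`, `c` and `d` are distinct: `c` is on the other side, and it separates `b`
  -- from `d`.
  few-clumps⁻ : (∀ C₁ C₂ C₃ → Clump x i j C₁ → Clump x i j C₂ → Clump x i j C₃ → C₁ ≡ C₂ ⊎ C₁ ≡ C₃ ⊎ C₂ ≡ C₃) → ¬ Alternates x i j
  few-clumps⁻ few (b , c , d , a<b , b<c , c<d , d<e , alt) = three alt
    where
    b<e = <-trans b<c (<-trans c<d d<e)
    c<e = <-trans c<d d<e
    a<c = <-trans a<b b<c
    a<d = <-trans a<c c<d
    left? : ∀ v → Dec (Lft v)
    left? v = toℕ (x ⟨$⟩ˡ v) <? toℕ i
    right? : ∀ v → Dec (Rgt v)
    right? v = toℕ j <? toℕ (x ⟨$⟩ˡ v)
    clash : {S S′ : Fin n → Set} → (∀ {v} → S v → ¬ S′ v) → S′ c → S d →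
      (∃ λ C → Clump x i j C × proj₁ C Fin.≤ b × b Fin.≤ proj₂ C × (∀ v → proj₁ C Fin.≤ v → v Fin.≤ proj₂ C → S v)) →
      (∃ λ C → Clump x i j C × proj₁ C Fin.≤ c × c Fin.≤ proj₂ C × (∀ v → proj₁ C Fin.≤ v → v Fin.≤ proj₂ C → S′ v)) →
      (∃ λ C → Clump x i j C × proj₁ C Fin.≤ d × d Fin.≤ proj₂ C × (∀ v → proj₁ C Fin.≤ v → v Fin.≤ proj₂ C → S v)) → ⊥
    clash dis S′c Sd (C₁ , k₁ , l₁ , u₁ , a₁) (C₂ , k₂ , l₂ , u₂ , a₂) (C₃ , k₃ , l₃ , u₃ , a₃) with few C₁ C₂ C₃ k₁ k₂ k₃
    ... | inj₁ refl = dis (a₁ c l₂ u₂) S′c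
    ... | inj₂ (inj₁ refl) = dis (a₁ c (≤-trans l₁ (<⇒≤ b<c)) (≤-trans (<⇒≤ c<d) u₃)) S′c
    ... | inj₂ (inj₂ refl) = dis Sd (a₂ d l₃ u₃)
    three : _ → ⊥
    three (inj₁ (p , q , r)) = clash not-both r q (Lefts.clump-around left? (a<b , b<e) p)
      (Rights.clump-around right? (a<c , c<e) r) (Lefts.clump-around left? (a<d , d<e) q)
    three (inj₂ (p , q , r)) = clash (λ p q → not-both q p) r q (Rights.clump-around right? (a<b , b<e) p)
      (Lefts.clump-around left? (a<c , c<e) r) (Rights.clump-around right? (a<d , d<e) q)

twoClumped⇒tame : {x : Perm n} → TwoClumped x → DescentsTame x
twoClumped⇒tame {n} {x} two {A} {E} A<E E<n adj (b , c , d , A<b , b<c , c<d , d<E , alt) =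
  Pair.few-clumps⁻ x i j adj′ desc (two i j adj′ desc) (fin b<n , fin c<n , fin d<n ,
    subst₂ _<_ (sym xj) (sym (fin≡ b<n)) A<b , subst₂ _<_ (sym (fin≡ b<n)) (sym (fin≡ c<n)) b<c ,
    subst₂ _<_ (sym (fin≡ c<n)) (sym (fin≡ d<n)) c<d , subst₂ _<_ (sym (fin≡ d<n)) (sym xi) d<E , sides alt)
  where
  A<n = <-trans A<E E<n
  d<n = <-trans d<E E<n
  c<n = <-trans c<d d<n
  b<n = <-trans b<c c<n
  fin : ∀ {v} → v < n → Fin n
  fin p = fromℕ< p
  fin≡ : ∀ {v} (p : v < n) → toℕ (fin p) ≡ v
  fin≡ p = toℕ-fromℕ< p
  rank≡ : ∀ {v} (p : v < n) → toℕ (x ⟨$⟩ˡ fin p) ≡ rank x v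
  rank≡ p = trans (sym (rank-toℕ x (fin p))) (cong (rank x) (fin≡ p))
  i = x ⟨$⟩ˡ fin E<n
  j = x ⟨$⟩ˡ fin A<n
  xi : toℕ (x ⟨$⟩ʳ i) ≡ E
  xi = trans (cong toℕ (inverseʳ x)) (fin≡ E<n)
  xj : toℕ (x ⟨$⟩ʳ j) ≡ A
  xj = trans (cong toℕ (inverseʳ x)) (fin≡ A<n)
  adj′ : Adjacent i j
  adj′ = trans (rank≡ A<n) (trans adj (cong suc (sym (rank≡ E<n))))
  desc : (x ⟨$⟩ʳ j) Fin.< (x ⟨$⟩ʳ i)
  desc = subst₂ _<_ (sym xj) (sym xi) A<E
  lft : ∀ {v} (p : v < n) → Before x v E → LeftOfPair x i j (fin p)
  lft p q = subst₂ _<_ (sym (rank≡ p)) (sym (rank≡ E<n)) q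
  rgt : ∀ {v} (p : v < n) → Before x A v → RightOfPair x i j (fin p)
  rgt p q = subst₂ _<_ (sym (rank≡ A<n)) (sym (rank≡ p)) q
  sides : _ → _
  sides (inj₁ ((_ , p) , (q , _) , (_ , r))) = inj₁ (lft b<n p , lft d<n r , rgt c<n q)
  sides (inj₂ ((p , _) , (_ , q) , (r , _))) = inj₂ (rgt b<n p , rgt d<n r , lft c<n q)

-- Descending to a two-clumped permutation

adjacent? : (i j : Fin n) → Dec (Adjacent i j)
adjacent? i j = toℕ j ≟ suc (toℕ i)

alternates? : (x : Perm n) (i j : Fin n) → Dec (Alternates x i j)
alternates? x i j = Finₚ.any? λ b → Finₚ.any? λ c → Finₚ.any? λ d →
  (_ <? _) ×-dec (_ <? _) ×-dec (_ <? _) ×-dec (_ <? _) ×-dec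
  (((_ <? _) ×-dec (_ <? _) ×-dec (_ <? _)) ⊎-dec ((_ <? _) ×-dec (_ <? _) ×-dec (_ <? _)))

-- Each value counts as often as there are positions after it. Sorting an adjacent descent lowers
-- this sum by the difference of the two entries, which makes descending along Γ terminate.
weight : (Fin n → ℕ) → ℕ
weight {zero}  f = 0
weight {suc n} f = f zero * n + weight (f ∘ suc)

weight-cong : (f g : Fin n → ℕ) → (∀ h → f h ≡ g h) → weight f ≡ weight g
weight-cong {zero}  f g e = refl
weight-cong {suc n} f g e = cong₂ (λ u v → u * n + v) (e zero) (weight-cong (f ∘ suc) (g ∘ suc) (e ∘ suc))

weight-sorted : (f g : Fin n → ℕ) (i j : Fin n) → Adjacent i j → f i ≡ g j → f j ≡ g i →
  (∀ h → h ≢ i → h ≢ j → f h ≡ g h) → g j < g i → weight f < weight g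
weight-sorted f g (suc i) (suc j) adj p q others lt = subst (λ u → u * _ + weight (f ∘ suc) < weight g)
  (sym (others zero (λ ()) (λ ()))) (+-monoʳ-< (g zero * _) (weight-sorted (f ∘ suc) (g ∘ suc) i j (suc-injective adj) p q
    (λ h h≢i h≢j → others (suc h) (h≢i ∘ Finₚ.suc-injective) (h≢j ∘ Finₚ.suc-injective)) lt))
weight-sorted {suc (suc m)} f g zero (suc zero) adj p q others lt = begin-strict
  f zero * suc m + (f (suc zero) * m + weight f′) ≡⟨ cong₂ _+_ (cong (_* suc m) p) (cong₂ _+_ (cong (_* m) q) (weight-cong f′ g′ same)) ⟩
  α * suc m + (β * m + w)                         ≡⟨ cong (_+ (β * m + w)) (*-suc α m) ⟩
  α + α * m + (β * m + w)                         ≡⟨ +-assoc α (α * m) (β * m + w) ⟩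
  α + (α * m + (β * m + w))                       ≡⟨ cong (α +_) (sym (+-assoc (α * m) (β * m) w)) ⟩
  α + (α * m + β * m + w)                         ≡⟨ cong (λ s → α + (s + w)) (+-comm (α * m) (β * m)) ⟩
  α + (β * m + α * m + w)                         <⟨ +-monoˡ-< (β * m + α * m + w) lt ⟩
  β + (β * m + α * m + w)                         ≡⟨ cong (β +_) (+-assoc (β * m) (α * m) w) ⟩
  β + (β * m + (α * m + w))                       ≡⟨ sym (+-assoc β (β * m) (α * m + w)) ⟩
  β + β * m + (α * m + w)                         ≡⟨ cong (_+ (α * m + w)) (sym (*-suc β m)) ⟩
  β * suc m + (α * m + w)                         ∎
  where
  open ≤-Reasoning
  α = g (suc zero)
  β = g zero
  f′ g′ : Fin m → ℕ
  f′ h = f (suc (suc h))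
  g′ h = g (suc (suc h))
  w = weight g′
  same : ∀ h → f′ h ≡ g′ h
  same h = others (suc (suc h)) (λ ()) (λ ())

module _ (i j : Fin n) where

  transpose-first : PC.transpose i j i ≡ j
  transpose-first with i Fin.≟ i
  ... | yes _ = refl
  ... | no i≢i = contradiction refl i≢i

  transpose-second : PC.transpose i j j ≡ i
  transpose-second with j Fin.≟ i
  ... | yes j≡i = j≡i
  ... | no _ with j Fin.≟ j
  ...   | yes _ = refl
  ...   | no j≢j = contradiction refl j≢j

  transpose-other : ∀ {h} → h ≢ i → h ≢ j → PC.transpose i j h ≡ h
  transpose-other {h} h≢i h≢j with h Fin.≟ i
  ... | yes h≡i = contradiction h≡i h≢i
  ... | no _ with h Fin.≟ j
  ...   | yes h≡j = contradiction h≡j h≢j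
  ...   | no _ = refl

ΓReducible : Perm n → Set
ΓReducible x = ∃₂ λ i j → Adjacent i j × (x ⟨$⟩ʳ j) Fin.< (x ⟨$⟩ʳ i) × Alternates x i j

Γreducible? : (x : Perm n) → Dec (ΓReducible x)
Γreducible? x = Finₚ.any? λ i → Finₚ.any? λ j → adjacent? i j ×-dec (_ <? _) ×-dec alternates? x i j

permWeight : Perm n → ℕ
permWeight x = weight λ i → toℕ (x ⟨$⟩ʳ i)

reduce : (y : Perm n) → ΓReducible y → ∃ λ x → ΓCover x y × permWeight x < permWeight y
reduce y (i , j , adj , desc , alt) = x , (i , j , (adj , at-i , desc , sym at-j , at-other) , alt) ,
    weight-sorted _ _ i j adj (cong toℕ at-i) (cong toℕ at-j) (λ h p q → cong toℕ (at-other h p q)) desc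
  where
  x = transpose i j ∘ₚ y
  at-i : x ⟨$⟩ʳ i ≡ y ⟨$⟩ʳ j
  at-i = cong (y ⟨$⟩ʳ_) (transpose-first i j)
  at-j : x ⟨$⟩ʳ j ≡ y ⟨$⟩ʳ i
  at-j = cong (y ⟨$⟩ʳ_) (transpose-second i j)
  at-other : ∀ h → h ≢ i → h ≢ j → x ⟨$⟩ʳ h ≡ y ⟨$⟩ʳ h
  at-other h p q = cong (y ⟨$⟩ʳ_) (transpose-other i j p q)

irreducible⇒twoClumped : (x : Perm n) → ¬ ΓReducible x → TwoClumped x
irreducible⇒twoClumped x irr i j adj desc = Pair.few-clumps x i j adj desc λ alt → irr (i , j , adj , desc , alt)

-- Fibers are unions of congruence classes

⟨$⟩ˡ-of : (x : Perm n) {i v : Fin n} → x ⟨$⟩ʳ i ≡ v → x ⟨$⟩ˡ v ≡ i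
⟨$⟩ˡ-of x refl = inverseˡ x

module Cover (x y : Perm n) {i j : Fin n} (adj : Adjacent i j) (at-i : x ⟨$⟩ʳ i ≡ y ⟨$⟩ʳ j)
  (desc : (y ⟨$⟩ʳ j) Fin.< (y ⟨$⟩ʳ i)) (at-j : y ⟨$⟩ʳ i ≡ x ⟨$⟩ʳ j)
  (at-other : ∀ h → h ≢ i → h ≢ j → x ⟨$⟩ʳ h ≡ y ⟨$⟩ʳ h) (alt : Alternates y i j) where
  private
    a = y ⟨$⟩ʳ j
    e = y ⟨$⟩ʳ i
    p = toℕ i

    rank-at : (w : Perm n) {h v : Fin n} → w ⟨$⟩ʳ h ≡ v → rank w (toℕ v) ≡ toℕ h
    rank-at w eq = trans (rank-toℕ w _) (cong toℕ (⟨$⟩ˡ-of w eq))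

    xa : rank x (toℕ a) ≡ p
    xa = rank-at x at-i
    xe : rank x (toℕ e) ≡ suc p
    xe = trans (rank-at x (sym at-j)) adj
    ye : rank y (toℕ e) ≡ p
    ye = rank-at y refl
    ya : rank y (toℕ a) ≡ suc p
    ya = trans (rank-at y refl) adj

    otherᶠ : ∀ v → v ≢ a → v ≢ e → rank x (toℕ v) ≡ rank y (toℕ v)
    otherᶠ v v≢a v≢e = trans (rank-at x (trans (at-other h h≢i h≢j) (inverseʳ y))) (sym (rank-toℕ y v))
      where
      h = y ⟨$⟩ˡ v
      h≢i : h ≢ i
      h≢i eq = v≢e (trans (sym (inverseʳ y)) (cong (y ⟨$⟩ʳ_) eq))
      h≢j : h ≢ j
      h≢j eq = v≢a (trans (sym (inverseʳ y)) (cong (y ⟨$⟩ʳ_) eq))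

    other : ∀ v → v ≢ toℕ a → v ≢ toℕ e → rank x v ≡ rank y v
    other v v≢a v≢e = cases (v <? n)
      where
      cases : Dec (v < n) → rank x v ≡ rank y v
      cases (no v≮n) = trans (rank-beyond x v≮n) (sym (rank-beyond y v≮n))
      cases (yes v<n) = subst (λ u → rank x u ≡ rank y u) eq
          (otherᶠ (fromℕ< v<n) (λ e → v≢a (trans (sym eq) (cong toℕ e))) (λ e → v≢e (trans (sym eq) (cong toℕ e))))
        where eq = toℕ-fromℕ< v<n

    -- The labels strictly between `a` and `e` do not move, so the alternation holds in both
    -- permutations of the cover; `w` will be `y` for the way down and `x` for the way up.
    alternating : Alternates y i j → ∀ (w : Perm n) → (∀ {v} → a Fin.< v → v Fin.< e → w ⟨$⟩ˡ v ≡ y ⟨$⟩ˡ v) →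
      (∀ {q} → q < p → q < rank w (toℕ a) × q < rank w (toℕ e)) →
      (∀ {q} → suc p < q → rank w (toℕ a) < q × rank w (toℕ e) < q) → Alternating (Before w) (toℕ a) (toℕ e)
    alternating (b , c , d , a<b , b<c , c<d , d<e , sides) w same low high =
      toℕ b , toℕ c , toℕ d , a<b , b<c , c<d , d<e , conv sides
      where
      lft : ∀ {v} → a Fin.< v → v Fin.< e → LeftOfPair y i j v → Before w (toℕ v) (toℕ a) × Before w (toℕ v) (toℕ e)
      lft {v} r s q = low (subst (_< p) (sym (trans (rank-toℕ w v) (cong toℕ (same r s)))) q)
      rgt : ∀ {v} → a Fin.< v → v Fin.< e → RightOfPair y i j v → Before w (toℕ a) (toℕ v) × Before w (toℕ e) (toℕ v)
      rgt {v} r s q = high (subst₂ _<_ adj (sym (trans (rank-toℕ w v) (cong toℕ (same r s)))) q)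
      c<e = <-trans c<d d<e
      b<e = <-trans b<c c<e
      a<c = <-trans a<b b<c
      a<d = <-trans a<c c<d
      conv : _ → _
      conv (inj₁ (q , r , s)) = inj₁ (lft a<b b<e q , rgt a<c c<e s , lft a<d d<e r)
      conv (inj₂ (q , r , s)) = inj₂ (rgt a<b b<e q , lft a<c c<e s , rgt a<d d<e r)

    same-x : ∀ {v} → a Fin.< v → v Fin.< e → x ⟨$⟩ˡ v ≡ y ⟨$⟩ˡ v
    same-x {v} a<v v<e = toℕ-injective (trans (sym (rank-toℕ x v))
      (trans (otherᶠ v (λ { refl → <-irrefl refl a<v }) (λ { refl → <-irrefl refl v<e })) (rank-toℕ y v)))

    below : ∀ {q r} → r ≡ p ⊎ r ≡ suc p → q < p → q < r
    below (inj₁ refl) lt = lt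
    below (inj₂ refl) lt = m≤n⇒m≤1+n lt
    beyond : ∀ {q r} → r ≡ p ⊎ r ≡ suc p → suc p < q → r < q
    beyond (inj₁ refl) lt = <-trans (n<1+n _) lt
    beyond (inj₂ refl) lt = lt

  down : {S : Layout n} → y γ↦ S → x γ↦ S
  down = swap-fiber y x {e} {a}
    (adjacent-swap {rank y} {rank x} (rank-injective y) (rank-injective x) ye ya xa xe (λ v q r → sym (other v r q)))
    (inj₂ (desc , alternating alt y (λ _ _ → refl)
      (λ q → below (inj₂ ya) q , below (inj₁ ye) q) (λ q → beyond (inj₂ ya) q , beyond (inj₁ ye) q)))

  up : {S : Layout n} → x γ↦ S → y γ↦ S
  up = swap-fiber x y {a} {e}
    (adjacent-swap {rank x} {rank y} (rank-injective x) (rank-injective y) xa xe ye ya other)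
    (inj₁ (desc , alternating alt x same-x
      (λ q → below (inj₁ xa) q , below (inj₂ xe) q) (λ q → beyond (inj₁ xa) q , beyond (inj₂ xe) q)))

≈-fiber : (x y : Perm n) → x ≈ y → {S : Layout n} → x γ↦ S → y γ↦ S
≈-fiber {n} x y x≈y = fiber-transfer x y (ρ-cong x y extents-same) λ {_} {u} {v} _ _ → subst₂ Fin._<_ (positions u) (positions v)
  where
  positions : ∀ v → x ⟨$⟩ˡ v ≡ y ⟨$⟩ˡ v
  positions v = sym (⟨$⟩ˡ-of y (trans (sym (x≈y _)) (inverseʳ x)))
  rank≡ : ∀ v → rank x v ≡ rank y v
  rank≡ v with v <? n
  ... | yes p = cong toℕ (positions (fromℕ< p))
  ... | no _ = refl
  imp : ∀ {u v} → Before x u v → Before y u v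
  imp = subst₂ _<_ (rank≡ _) (rank≡ _)
  module X = Extents (extentsOf x)
  module Y = Extents (extentsOf y)
  lo-map : ∀ {R R′ : ℕ → ℕ → Set} → (∀ {u v} → R u v → R′ u v) → ∀ {k c} → IsLo R k c → IsLo R′ k c
  lo-map f (isLo p inn out) = isLo p (λ q r → f (inn q r)) (λ e → f (out e))
  hi-map : ∀ {R R′ : ℕ → ℕ → Set} → (∀ {u v} → R u v → R′ u v) → ∀ {k d} → IsHi n R k d → IsHi n R′ k d
  hi-map f (isHi p q inn out) = isHi p q (λ q r → f (inn q r)) (λ e → f (out e))
  extents-same : ∀ {k} → k < n → rectOf (extentsOf x) k ≡ rectOf (extentsOf y) k
  extents-same k<n = rect≡
    (lo-unique (before y) (lo-map imp (X.isL k<n)) (Y.isL k<n))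
    (hi-unique (reverse (before y)) (hi-map imp (X.isR k<n)) (Y.isR k<n))
    (cong (n ∸_) (hi-unique (before y) (hi-map imp (X.isB k<n)) (Y.isB k<n)))
    (cong (n ∸_) (lo-unique (reverse (before y)) (lo-map imp (X.isT k<n)) (Y.isT k<n)))

Γ-fiber : {S : Layout n} {x y : Perm n} → x ≡Γ y → x γ↦ S → y γ↦ S
Γ-fiber ε g = g
Γ-fiber {x = x} (fwd (inj₁ e) ◅ s) g = Γ-fiber s (≈-fiber x _ e g)
Γ-fiber {x = x} (bwd (inj₁ e) ◅ s) g = Γ-fiber s (≈-fiber x _ (λ h → sym (e h)) g)
Γ-fiber {x = x} (fwd (inj₂ (_ , _ , (adj , p , q , r , t) , alt)) ◅ s) g = Γ-fiber s (Cover.up x _ adj p q r t alt g)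
Γ-fiber {x = x} (bwd (inj₂ (_ , _ , (adj , p , q , r , t) , alt)) ◅ s) g = Γ-fiber s (Cover.down _ x adj p q r t alt g)

descend : (y : Perm n) → Acc _<_ (permWeight y) → ∃ λ z → TwoClumped z × y ≡Γ z
descend y (acc rec) with Γreducible? y
... | no irr = y , irreducible⇒twoClumped y irr , ε
... | yes red with reduce y red
...   | x , cover , lt with descend x (rec lt)
...     | z , two , s = z , two , bwd (inj₂ cover) ◅ s

-- Fibers as congruence classes

proposition4p4 : (n : ℕ) → n ≥ 1 → (R : GenericTiling n) → ∃ (Fiber R) →
    IsΓClass (Fiber R) × ∃! _≈_ (λ z → TwoClumped z × Fiber R z)
proposition4p4 n 0<n R (x , gx) = (x , λ y → mk⇔ (connect y) (λ s → Γ-fiber s gx)) ,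
    z , (two , gz) , λ (two′ , gw) → unique two two′ gz gw
  where
  unique : ∀ {z w} → TwoClumped z → TwoClumped w → Fiber R z → Fiber R w → z ≈ w
  unique {z} {w} two two′ gz gw = tame-unique z w (twoClumped⇒tame {x = z} two) (twoClumped⇒tame {x = w} two′)
    (fiber⇒same-data 0<n gz gw) (fiber⇒same-data 0<n gw gz)
  dx = descend x (<-wellFounded _)
  z = proj₁ dx
  two = proj₁ (proj₂ dx)
  gz = Γ-fiber (proj₂ (proj₂ dx)) gx
  -- `x` and `y` descend to two-clumped permutations of the same fiber. These agree pointwise by
  -- uniqueness, which is a generator of `≡Γ`, so the two descents can be joined.
  connect : ∀ y → Fiber R y → x ≡Γ y
  connect y gy =
    let w , two′ , s = descend y (<-wellFounded _)
    in proj₂ (proj₂ dx) ◅◅ fwd (inj₁ (unique two two′ gz (Γ-fiber s gy))) ◅ symmetric _ s
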